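{- Let $p$ be a prime with $p\equiv3\pmod4$ and $q=p^2$. Let $A(q)$ be the adjacency matrix of the Paley graph $\mathrm{Paley}(q)$ and $A^*(q)$ that of the Peisert graph $P^*(q)$, with respect to the same ordering of their common vertex set $\mathbb{F}_q$. Then (i) there is a number field whose ring of algebraic integers $D$ is such that $A(q)$ and $A^*(q)$ are similar over $D$, i.e. $CA(q)C^{ -1}=A^*(q)$ for some matrix $C$ invertible over $D$; (ii) $A(q)$ and $A^*(q)$ are similar over the local ring $\mathbb{Z}_{(\ell)}$ for every prime $\ell\in\mathbb{Z}$.
   Context: $\mathrm{Paley}(q)$ has vertex set $\mathbb{F}_q$, distinct $x,y$ adjacent iff $x-y$ is a nonzero square. With $\beta$ a primitive element of $\mathbb{F}_q$, $C_0$ the subgroup of nonzero fourth powers in $\mathbb{F}_q^\times$ and $S'=C_0\cup\beta C_0$, $P^*(q)$ has vertex set $\mathbb{F}_q$, distinct $x,y$ adjacent iff $x-y\in S'$. Two $n\times n$ matrices over an integral domain $D$ are similar over $D$ if $CAC^{ -1}=B$ for some $C$ invertible in the ring of $n\times n$ matrices over $D$. -}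

module Defs where

open import Data.Nat using (ℕ; zero; suc; NonZero; _∸_)
open import Data.Nat.Divisibility using (_∣_)
import Data.Nat as N
open import Data.Nat.DivMod using (_mod_)
open import Data.Fin using (Fin; toℕ)
open import Data.Fin.Properties using (_≟_)
open import Data.Bool using (Bool; true; false; if_then_else_; _∧_; _∨_; not)
open import Data.List using (List; foldr; map; cartesianProduct; allFin)
open import Data.Bool.ListAction using (any)
open import Data.Vec using (Vec; []; _∷_; zipWith; replicate; init; last)
import Data.Vec as V
open import Data.Integer using (ℤ)
open import Data.Rational using (ℚ; 0ℚ; 1ℚ; _+_; _*_; -_; _/_)
import Data.Rational as Q
open import Data.Product using (_×_; _,_; Σ; ∃)
open import Relation.Nullary using (¬_; does)
open import Relation.Binary.PropositionalEquality using (_≡_; _≢_)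

module Mat {I A : Set} (elems : List I) (_⊕_ _⊗_ : A → A → A) (𝟘 : A) where
  Matrix : Set
  Matrix = I → I → A

  _·_ : Matrix → Matrix → Matrix
  (M · N) x z = foldr _⊕_ 𝟘 (map (λ y → M x y ⊗ N y z) elems)

-- The field F_q, q = p², for a prime p ≡ 3 (mod 4), modelled concretely
-- as F_p[i] with i² = -1 (the polynomial x² + 1 is irreducible over F_p).

module _ (p : ℕ) .{{_ : NonZero p}} where

  Fp : Set
  Fp = Fin p

  _+p_ _*p_ : Fp → Fp → Fp
  a +p b = (toℕ a N.+ toℕ b) mod p
  a *p b = (toℕ a N.* toℕ b) mod p

  -p_ : Fp → Fp
  -p a = (p ∸ toℕ a) mod p

  0p : Fp
  0p = 0 mod p

  Fq : Set
  Fq = Fp × Fp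

  0q : Fq
  0q = 0p , 0p

  1q : Fq
  1q = 1 mod p , 0p

  _+q_ _-q_ _*q_ : Fq → Fq → Fq
  (a , b) +q (c , d) = (a +p c) , (b +p d)
  (a , b) -q (c , d) = (a +p (-p c)) , (b +p (-p d))
  (a , b) *q (c , d) = ((a *p c) +p (-p (b *p d))) , ((a *p d) +p (b *p c))

  _^q_ : Fq → ℕ → Fq
  x ^q zero = 1q
  x ^q suc k = x *q (x ^q k)

  _=q_ : Fq → Fq → Bool
  (a , b) =q (c , d) = does (a ≟ c) ∧ does (b ≟ d)

  elemsFq : List Fq
  elemsFq = cartesianProduct (allFin p) (allFin p)

  IsPrimitive : Fq → Set
  IsPrimitive β = (β ≢ 0q) × ((x : Fq) → x ≢ 0q → ∃ λ k → β ^q k ≡ x)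

  isNZSquare : Fq → Bool
  isNZSquare d = any (λ y → not (y =q 0q) ∧ ((y *q y) =q d)) elemsFq

  inC0 : Fq → Bool
  inC0 d = any (λ y → not (y =q 0q) ∧ ((y ^q 4) =q d)) elemsFq

  inβC0 : Fq → Fq → Bool
  inβC0 β d = any (λ y → not (y =q 0q) ∧ ((β *q (y ^q 4)) =q d)) elemsFq

  paleyAdj : Fq → Fq → Bool
  paleyAdj x y = not (x =q y) ∧ isNZSquare (x -q y)

  peisertAdj : Fq → Fq → Fq → Bool
  peisertAdj β x y = not (x =q y) ∧ (inC0 (x -q y) ∨ inβC0 β (x -q y))

-- Number fields, presented as K = ℚ[x]/(f) with f = xⁿ + c_{n-1}x^{n-1} + … + c₀,
-- n = suc m ≥ 1, elements as coefficient vectors (a₀ , … , a_{n-1}),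
-- required to be a field.

module NF {m : ℕ} (c : Vec ℚ (suc m)) where
  K : Set
  K = Vec ℚ (suc m)

  0K 1K : K
  0K = replicate _ 0ℚ
  1K = 1ℚ ∷ replicate _ 0ℚ

  ι : ℚ → K
  ι r = r ∷ replicate _ 0ℚ

  _+K_ : K → K → K
  _+K_ = zipWith _+_

  scale : ℚ → K → K
  scale r = V.map (r *_)

  mulX : K → K
  mulX a = zipWith _+_ (0ℚ ∷ init a) (V.map ((- last a) *_) c)

  private
    mulAux : ∀ {k} → Vec ℚ k → K → K
    mulAux [] b = 0K
    mulAux (a ∷ as) b = scale a b +K mulAux as (mulX b)

  _*K_ : K → K → K
  a *K b = mulAux a b

  _^K_ : K → ℕ → K
  α ^K zero = 1K
  α ^K suc k = α *K (α ^K k)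

  IsField : Set
  IsField = (a : K) → a ≢ 0K → ∃ λ b → a *K b ≡ 1K

  private
    evalAux : ∀ {d} → ℕ → Vec ℤ d → K → K
    evalAux i [] α = 0K
    evalAux i (e ∷ es) α = scale (e / 1) (α ^K i) +K evalAux (suc i) es α

  IsAlgInt : K → Set
  IsAlgInt α = ∃ λ d → Σ (Vec ℤ d) λ e → (α ^K d) +K evalAux 0 e α ≡ 0K

boolTo : {A : Set} → A → A → Bool → A
boolTo zero' one' b = if b then one' else zero'

SimilarOverIntegers : (p : ℕ) .{{_ : NonZero p}} → {m : ℕ} → Vec ℚ (suc m) →
                      (Fq p → Fq p → Bool) → (Fq p → Fq p → Bool) → Set
SimilarOverIntegers p c A B =
  Σ (Fq p → Fq p → K) λ C → Σ (Fq p → Fq p → K) λ C' →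
    ((x y : Fq p) → IsAlgInt (C x y) × IsAlgInt (C' x y)) ×
    ((x y : Fq p) → (C · C') x y ≡ Id x y) ×
    ((x y : Fq p) → (C' · C) x y ≡ Id x y) ×
    ((x y : Fq p) → (C · Â) x y ≡ (B̂ · C) x y)
  where
    open NF c
    open Mat (elemsFq p) _+K_ _*K_ 0K
    Id Â B̂ : Fq p → Fq p → K
    Id x y = boolTo 0K 1K (_=q_ p x y)
    Â x y = boolTo 0K 1K (A x y)
    B̂ x y = boolTo 0K 1K (B x y)

InZloc : ℕ → ℚ → Set
InZloc ℓ r = ¬ (ℓ ∣ Q.ℚ.denominatorℕ r)

SimilarOverZloc : ℕ → (p : ℕ) .{{_ : NonZero p}} →
                  (Fq p → Fq p → Bool) → (Fq p → Fq p → Bool) → Set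
SimilarOverZloc ℓ p A B =
  Σ (Fq p → Fq p → ℚ) λ C → Σ (Fq p → Fq p → ℚ) λ C' →
    ((x y : Fq p) → InZloc ℓ (C x y) × InZloc ℓ (C' x y)) ×
    ((x y : Fq p) → (C · C') x y ≡ Id x y) ×
    ((x y : Fq p) → (C' · C) x y ≡ Id x y) ×
    ((x y : Fq p) → (C · Â) x y ≡ (B̂ · C) x y)
  where
    open Mat (elemsFq p) _+_ _*_ 0ℚ
    Id Â B̂ : Fq p → Fq p → ℚ
    Id x y = boolTo 0ℚ 1ℚ (_=q_ p x y)
    Â x y = boolTo 0ℚ 1ℚ (A x y)
    B̂ x y = boolTo 0ℚ 1ℚ (B x y)

{-# OPTIONS --safe #-}

-- With s = (p + 1) / 2 and m = p + 1, the subgroup F_p^× of F_q^× consists of the powers of β^m, and 4 ∣ m.  So both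
-- graphs are unions of s of the m parallel classes of lines of the plane F_q over F_p: the class of β^i belongs to
-- Paley(q) for even i and to P*(q) for i ≡ 0, 1 (mod 4).  Let S be a set of s directions and N = ∑_{d ∈ S} B_d, where
-- B_d sums a function over the lines in direction d; N is the adjacency matrix plus s.  Up to similarity over ℤ, N
-- depends on p only, so the two adjacency matrices are already similar over ℤ, which gives (i) with D = ℤ, and (ii).
--
-- Normal form of N.  From N² = p N + s (s - 1) J one splits off the summand spanned by a unit vector δ, N δ and the
-- all-one function; on the complement N² = p N, hence N ~ [p I, B; 0, 0], with square blocks by the trace.  Conjugation
-- changes B by multiplication with GL(ℤ) on both sides and by multiples of p, and so brings it to [I, 0; 0, 0] as long as
-- B is singular modulo p.  What is left is the rank of N modulo p.
--
-- The rank of N modulo p is s² for every S.  Write functions on F_q as elements of the group ring of F_q, order S as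
-- d₁, …, d_s, let U be the complement of S and Δ_d = 1 - τ_d, so that B_d Δ_d = 0.  A basis of the functions modulo the
-- kernel of N consists of the elements Δ_{d₁} ⋯ Δ_{d_{j-1}} τ_e^b with b < s and e transversal to d_j.
-- Independence: multiplied by Δ_{d_{j+1}} ⋯ Δ_{d_s}, N reduces to B_{d_j}, and modulo d_j what remains is multiplication
-- by (1 - τ_e)^{s-1} on polynomials in τ_e of degree < s, where no wrap-around occurs since 2 (s - 1) < p.
-- Spanning: N annihilates ∏_S Δ, and annihilates ∏_U Δ modulo p because ∑_{S ∪ U} B_d = p + J; modulo d_j the latter
-- product is (1 - τ_e)^s, a monic relation of degree s.
module Submission where

open import Data.Nat using (ℕ; zero; suc; NonZero)
open import Data.Integer.Properties using (*-assoc; *-cancelˡ-≡; *-comm; *-commutativeSemigroup; *-distribʳ-+; *-distribˡ-+; *-identityʳ; *-identityˡ; *-zeroʳ; *-zeroˡ; +-assoc; +-comm; +-commutativeSemigroup; +-identityʳ; +-identityˡ; +-injective; +-inverseʳ; -1*i≡-i; abs-*; i*j≡0⇒i≡0∨j≡0; i-j≡0⇒i≡j; m-n≡m⊖n; neg-distribʳ-*; neg-distribˡ-*; pos-*; pos-+; suc-*; ⊖-≥)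
open import Data.Integer using (ℤ; +_; _+_; _*_; -_; _-_; 0ℤ; 1ℤ; -[1+_]; ∣_∣)
open import Data.Integer.Tactic.RingSolver using (solve-∀)
open import Data.Bool using (true; false; if_then_else_; Bool; not; _∧_; _∨_)
open import Data.Fin using (Fin; zero; suc; toℕ; fromℕ<; funToFin; finToFun)
open import Data.List using (List; []; _∷_; _++_; map; foldr; allFin; cartesianProduct; tabulate; length)
open import Data.Product using (Σ; ∃; _×_; _,_; proj₁; proj₂)
open import Data.Product.Properties using (≡-dec)
open import Data.Sum using (_⊎_; inj₁; inj₂; [_,_]; [_,_]′)
open import Data.Unit using (⊤; tt)
open import Function using (_∘_; id; const)
open import Relation.Nullary using (Dec; yes; no; does; ¬_; contradiction)
open import Relation.Nullary.Decidable using (¬?; decidable-stable; map′)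
open import Relation.Binary.PropositionalEquality using (_≡_; _≢_; refl; sym; trans; cong; cong₂; subst; module ≡-Reasoning)
open import Data.Empty using (⊥)
open import Function.Bundles using (_↔_; Inverse; mk↔ₛ′)
open import Data.Nat.GCD using (module Bézout; module GCD)
open import Data.Nat.Primality using (Prime; euclidsLemma; prime⇒irreducible; prime⇒nonZero; prime⇒nonTrivial)
open import Data.List.Relation.Unary.All using (All; []; _∷_)
open import Data.List.Relation.Unary.AllPairs using (AllPairs; []; _∷_)
open import Data.Nat.DivMod using (_mod_; _/_; _%_; m≡m%n+[m/n]*n; m%n<n; m<n⇒m%n≡m; [m+kn]%n≡m%n; m<n*o⇒m/o<n; n%n≡0)
open import Defs
open import Data.Fin.Permutation using (↔⇒≡)
open import Data.Bool.ListAction using (any)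
open import Data.List.Membership.Propositional using (_∈_)
open import Data.List.Membership.Propositional.Properties using (∈-cartesianProduct⁺; ∈-allFin)
open import Data.List.Relation.Unary.Any using (here; there)
open import Data.Rational using (ℚ; 0ℚ; 1ℚ; mkℚ)
open import Data.Vec using (Vec; []; _∷_)
import Data.Nat as ℕ
import Data.Integer as ℤ
import Data.Fin as Fin
import Data.Fin.Properties as Finₚ
import Data.Sum.Properties as Sumₚ
import Data.Nat.Properties as ℕₚ
import Data.Nat.Divisibility as ℕ∣
import Data.List as List
import Data.Integer.Divisibility.Signed as ∣ₛ
import Data.Sum as Sum
import Data.Integer.DivMod as ℤ÷
import Function.Properties.Inverse as ↔ₚ
import Data.Sum.Function.Propositional as ⊎ₚ
import Data.List.Properties as Listₚ
import Data.List.Relation.Unary.All as All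
import Data.List.Relation.Unary.All.Properties as Allₚ
import Data.Bool.Properties as Boolₚ
import Data.Rational as ℚ
import Data.Rational.Properties as ℚₚ
import Data.Nat.Coprimality as Coprimality

open import Algebra.Properties.CommutativeSemigroup +-commutativeSemigroup using () renaming (interchange to +-interchange)
open import Algebra.Properties.CommutativeSemigroup *-commutativeSemigroup using () renaming (x∙yz≈y∙xz to *-exchange)

-- Over ℤ the eigenvalues of N do not determine it: an eigenspace need not have an invariant
-- complement, and `[p I, B; 0, 0]` retains B modulo p. The three-dimensional summand is removed
-- first because the term s (s - 1) J prevents a quadratic equation for N. It is a direct summand
-- since three integral functionals have determinant exactly 1 on it, which uses 4 s (s - 1) = p² -
-- 1.
--
-- Singularity of B matters because GL(ℤ) preserves determinants up to sign: a pivot modulo p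
-- becomes 1 only with the help of another row, so the last pivot of a matrix that is invertible
-- modulo p resists. Counting excludes this case. Traces give B the size 2 s² - 2 s - 1, and the
-- rank of N modulo p is 2 plus that of B, so an invertible B would mean 2 s² - 2 s + 1 = s², that
-- is, s = 1.
--
-- The two bounds for the rank meet because S and U have the same size s. At each direction the s -
-- 1 other members of S leave s - 1 differences, against s - 1 known zeros, while the s members of U
-- provide a relation of degree s.

private variable
  I J K L : Set

-- Finite sums and linear maps between function spaces

∑ : {A : Set} → List A → (A → ℤ) → ℤ
∑ [] f = 0ℤ
∑ (x ∷ xs) f = f x + ∑ xs f

module _ {A : Set} where

  ∑-cong : ∀ (xs : List A) {f g : A → ℤ} → (∀ x → f x ≡ g x) → ∑ xs f ≡ ∑ xs g
  ∑-cong [] e = refl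
  ∑-cong (x ∷ xs) e = cong₂ _+_ (e x) (∑-cong xs e)

  ∑-zero : ∀ (xs : List A) {f : A → ℤ} → (∀ x → f x ≡ 0ℤ) → ∑ xs f ≡ 0ℤ
  ∑-zero [] e = refl
  ∑-zero (x ∷ xs) e = cong₂ _+_ (e x) (∑-zero xs e)

  ∑-+ : ∀ (xs : List A) (f g : A → ℤ) → ∑ xs (λ x → f x + g x) ≡ ∑ xs f + ∑ xs g
  ∑-+ [] f g = refl
  ∑-+ (x ∷ xs) f g = trans (cong (_+_ (f x + g x)) (∑-+ xs f g)) (+-interchange (f x) (g x) _ _)

  ∑-* : ∀ (xs : List A) k (f : A → ℤ) → ∑ xs (λ x → k * f x) ≡ k * ∑ xs f
  ∑-* [] k f = sym (*-zeroʳ k)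
  ∑-* (x ∷ xs) k f = trans (cong (_+_ (k * f x)) (∑-* xs k f)) (sym (*-distribˡ-+ k (f x) _))

  ∑-++ : ∀ (xs ys : List A) (f : A → ℤ) → ∑ (xs ++ ys) f ≡ ∑ xs f + ∑ ys f
  ∑-++ [] ys f = sym (+-identityˡ _)
  ∑-++ (x ∷ xs) ys f = trans (cong (_+_ (f x)) (∑-++ xs ys f)) (sym (+-assoc (f x) _ _))

  ∑-map : ∀ {B : Set} (g : A → B) (xs : List A) (f : B → ℤ) → ∑ (map g xs) f ≡ ∑ xs (f ∘ g)
  ∑-map g [] f = refl
  ∑-map g (x ∷ xs) f = cong (_+_ (f (g x))) (∑-map g xs f)

∑-swap : ∀ {A B : Set} (xs : List A) (ys : List B) (f : A → B → ℤ) →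
         ∑ xs (λ x → ∑ ys (f x)) ≡ ∑ ys (λ y → ∑ xs (λ x → f x y))
∑-swap [] ys f = sym (∑-zero ys (λ _ → refl))
∑-swap (x ∷ xs) ys f =
  trans (cong (_+_ (∑ ys (f x))) (∑-swap xs ys f)) (sym (∑-+ ys (f x) _))

∑-tabulate : ∀ {A : Set} {n} (g : Fin n → A) (f : A → ℤ) → ∑ (tabulate g) f ≡ ∑ (allFin n) (f ∘ g)
∑-tabulate {n = zero} g f = refl
∑-tabulate {n = suc n} g f =
  cong (_+_ (f (g zero))) (trans (∑-tabulate (g ∘ suc) f) (sym (∑-tabulate suc (f ∘ g))))

∑-Fin-suc : ∀ {n} (f : Fin (suc n) → ℤ) → ∑ (allFin (suc n)) f ≡ f zero + ∑ (allFin n) (f ∘ suc)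
∑-Fin-suc f = cong (_+_ (f zero)) (∑-tabulate suc f)

∑-× : ∀ {A B : Set} (xs : List A) (ys : List B) (f : A × B → ℤ) →
      ∑ (cartesianProduct xs ys) f ≡ ∑ xs (λ x → ∑ ys (λ y → f (x , y)))
∑-× [] ys f = refl
∑-× (x ∷ xs) ys f = trans (∑-++ (map (x ,_) ys) _ f) (cong₂ _+_ (∑-map (x ,_) ys f) (∑-× xs ys f))

indicator : {P : Set} → Dec P → ℤ
indicator d = if does d then 1ℤ else 0ℤ

indicator-yes : ∀ {P : Set} (d : Dec P) → P → indicator d ≡ 1ℤ
indicator-yes (yes _) _ = refl
indicator-yes (no ¬p) p = contradiction p ¬p

indicator-no : ∀ {P : Set} (d : Dec P) → ¬ P → indicator d ≡ 0ℤ
indicator-no (yes p) ¬p = contradiction p ¬p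
indicator-no (no _) _ = refl

-- The sifting property says in one equation that `elems` contains every element exactly once, and
-- it is the form in which linear algebra uses this. For `Fq p` the instances produce the very list
-- `elemsFq p`, so that `Sum` is the sum in the matrix product of the statement.
record Finite (I : Set) : Set where
  infix 4 _≟_
  field
    elems : List I
    _≟_ : (i j : I) → Dec (i ≡ j)
    ∑-indicator : ∀ i (f : I → ℤ) → ∑ elems (λ j → indicator (i ≟ j) * f j) ≡ f i

open Finite ⦃ ... ⦄ public

Sum : {I : Set} ⦃ _ : Finite I ⦄ → (I → ℤ) → ℤ
Sum = ∑ elems

indicator-map : ∀ {P Q : Set} (d : Dec P) (d′ : Dec Q) → (P → Q) → (Q → P) → indicator d ≡ indicator d′
indicator-map (yes p) d′ f g = sym (indicator-yes d′ (f p))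
indicator-map (no ¬p) d′ f g = sym (indicator-no d′ (¬p ∘ g))

∑-zeroˡ : ∀ {A : Set} (xs : List A) (k f : A → ℤ) → (∀ x → k x ≡ 0ℤ) → ∑ xs (λ x → k x * f x) ≡ 0ℤ
∑-zeroˡ xs k f e = ∑-zero xs (λ x → trans (cong (_* f x) (e x)) (*-zeroˡ (f x)))

Fin-∑-indicator : ∀ {n} (i : Fin n) (f : Fin n → ℤ) → ∑ (allFin n) (λ j → indicator (i Fin.≟ j) * f j) ≡ f i
Fin-∑-indicator {suc n} zero f =
  trans (∑-Fin-suc (λ j → indicator (zero Fin.≟ j) * f j))
  (trans (cong₂ _+_ (*-identityˡ (f zero)) (∑-zeroˡ (allFin n) _ (f ∘ suc) (λ _ → refl)))
         (+-identityʳ (f zero)))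
Fin-∑-indicator {suc n} (suc i) f =
  trans (∑-Fin-suc (λ j → indicator (suc i Fin.≟ j) * f j))
  (trans (cong₂ _+_ (*-zeroˡ (f zero))
           (∑-cong (allFin n) (λ j → cong (_* f (suc j)) (indicator-map (suc i Fin.≟ suc j) (i Fin.≟ j) Finₚ.suc-injective (cong suc)))))
  (trans (+-identityˡ _) (Fin-∑-indicator i (f ∘ suc))))

instance
  Finite-Fin : ∀ {n} → Finite (Fin n)
  Finite-Fin {n} = record { elems = allFin n ; _≟_ = Fin._≟_ ; ∑-indicator = Fin-∑-indicator }

  Finite-⊎ : ∀ {I J : Set} ⦃ FI : Finite I ⦄ ⦃ FJ : Finite J ⦄ → Finite (I ⊎ J)
  Finite-⊎ {I} {J} ⦃ FI ⦄ ⦃ FJ ⦄ = record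
    { elems = map inj₁ elems ++ map inj₂ elems
    ; _≟_ = eq
    ; ∑-indicator = λ k f →
        trans (∑-++ (map inj₁ is) (map inj₂ js) _)
        (trans (cong₂ _+_ (∑-map inj₁ is _) (∑-map inj₂ js _)) (split k f))
    }
    where
    is = elems ⦃ FI ⦄
    js = elems ⦃ FJ ⦄
    eq : (i j : I ⊎ J) → Dec (i ≡ j)
    eq = Sumₚ.≡-dec _≟_ _≟_
    split : ∀ k (f : I ⊎ J → ℤ) →
      ∑ is (λ j → indicator (eq k (inj₁ j)) * f (inj₁ j)) + ∑ js (λ j → indicator (eq k (inj₂ j)) * f (inj₂ j)) ≡ f k
    split (inj₁ i) f = trans (cong₂ _+_
      (trans (∑-cong is (λ j → cong (_* f (inj₁ j)) (indicator-map (eq (inj₁ i) (inj₁ j)) (i ≟ j) Sumₚ.inj₁-injective (cong inj₁))))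
             (∑-indicator i (f ∘ inj₁)))
      (∑-zeroˡ js _ (f ∘ inj₂) (λ _ → refl))) (+-identityʳ _)
    split (inj₂ i) f = trans (cong₂ _+_
      (∑-zeroˡ is _ (f ∘ inj₁) (λ _ → refl))
      (trans (∑-cong js (λ j → cong (_* f (inj₂ j)) (indicator-map (eq (inj₂ i) (inj₂ j)) (i ≟ j) Sumₚ.inj₂-injective (cong inj₂))))
             (∑-indicator i (f ∘ inj₂)))) (+-identityˡ _)

  Finite-× : ∀ {I J : Set} ⦃ FI : Finite I ⦄ ⦃ FJ : Finite J ⦄ → Finite (I × J)
  Finite-× {I} {J} ⦃ FI ⦄ ⦃ FJ ⦄ = record
    { elems = cartesianProduct elems elems
    ; _≟_ = eq
    ; ∑-indicator = λ (i , j) f →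
        trans (∑-× is js _)
        (trans (∑-cong is (λ i′ → trans (∑-cong js (λ j′ → factor i j i′ j′ f)) (∑-* js (indicator (i ≟ i′)) (λ j′ → indicator (j ≟ j′) * f (i′ , j′)))))
        (trans (∑-indicator i (λ i′ → ∑ js (λ j′ → indicator (j ≟ j′) * f (i′ , j′)))) (∑-indicator j (λ j′ → f (i , j′)))))
    }
    where
    is = elems ⦃ FI ⦄
    js = elems ⦃ FJ ⦄
    eq : (i j : I × J) → Dec (i ≡ j)
    eq = ≡-dec _≟_ _≟_
    factor : ∀ i j i′ j′ (f : I × J → ℤ) → indicator (eq (i , j) (i′ , j′)) * f (i′ , j′)
             ≡ indicator (i ≟ i′) * (indicator (j ≟ j′) * f (i′ , j′))
    factor i j i′ j′ f = trans (cong (_* f (i′ , j′)) (product (i ≟ i′) (j ≟ j′)))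
      (*-assoc (indicator (i ≟ i′)) (indicator (j ≟ j′)) (f (i′ , j′)))
      where
      product : ∀ {i i′ : I} {j j′ : J} (d : Dec (i ≡ i′)) (d′ : Dec (j ≡ j′)) →
                indicator (eq (i , j) (i′ , j′)) ≡ indicator d * indicator d′
      product (yes p) (yes q) = indicator-yes (eq _ _) (cong₂ _,_ p q)
      product (yes p) (no ¬q) = indicator-no (eq _ _) (¬q ∘ cong proj₂)
      product (no ¬p) d′ = trans (indicator-no (eq _ _) (¬p ∘ cong proj₁)) (sym (*-zeroˡ (indicator d′)))

infix 4 _≐_
_≐_ : {I : Set} → (I → ℤ) → (I → ℤ) → Set
v ≐ w = ∀ i → v i ≡ w i

-- Linear maps are operators rather than arrays of entries, so that compositions, blocks and
-- translations involve no sums. The entry in row `j` and column `i` is `ap f (unit i) j`.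
record Lin (I J : Set) : Set where
  field
    ap : (I → ℤ) → J → ℤ
    ap-cong : ∀ {v w} → v ≐ w → ap v ≐ ap w
    ap-+ : ∀ v w → ap (λ i → v i + w i) ≐ λ j → ap v j + ap w j
    ap-* : ∀ k v → ap (λ i → k * v i) ≐ λ j → k * ap v j

open Lin public

End : Set → Set
End I = Lin I I

ap-0 : (f : Lin I J) → ap f (λ _ → 0ℤ) ≐ λ _ → 0ℤ
ap-0 f j = trans (ap-* f 0ℤ (λ _ → 0ℤ) j) (*-zeroˡ (ap f (λ _ → 0ℤ) j))

ap-neg : (f : Lin I J) → ∀ v → ap f (λ i → - v i) ≐ λ j → - ap f v j
ap-neg f v j = trans (ap-cong f (λ i → sym (-1*i≡-i (v i))) j)
               (trans (ap-* f (- 1ℤ) v j) (-1*i≡-i _))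

ap-sub : (f : Lin I J) → ∀ v w → ap f (λ i → v i - w i) ≐ λ j → ap f v j - ap f w j
ap-sub f v w j = trans (ap-+ f v (λ i → - w i) j) (cong (_+_ (ap f v j)) (ap-neg f w j))

ap-∑ : ∀ {A : Set} (f : Lin I J) (xs : List A) (k : A → ℤ) (v : A → I → ℤ) →
       ap f (λ i → ∑ xs (λ x → k x * v x i)) ≐ λ j → ∑ xs (λ x → k x * ap f (v x) j)
ap-∑ f [] k v j = ap-0 f j
ap-∑ f (x ∷ xs) k v j =
  trans (ap-+ f (λ i → k x * v x i) _ j) (cong₂ _+_ (ap-* f (k x) (v x) j) (ap-∑ f xs k v j))

Image : Lin I J → (J → ℤ) → Set
Image {I} f v = Σ (I → ℤ) λ w → v ≐ ap f w

Image-cong : (f : Lin I J) → ∀ {v v′} → v ≐ v′ → Image f v → Image f v′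
Image-cong f e (w , q) = w , λ j → trans (sym (e j)) (q j)

Image-+ : (f : Lin I J) → ∀ {v v′} → Image f v → Image f v′ → Image f (λ j → v j + v′ j)
Image-+ f (w , q) (w′ , q′) = (λ i → w i + w′ i) , λ j → trans (cong₂ _+_ (q j) (q′ j)) (sym (ap-+ f w w′ j))

Image-* : (f : Lin I J) → ∀ k {v} → Image f v → Image f (λ j → k * v j)
Image-* f k (w , q) = (λ i → k * w i) , λ j → trans (cong (_*_ k) (q j)) (sym (ap-* f k w j))

Image-sub : (f : Lin I J) → ∀ {v v′} → Image f v → Image f v′ → Image f (λ j → v j - v′ j)
Image-sub f (w , q) (w′ , q′) = (λ i → w i - w′ i) , λ j → trans (cong₂ _-_ (q j) (q′ j)) (sym (ap-sub f w w′ j))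

idL : Lin I I
idL = record { ap = id ; ap-cong = id ; ap-+ = λ _ _ _ → refl ; ap-* = λ _ _ _ → refl }

infixr 9 _∘L_
_∘L_ : Lin J K → Lin I J → Lin I K
g ∘L f = record
  { ap = ap g ∘ ap f
  ; ap-cong = ap-cong g ∘ ap-cong f
  ; ap-+ = λ v w k → trans (ap-cong g (ap-+ f v w) k) (ap-+ g (ap f v) (ap f w) k)
  ; ap-* = λ c v k → trans (ap-cong g (ap-* f c v) k) (ap-* g c (ap f v) k)
  }

0L : Lin I J
0L = record { ap = λ _ _ → 0ℤ ; ap-cong = λ _ _ → refl ; ap-+ = λ _ _ _ → refl
            ; ap-* = λ c _ _ → sym (*-zeroʳ c) }

infixl 6 _+L_
_+L_ : Lin I J → Lin I J → Lin I J
f +L g = record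
  { ap = λ v j → ap f v j + ap g v j
  ; ap-cong = λ e j → cong₂ _+_ (ap-cong f e j) (ap-cong g e j)
  ; ap-+ = λ v w j → trans (cong₂ _+_ (ap-+ f v w j) (ap-+ g v w j)) (+-interchange (ap f v j) (ap f w j) _ _)
  ; ap-* = λ c v j → trans (cong₂ _+_ (ap-* f c v j) (ap-* g c v j)) (sym (*-distribˡ-+ c (ap f v j) _))
  }

infixr 7 _∙L_
_∙L_ : ℤ → Lin I J → Lin I J
k ∙L f = record
  { ap = λ v j → k * ap f v j
  ; ap-cong = λ e j → cong (_*_ k) (ap-cong f e j)
  ; ap-+ = λ v w j → trans (cong (_*_ k) (ap-+ f v w j)) (*-distribˡ-+ k (ap f v j) _)
  ; ap-* = λ c v j → trans (cong (_*_ k) (ap-* f c v j)) (*-exchange k c (ap f v j))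
  }

reindex : (J → I) → Lin I J
reindex h = record { ap = λ v → v ∘ h ; ap-cong = λ e j → e (h j) ; ap-+ = λ _ _ _ → refl ; ap-* = λ _ _ _ → refl }

infix 5 _⊗_
_⊗_ : (J → ℤ) → Lin I ⊤ → Lin I J
w ⊗ φ = record
  { ap = λ v j → ap φ v tt * w j
  ; ap-cong = λ e j → cong (_* w j) (ap-cong φ e tt)
  ; ap-+ = λ v v′ j → trans (cong (_* w j) (ap-+ φ v v′ tt)) (*-distribʳ-+ (w j) (ap φ v tt) _)
  ; ap-* = λ c v j → trans (cong (_* w j) (ap-* φ c v tt)) (*-assoc c (ap φ v tt) (w j))
  }

⟨_,_⟩ : Lin K I → Lin K J → Lin K (I ⊎ J)
⟨ f , g ⟩ = record
  { ap = λ v → [ ap f v , ap g v ]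
  ; ap-cong = λ { e (inj₁ i) → ap-cong f e i ; e (inj₂ j) → ap-cong g e j }
  ; ap-+ = λ { v w (inj₁ i) → ap-+ f v w i ; v w (inj₂ j) → ap-+ g v w j }
  ; ap-* = λ { c v (inj₁ i) → ap-* f c v i ; c v (inj₂ j) → ap-* g c v j }
  }

infixr 5 _◂_
_◂_ : ∀ {n} {A : Set} → A → (Fin n → A) → Fin (suc n) → A
(a ◂ v) zero = a
(a ◂ v) (suc i) = v i

infixr 5 _◂L_
_◂L_ : ∀ {n} → Lin I ⊤ → Lin I (Fin n) → Lin I (Fin (suc n))
φ ◂L f = record
  { ap = λ v → ap φ v tt ◂ ap f v
  ; ap-cong = λ { e zero → ap-cong φ e tt ; e (suc i) → ap-cong f e i }
  ; ap-+ = λ { v w zero → ap-+ φ v w tt ; v w (suc i) → ap-+ f v w i }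
  ; ap-* = λ { c v zero → ap-* φ c v tt ; c v (suc i) → ap-* f c v i }
  }

eval : I → Lin I ⊤
eval i = reindex (const i)

π₁ : Lin (I ⊎ J) I
π₁ = reindex inj₁

π₂ : Lin (I ⊎ J) J
π₂ = reindex inj₂

ι₁ : Lin I (I ⊎ J)
ι₁ = ⟨ idL , 0L ⟩

ι₂ : Lin J (I ⊎ J)
ι₂ = ⟨ 0L , idL ⟩

unit : ⦃ _ : Finite I ⦄ → I → I → ℤ
unit i j = indicator (i ≟ j)

unit-sym : ⦃ _ : Finite I ⦄ → ∀ i j → unit {I} i j ≡ unit j i
unit-sym i j = indicator-map (i ≟ j) (j ≟ i) sym sym

unit-diag : ⦃ _ : Finite I ⦄ → ∀ i → unit {I} i i ≡ 1ℤ
unit-diag i = indicator-yes (i ≟ i) refl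

expand : ⦃ _ : Finite I ⦄ (v : I → ℤ) → v ≐ λ i → Sum (λ j → v j * unit j i)
expand v i = sym (trans (∑-cong elems (λ j → trans (*-comm (v j) (unit j i)) (cong (_* v j) (unit-sym j i))))
                        (∑-indicator i v))

ap-expand : ⦃ _ : Finite I ⦄ (f : Lin I J) (v : I → ℤ) → ap f v ≐ λ j → Sum (λ i → v i * ap f (unit i) j)
ap-expand f v j = trans (ap-cong f (expand v) j) (ap-∑ f elems v unit j)

trace : ⦃ _ : Finite I ⦄ → End I → ℤ
trace M = Sum (λ i → ap M (unit i) i)

trace-cong : ⦃ _ : Finite I ⦄ {M N : End I} → (∀ v → ap M v ≐ ap N v) → trace M ≡ trace N
trace-cong e = ∑-cong elems (λ i → e (unit i) i)

trace-+ : ⦃ _ : Finite I ⦄ (M N : End I) → trace (M +L N) ≡ trace M + trace N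
trace-+ M N = ∑-+ elems (λ i → ap M (unit i) i) (λ i → ap N (unit i) i)

trace-∙ : ⦃ _ : Finite I ⦄ (k : ℤ) (M : End I) → trace (k ∙L M) ≡ k * trace M
trace-∙ k M = ∑-* elems k (λ i → ap M (unit i) i)

trace-comm : ⦃ _ : Finite I ⦄ ⦃ _ : Finite J ⦄ (f : Lin I J) (g : Lin J I) → trace (g ∘L f) ≡ trace (f ∘L g)
trace-comm f g =
  trans (∑-cong elems (λ i → ap-expand g (ap f (unit i)) i))
  (trans (∑-swap elems elems (λ i j → ap f (unit i) j * ap g (unit j) i))
  (∑-cong elems (λ j → trans (∑-cong elems (λ i → *-comm (ap f (unit i) j) (ap g (unit j) i)))
                              (sym (ap-expand f (ap g (unit j)) j)))))

-- Similarity over ℤ and block sums.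

record Iso (I J : Set) : Set where
  field
    to : Lin I J
    from : Lin J I
    from-to : ∀ v → ap from (ap to v) ≐ v
    to-from : ∀ w → ap to (ap from w) ≐ w

open Iso public

idI : Iso I I
idI = record { to = idL ; from = idL ; from-to = λ _ _ → refl ; to-from = λ _ _ → refl }

symI : Iso I J → Iso J I
symI P = record { to = from P ; from = to P ; from-to = to-from P ; to-from = from-to P }

infixr 9 _∘I_
_∘I_ : Iso J K → Iso I J → Iso I K
Q ∘I P = record
  { to = to Q ∘L to P ; from = from P ∘L from Q
  ; from-to = λ v i → trans (ap-cong (from P) (from-to Q (ap (to P) v)) i) (from-to P v i)
  ; to-from = λ w k → trans (ap-cong (to Q) (to-from P (ap (from Q) w)) k) (to-from Q w k)
  }

reindexI : I ↔ J → Iso I J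
reindexI h = record
  { to = reindex (Inverse.from h) ; from = reindex (Inverse.to h)
  ; from-to = λ v i → cong v (Inverse.strictlyInverseʳ h i)
  ; to-from = λ w j → cong w (Inverse.strictlyInverseˡ h j)
  }

record Similar (M : End I) (N : End J) : Set where
  constructor _by_
  field
    iso : Iso I J
    intertwines : ∀ v → ap (to iso) (ap M v) ≐ ap N (ap (to iso) v)

open Similar public

Similar-sym : {M : End I} {N : End J} → Similar M N → Similar N M
Similar-sym {M = M} {N} (P by e) = symI P by λ w i →
  trans (ap-cong (from P) (λ j → trans (ap-cong N (λ k → sym (to-from P w k)) j) (sym (e (ap (from P) w) j))) i)
        (from-to P (ap M (ap (from P) w)) i)

Similar-trans : {M : End I} {N : End J} {O : End K} → Similar M N → Similar N O → Similar M O
Similar-trans (P by e) (Q by f) = (Q ∘I P) by λ v k → trans (ap-cong (to Q) (e v) k) (f (ap (to P) v) k)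

conjugate : (P : Iso I J) (M : End I) → Similar M (to P ∘L M ∘L from P)
conjugate P M = P by λ v → ap-cong (to P) (ap-cong M (λ i → sym (from-to P v i)))

Similar-trace : ⦃ _ : Finite I ⦄ ⦃ _ : Finite J ⦄ {M : End I} {N : End J} → Similar M N → trace M ≡ trace N
Similar-trace {M = M} {N} (P by e) =
  trans (trace-cong {M = M} {from P ∘L (to P ∘L M)} (λ v i → sym (from-to P (ap M v) i)))
  (trans (trace-comm (to P ∘L M) (from P))
  (trace-cong {M = to P ∘L M ∘L from P} {N} (λ w j → trans (e (ap (from P) w) j) (ap-cong N (to-from P w) j))))

infixr 5 _⊞_ _⊕_
_⊞_ : Lin I J → Lin K L → Lin (I ⊎ K) (J ⊎ L)
f ⊞ g = ⟨ f ∘L π₁ , g ∘L π₂ ⟩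

_⊕_ : Iso I J → Iso K L → Iso (I ⊎ K) (J ⊎ L)
P ⊕ Q = record
  { to = to P ⊞ to Q ; from = from P ⊞ from Q
  ; from-to = λ { v (inj₁ i) → from-to P (v ∘ inj₁) i ; v (inj₂ k) → from-to Q (v ∘ inj₂) k }
  ; to-from = λ { w (inj₁ j) → to-from P (w ∘ inj₁) j ; w (inj₂ l) → to-from Q (w ∘ inj₂) l }
  }

fixFirst : ∀ {m n} → Iso (Fin m) (Fin n) → Iso (Fin (suc m)) (Fin (suc n))
fixFirst P = record
  { to = eval zero ◂L to P ∘L reindex suc ; from = eval zero ◂L from P ∘L reindex suc
  ; from-to = λ { v zero → refl ; v (suc i) → from-to P (v ∘ suc) i }
  ; to-from = λ { w zero → refl ; w (suc j) → to-from P (w ∘ suc) j }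
  }

-- Triangularising integer matrices

-- The combination equal to 1 is one of the cofactors, not of a and b themselves. This way a = b = 0
-- is no exception (g = 0 with cofactors 1 and 0), and the cofactors always complete to a unimodular
-- matrix.
record Bezout (a b : ℤ) : Set where
  field
    g a′ b′ x y : ℤ
    a≡ : a ≡ g * a′
    b≡ : b ≡ g * b′
    bezout : x * a′ + y * b′ ≡ 1ℤ

open ℕ∣ using (divides)
open GCD using () renaming (commonDivisor to gcd-common)

bezout-ℕ : ∀ m n → Bezout (+ m) (+ n)
bezout-ℕ m n with Bézout.lemma m n
... | Bézout.result ℕ.zero g _ = record
  { g = 0ℤ ; a′ = 1ℤ ; b′ = 0ℤ ; x = 1ℤ ; y = 0ℤ
  ; a≡ = cong +_ (ℕ∣.0∣⇒≡0 (proj₁ (gcd-common g))) ; b≡ = cong +_ (ℕ∣.0∣⇒≡0 (proj₂ (gcd-common g))) ; bezout = refl }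
... | Bézout.result d@(suc _) g identity with gcd-common g
...   | divides m′ m≡ , divides n′ n≡ with coefficients identity
  where
  rearrange : ∀ d u v → d + v ≡ u → u + - v ≡ d
  rearrange d _ v refl = cancel d v
    where
    cancel : ∀ d v → d + v + - v ≡ d
    cancel = solve-∀
  +-coefficients : ∀ x m y n → d ℕ.+ y ℕ.* n ≡ x ℕ.* m → + x * + m + - (+ y) * + n ≡ + d
  +-coefficients x m y n e =
    trans (cong₂ _+_ (sym (pos-* x m)) (trans (sym (neg-distribˡ-* (+ y) (+ n))) (cong -_ (sym (pos-* y n)))))
          (rearrange (+ d) (+ (x ℕ.* m)) (+ (y ℕ.* n)) (trans (sym (pos-+ d (y ℕ.* n))) (cong +_ e)))
  coefficients : Bézout.Identity d m n → Σ ℤ λ x → Σ ℤ λ y → x * + m + y * + n ≡ + d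
  coefficients (Bézout.+- x y e) = + x , - (+ y) , +-coefficients x m y n e
  coefficients (Bézout.-+ x y e) = - (+ x) , + y , trans (+-comm (- (+ x) * + m) (+ y * + n)) (+-coefficients y n x m e)
...     | x , y , e = record
  { g = + d ; a′ = + m′ ; b′ = + n′ ; x = x ; y = y
  ; a≡ = factor m m′ m≡ ; b≡ = factor n n′ n≡
  ; bezout = *-cancelˡ-≡ (+ d) _ _ (trans (regroup (+ d) x (+ m′) y (+ n′))
      (trans (cong₂ (λ s t → x * s + y * t) (sym (factor m m′ m≡)) (sym (factor n n′ n≡)))
      (trans e (sym (*-identityʳ (+ d))))))
  }
  where
  factor : ∀ k k′ → k ≡ k′ ℕ.* d → + k ≡ + d * + k′
  factor k k′ e = trans (cong +_ (trans e (ℕₚ.*-comm k′ d))) (pos-* d k′)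
  regroup : ∀ g x a y b → g * (x * a + y * b) ≡ x * (g * a) + y * (g * b)
  regroup = solve-∀

bezout-neg : ∀ {a b} → Bezout a b → Bezout (- a) b
bezout-neg B = record
  { g = g ; a′ = - a′ ; b′ = b′ ; x = - x ; y = y
  ; a≡ = trans (cong -_ a≡) (neg-distribʳ-* g a′) ; b≡ = b≡ ; bezout = trans (negate x a′ (y * b′)) bezout }
  where
  open Bezout B
  negate : ∀ x a z → - x * - a + z ≡ x * a + z
  negate = solve-∀

bezout-swap : ∀ {a b} → Bezout a b → Bezout b a
bezout-swap B = record { g = g ; a′ = b′ ; b′ = a′ ; x = y ; y = x ; a≡ = b≡ ; b≡ = a≡ ; bezout = trans (+-comm (y * b′) (x * a′)) bezout }
  where open Bezout B

bezoutLemma : ∀ a b → Bezout a b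
bezoutLemma (+ m) (+ n) = bezout-ℕ m n
bezoutLemma -[1+ m ] (+ n) = bezout-neg (bezout-ℕ (suc m) n)
bezoutLemma (+ m) -[1+ n ] = bezout-swap (bezout-neg (bezout-swap (bezout-ℕ m (suc n))))
bezoutLemma -[1+ m ] -[1+ n ] = bezout-neg (bezout-swap (bezout-neg (bezout-swap (bezout-ℕ (suc m) (suc n)))))

-- The matrix `[x, y; -b, a]` on the first two coordinates, of determinant 1. If a and b are the
-- cofactors of two entries, it replaces these entries by their gcd and 0.
rotate : ∀ {n} (x y a b : ℤ) → x * a + y * b ≡ 1ℤ → Iso (Fin (suc (suc n))) (Fin (suc (suc n)))
rotate {n} x y a b unimodular = record
  { to = x ∙L e₀ +L y ∙L e₁ ◂L (- b) ∙L e₀ +L a ∙L e₁ ◂L rest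
  ; from = a ∙L e₀ +L (- y) ∙L e₁ ◂L b ∙L e₀ +L x ∙L e₁ ◂L rest
  ; from-to = λ { v zero → trans (left₀ x y a b _ _) (det (v zero)) ; v (suc zero) → trans (left₁ x y a b _ _) (det (v (suc zero))) ; v (suc (suc i)) → refl }
  ; to-from = λ { v zero → trans (right₀ x y a b _ _) (det (v zero)) ; v (suc zero) → trans (right₁ x y a b _ _) (det (v (suc zero))) ; v (suc (suc i)) → refl }
  }
  where
  e₀ = eval zero
  e₁ = eval (suc zero)
  rest : Lin (Fin (suc (suc n))) (Fin n)
  rest = reindex λ i → Fin.suc (Fin.suc i)
  det : ∀ c → (x * a + y * b) * c ≡ c
  det c = trans (cong (_* c) unimodular) (*-identityˡ c)
  left₀ : ∀ x y a b u v → a * (x * u + y * v) + - y * (- b * u + a * v) ≡ (x * a + y * b) * u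
  left₀ = solve-∀
  left₁ : ∀ x y a b u v → b * (x * u + y * v) + x * (- b * u + a * v) ≡ (x * a + y * b) * v
  left₁ = solve-∀
  right₀ : ∀ x y a b u v → x * (a * u + - y * v) + y * (b * u + x * v) ≡ (x * a + y * b) * u
  right₀ = solve-∀
  right₁ : ∀ x y a b u v → - b * (a * u + - y * v) + a * (b * u + x * v) ≡ (x * a + y * b) * v
  right₁ = solve-∀

reduceVector : ∀ n (v : Fin (suc n) → ℤ) →
               Σ (Iso (Fin (suc n)) (Fin (suc n))) λ P → ∀ i → ap (to P) v (suc i) ≡ 0ℤ
reduceVector zero v = idI , λ ()
reduceVector (suc n) v with reduceVector n (v ∘ suc)
... | P , clear = rotate x y a′ b′ bezout ∘I fixFirst P , λ
  { zero → trans (cong₂ (λ s t → - b′ * s + a′ * t) a≡ b≡) (cancel g a′ b′) ; (suc i) → clear i }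
  where
  open Bezout (bezoutLemma (v zero) (ap (to P) (v ∘ suc) zero))
  cancel : ∀ g a b → - b * (g * a) + a * (g * b) ≡ 0ℤ
  cancel = solve-∀

cancel-*ˡ : ∀ {g} → g ≢ 0ℤ → ∀ a b → g * a ≡ g * b → a ≡ b
cancel-*ˡ {g} g≢0 a b = *-cancelˡ-≡ g a b ⦃ ℤ.≢-nonZero g≢0 ⦄

cancel-*ˡ-0 : ∀ {g} → g ≢ 0ℤ → ∀ a → g * a ≡ 0ℤ → a ≡ 0ℤ
cancel-*ˡ-0 {g} g≢0 a e = cancel-*ˡ g≢0 a 0ℤ (trans e (sym (*-zeroʳ g)))

+-cancelˡ : ∀ a b c → a + b ≡ a + c → b ≡ c
+-cancelˡ a b c e = trans (sym (shift a b)) (trans (cong (_+_ (- a)) e) (shift a c))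
  where
  shift : ∀ a b → - a + (a + b) ≡ b
  shift = solve-∀

-- The block matrix `[c I, B; 0, 0]`.
upper : ℤ → Lin J I → End (I ⊎ J)
upper c B = ⟨ c ∙L π₁ +L B ∘L π₂ , 0L ⟩

first : ∀ {n} → Fin (suc n) → ℤ
first = 1ℤ ◂ const 0ℤ

embed : ∀ {n} → Lin (Fin n) (Fin (suc n))
embed = 0L ◂L idL

decompose : ∀ {n} (v : Fin (suc n) → ℤ) → v ≐ λ i → v zero * first i + ap embed (v ∘ suc) i
decompose v zero = sym (trans (+-identityʳ _) (*-identityʳ (v zero)))
decompose v (suc i) = sym (trans (cong (_+ v (suc i)) (*-zeroʳ (v zero))) (+-identityˡ _))

ap-decompose : ∀ {n} (f : Lin (Fin (suc n)) I) (v : Fin (suc n) → ℤ) →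
               ap f v ≐ λ i → v zero * ap f first i + ap f (ap embed (v ∘ suc)) i
ap-decompose f v i = trans (ap-cong f (decompose v) i)
  (trans (ap-+ f (λ j → v zero * first j) (ap embed (v ∘ suc)) i)
         (cong (_+ ap f (ap embed (v ∘ suc)) i) (ap-* f (v zero) first i)))

prepend : ∀ {n r t} → Iso (Fin n) (Fin r ⊎ Fin t) → Iso (Fin (suc n)) (Fin (suc r) ⊎ Fin t)
prepend P = record
  { to = ⟨ eval zero ◂L π₁ ∘L to P ∘L reindex suc , π₂ ∘L to P ∘L reindex suc ⟩
  ; from = eval zero ∘L π₁ ◂L from P ∘L ⟨ reindex suc ∘L π₁ , π₂ ⟩
  ; from-to = λ { v zero → refl
                ; v (suc k) → trans (ap-cong (from P) (λ { (inj₁ _) → refl ; (inj₂ _) → refl }) k) (from-to P (v ∘ suc) k) }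
  ; to-from = λ { w (inj₁ zero) → refl
                ; w (inj₁ (suc k)) → to-from P [ w ∘ inj₁ ∘ suc , w ∘ inj₂ ] (inj₁ k)
                ; w (inj₂ k) → to-from P [ w ∘ inj₁ ∘ suc , w ∘ inj₂ ] (inj₂ k) }
  }

record Triangular {n} (c : ℤ) (M : End (Fin n)) : Set where
  field
    r t : ℕ
    r+t : r ℕ.+ t ≡ n
    B : Lin (Fin t) (Fin r)
    similar : Similar M (upper c B)

-- By M² = c M, every column of M is an eigenvector for c. A nonzero column divided by its content g
-- is still one, and being primitive it extends to a basis of the lattice.
firstColumn : ∀ {n c} → c ≢ 0ℤ → (M : End (Fin (suc n))) → (∀ v → ap M (ap M v) ≐ λ i → c * ap M v i) →
              ∀ {i j} → ap M (unit i) j ≢ 0ℤ →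
              Σ (Iso (Fin (suc n)) (Fin (suc n))) λ P → ap (to P ∘L M ∘L from P) first ≐ λ k → c * first k
firstColumn {n} {c} c≢0 M square {i} {j} entry≢0 = P , λ k → cancel-*ˡ g≢0 _ _ (begin
  g * ap M₁ first k                        ≡⟨ ap-* M₁ g first k ⟨
  ap M₁ (λ l → g * first l) k              ≡⟨ ap-cong M₁ (λ l → sym (reduced l)) k ⟩
  ap M₁ (ap (to P) w) k                    ≡⟨ ap-cong (to P ∘L M) (from-to P w) k ⟩
  ap (to P) (ap M w) k                     ≡⟨ ap-cong (to P) (square (unit i)) k ⟩
  ap (to P) (λ l → c * w l) k              ≡⟨ ap-* (to P) c w k ⟩
  c * ap (to P) w k                        ≡⟨ cong (_*_ c) (reduced k) ⟩
  c * (g * first k)                        ≡⟨ *-exchange c g (first k) ⟩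
  g * (c * first k)                        ∎)
  where
  open ≡-Reasoning
  w = ap M (unit i)
  P = proj₁ (reduceVector n w)
  M₁ = to P ∘L M ∘L from P
  g = ap (to P) w zero
  reduced : ap (to P) w ≐ λ l → g * first l
  reduced zero = sym (*-identityʳ g)
  reduced (suc l) = trans (proj₂ (reduceVector n w) l) (sym (*-zeroʳ g))
  g≢0 : g ≢ 0ℤ
  g≢0 g≡0 = entry≢0 (trans (sym (from-to P w j))
    (trans (ap-cong (from P) (λ l → trans (reduced l) (trans (cong (_* first l) g≡0) (*-zeroˡ (first l)))) j) (ap-0 (from P) j)))

-- Once the first basis vector is an eigenvector, M becomes `[c, ρ; 0, M″]` and M″ satisfies the
-- same equation. What has to be checked is that ρ does not spoil the block form of M″: it vanishes
-- on the part where M″ acts as c, and hence only adds a row to B.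
triangularize : ∀ n {c} → c ≢ 0ℤ → (M : End (Fin n)) → (∀ v → ap M (ap M v) ≐ λ i → c * ap M v i) → Triangular c M
triangularize n {c} c≢0 M square with Finₚ.any? (λ i → Finₚ.any? (λ j → ¬? (ap M (unit i) j ℤ.≟ 0ℤ)))
... | no vanishes = record
  { r = 0 ; t = n ; r+t = refl ; B = 0L
  ; similar = record { to = ι₂ ; from = π₂ ; from-to = λ _ _ → refl ; to-from = λ { w (inj₂ j) → refl } }
      by λ { v (inj₂ j) → trans (ap-expand M v j) (∑-zero (elems {Fin n}) (λ i → trans (cong (_*_ (v i)) (entry≡0 i j)) (*-zeroʳ (v i)))) }
  }
  where
  entry≡0 : ∀ i j → ap M (unit i) j ≡ 0ℤ
  entry≡0 i j = decidable-stable (ap M (unit i) j ℤ.≟ 0ℤ) (λ ne → vanishes (i , j , ne))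
triangularize (suc n) {c} c≢0 M square | yes (i , j , entry≢0) with firstColumn c≢0 M square {i} {j} entry≢0
... | P , column = record
  { r = suc r ; t = t ; r+t = cong suc r+t ; B = ρ′ ∘L ι₂ ◂L B
  ; similar = Similar-trans (conjugate P M) (Q by intertwine)
  }
  where
  M₁ = to P ∘L M ∘L from P
  ρ : Lin (Fin n) ⊤
  ρ = eval zero ∘L M₁ ∘L embed
  M″ : End (Fin n)
  M″ = reindex suc ∘L M₁ ∘L embed
  head-M₁ : ∀ v → ap M₁ v zero ≡ c * v zero + ap ρ (v ∘ suc) tt
  head-M₁ v = trans (ap-decompose M₁ v zero)
    (cong (_+ ap ρ (v ∘ suc) tt) (trans (cong (_*_ (v zero)) (trans (column zero) (*-identityʳ c))) (*-comm (v zero) c)))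
  tail-M₁ : ∀ v k → ap M₁ v (suc k) ≡ ap M″ (v ∘ suc) k
  tail-M₁ v k = trans (ap-decompose M₁ v (suc k))
    (trans (cong (λ z → v zero * z + ap M″ (v ∘ suc) k) (trans (column (suc k)) (*-zeroʳ c)))
    (trans (cong (_+ ap M″ (v ∘ suc) k) (*-zeroʳ (v zero))) (+-identityˡ _)))
  square₁ : ∀ v → ap M₁ (ap M₁ v) ≐ λ k → c * ap M₁ v k
  square₁ v k = trans (ap-cong (to P ∘L M) (from-to P (ap M (ap (from P) v))) k)
                (trans (ap-cong (to P) (square (ap (from P) v)) k) (ap-* (to P) c _ k))
  square″ : ∀ u → ap M″ (ap M″ u) ≐ λ k → c * ap M″ u k
  square″ u k = trans (sym (tail-M₁ (ap M₁ (ap embed u)) k)) (square₁ (ap embed u) (suc k))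
  -- The first coordinate of M₁² = c M₁ reads c ρ + ρ M″ = c ρ on vectors that start with 0.
  ρM″ : ∀ u → ap ρ (ap M″ u) tt ≡ 0ℤ
  ρM″ u = +-cancelˡ (c * ap ρ u tt) _ _ (trans (sym (head-M₁ (ap M₁ (ap embed u))))
            (trans (square₁ (ap embed u) zero) (sym (+-identityʳ _))))
  open Triangular (triangularize n c≢0 M″ square″)
  P″ = iso similar
  U = upper c B
  ρ′ : Lin (Fin r ⊎ Fin t) ⊤
  ρ′ = ρ ∘L from P″
  ρ′U : ∀ w → ap ρ′ (ap U w) tt ≡ 0ℤ
  ρ′U w = trans (ap-cong ρ (intertwines (Similar-sym similar) w) tt) (ρM″ (ap (from P″) w))
  -- On the first block U is multiplication by c, so c ρ′ = ρ′ U = 0 there, and c cancels.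
  ρ′ι₁ : ∀ x → ap ρ′ (ap ι₁ x) tt ≡ 0ℤ
  ρ′ι₁ x = cancel-*ˡ-0 c≢0 _ (trans (sym (ap-* ρ′ c (ap ι₁ x) tt))
    (trans (ap-cong ρ′ (λ { (inj₁ k) → sym (trans (cong (_+_ (c * x k)) (ap-0 B k)) (+-identityʳ _)) ; (inj₂ k) → *-zeroʳ c }) tt)
           (ρ′U (ap ι₁ x))))
  ρ′-split : ∀ w → ap ρ′ w tt ≡ ap ρ′ (ap ι₂ (w ∘ inj₂)) tt
  ρ′-split w = trans (ap-cong ρ′ {w} {λ k → ap ι₁ (w ∘ inj₁) k + ap ι₂ (w ∘ inj₂) k}
                        (λ { (inj₁ k) → sym (+-identityʳ _) ; (inj₂ k) → sym (+-identityˡ _) }) tt)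
    (trans (ap-+ ρ′ (ap ι₁ (w ∘ inj₁)) (ap ι₂ (w ∘ inj₂)) tt)
    (trans (cong (_+ ap ρ′ (ap ι₂ (w ∘ inj₂)) tt) (ρ′ι₁ (w ∘ inj₁))) (+-identityˡ _)))
  Q = prepend P″
  intertwine : ∀ v → ap (to Q) (ap M₁ v) ≐ ap (upper c (ρ′ ∘L ι₂ ◂L B)) (ap (to Q) v)
  intertwine v (inj₁ zero) = trans (head-M₁ v) (cong (_+_ (c * v zero))
    (trans (sym (ap-cong ρ (from-to P″ (v ∘ suc)) tt)) (ρ′-split (ap (to P″) (v ∘ suc)))))
  intertwine v (inj₁ (suc k)) = trans (ap-cong (to P″) (tail-M₁ v) (inj₁ k)) (intertwines similar (v ∘ suc) (inj₁ k))
  intertwine v (inj₂ k) = trans (ap-cong (to P″) (tail-M₁ v) (inj₂ k)) (intertwines similar (v ∘ suc) (inj₂ k))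

trace-upper : ∀ {r t} c (B : Lin (Fin t) (Fin r)) → trace (upper c B) ≡ c * + r
trace-upper {r} {t} c B =
  trans (∑-++ (List.map inj₁ (elems {Fin r})) (List.map inj₂ (elems {Fin t})) diagonal)
  (trans (cong₂ _+_ (trans (∑-map inj₁ (elems {Fin r}) diagonal)
                    (trans (∑-cong (elems {Fin r}) {diagonal ∘ inj₁} {λ _ → c * 1ℤ} (λ i → trans (cong₂ _+_ (cong (_*_ c) (unit-diag {Fin r ⊎ Fin t} (inj₁ i))) (ap-0 B i))
                                                     (+-identityʳ _)))
                    (trans (∑-* (elems {Fin r}) c (λ _ → 1ℤ)) (cong (_*_ c) (count r)))))
                  (trans (∑-map inj₂ (elems {Fin t}) diagonal) (∑-zero (elems {Fin t}) {diagonal ∘ inj₂} (λ _ → refl))))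
         (+-identityʳ _))
  where
  diagonal : Fin r ⊎ Fin t → ℤ
  diagonal k = ap (upper c B) (unit k) k
  count : ∀ n → Sum {Fin n} (λ _ → 1ℤ) ≡ + n
  count zero = refl
  count (suc n) = trans (∑-Fin-suc {n} (λ _ → 1ℤ)) (cong (_+_ 1ℤ) (count n))

record Splitting {n} (E : End (Fin n)) : Set where
  field
    r : ℕ
    rank : + r ≡ trace E
    ι : Lin (Fin r) (Fin n)
    π : Lin (Fin n) (Fin r)
    πι : ∀ x → ap π (ap ι x) ≐ x
    ιπ : ∀ v → ap ι (ap π v) ≐ ap E v

-- For c = 1 the triangular form factors as the column (I, 0) times the row (I, B), whose product in
-- the other order is the identity. This shows that the image is free of rank the trace.
splitIdempotent : ∀ {n} (E : End (Fin n)) → (∀ v → ap E (ap E v) ≐ ap E v) → Splitting E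
splitIdempotent {n} E idem = record
  { r = r
  ; rank = trans (sym (*-identityˡ (+ r))) (trans (sym (trace-upper 1ℤ B)) (sym (Similar-trace similar)))
  ; ι = from P ∘L ι₁
  ; π = (π₁ +L B ∘L π₂) ∘L to P
  ; πι = λ x i → trans (cong₂ _+_ (to-from P (ap ι₁ x) (inj₁ i))
                                  (trans (ap-cong B (λ j → to-from P (ap ι₁ x) (inj₂ j)) i) (ap-0 B i)))
                       (+-identityʳ (x i))
  ; ιπ = λ v i → trans (ap-cong (from P)
             (λ { (inj₁ k) → trans (cong (_+ ap B (ap π₂ (ap (to P) v)) k) (sym (*-identityˡ (ap (to P) v (inj₁ k))))) (sym (intertwines similar v (inj₁ k)))
                ; (inj₂ k) → sym (intertwines similar v (inj₂ k)) }) i)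
           (from-to P (ap E v) i)
  }
  where
  open Triangular (triangularize n {1ℤ} (λ ()) E (λ v i → trans (idem v i) (sym (*-identityˡ _))))
  P = iso similar

-- Elimination and rank modulo p

module Modulo (p : ℕ) (pPrime : Prime p) where

  π : ℤ
  π = + p

  π≢0 : π ≢ 0ℤ
  π≢0 e = ℕ.≢-nonZero⁻¹ p ⦃ prime⇒nonZero pPrime ⦄ (+-injective e)

  infix 4 _≈_ _≋_
  infix 3 _with-eq_
  -- The quotient is kept as data: linear maps are applied to it in `ap-≋`, and it provides the
  -- operator that `divide` constructs.
  record _≈_ (a b : ℤ) : Set where
    constructor _with-eq_
    field
      quot : ℤ
      eq : a ≡ b + π * quot

  open _≈_ public

  _≋_ : (I → ℤ) → (I → ℤ) → Set
  v ≋ w = ∀ i → v i ≈ w i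

  𝟎 : I → ℤ
  𝟎 _ = 0ℤ

  ≡⇒≈ : ∀ {a b} → a ≡ b → a ≈ b
  ≡⇒≈ {b = b} refl = 0ℤ with-eq sym (trans (cong (_+_ b) (*-zeroʳ π)) (+-identityʳ b))

  ≈-refl : ∀ {a} → a ≈ a
  ≈-refl = ≡⇒≈ refl

  ≈-sym : ∀ {a b} → a ≈ b → b ≈ a
  ≈-sym {b = b} (k with-eq refl) = - k with-eq cancel b π k
    where
    cancel : ∀ b π k → b ≡ b + π * k + π * - k
    cancel = solve-∀

  ≈-trans : ∀ {a b c} → a ≈ b → b ≈ c → a ≈ c
  ≈-trans {c = c} (k with-eq refl) (l with-eq refl) = l + k with-eq collect c π l k
    where
    collect : ∀ c π l k → c + π * l + π * k ≡ c + π * (l + k)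
    collect = solve-∀

  ≈-+ : ∀ {a b c d} → a ≈ b → c ≈ d → a + c ≈ b + d
  ≈-+ {b = b} {d = d} (k with-eq refl) (l with-eq refl) = k + l with-eq collect b d π k l
    where
    collect : ∀ b d π k l → b + π * k + (d + π * l) ≡ b + d + π * (k + l)
    collect = solve-∀

  ≈-* : ∀ c {a b} → a ≈ b → c * a ≈ c * b
  ≈-* c {b = b} (k with-eq refl) = c * k with-eq distribute c b π k
    where
    distribute : ∀ c b π k → c * (b + π * k) ≡ c * b + π * (c * k)
    distribute = solve-∀

  ≈-neg : ∀ {a b} → a ≈ b → - a ≈ - b
  ≈-neg {b = b} (k with-eq refl) = - k with-eq distribute b π k
    where
    distribute : ∀ b π k → - (b + π * k) ≡ - b + π * - k
    distribute = solve-∀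

  ≈-- : ∀ {a b c d} → a ≈ b → c ≈ d → a - c ≈ b - d
  ≈-- e f = ≈-+ e (≈-neg f)

  multiple≈0 : ∀ k → π * k ≈ 0ℤ
  multiple≈0 k = k with-eq sym (+-identityˡ _)

  ≈⇒-≈0 : ∀ {a b} → a ≈ b → a - b ≈ 0ℤ
  ≈⇒-≈0 {b = b} (k with-eq refl) = k with-eq cancel b π k
    where
    cancel : ∀ b π k → b + π * k - b ≡ 0ℤ + π * k
    cancel = solve-∀

  -≈0⇒≈ : ∀ {a b} → a - b ≈ 0ℤ → a ≈ b
  -≈0⇒≈ {a} {b} e = ≈-trans (≡⇒≈ (restore a b)) (≈-trans (≈-+ (≈-refl {b}) e) (≡⇒≈ (+-identityʳ b)))
    where
    restore : ∀ a b → a ≡ b + (a - b)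
    restore = solve-∀

  ≈0⇒∣ : ∀ {a} → a ≈ 0ℤ → π ∣ₛ.∣ a
  ≈0⇒∣ (k with-eq e) = ∣ₛ.divides k (trans e (trans (+-identityˡ _) (*-comm π k)))

  ∣⇒≈0 : ∀ {a} → π ∣ₛ.∣ a → a ≈ 0ℤ
  ∣⇒≈0 (∣ₛ.divides k e) = k with-eq trans e (trans (*-comm k π) (sym (+-identityˡ _)))

  _≈0? : ∀ a → Dec (a ≈ 0ℤ)
  a ≈0? = map′ ∣⇒≈0 ≈0⇒∣ (π ∣ₛ.∣? a)

  ≈0-prime : ∀ a b → a * b ≈ 0ℤ → a ≈ 0ℤ ⊎ b ≈ 0ℤ
  ≈0-prime a b e = Sum.map (∣⇒≈0 ∘ ∣ₛ.∣ᵤ⇒∣) (∣⇒≈0 ∘ ∣ₛ.∣ᵤ⇒∣)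
    (euclidsLemma ∣ a ∣ ∣ b ∣ pPrime (subst (ℕ∣._∣_ p) (abs-* a b) (∣ₛ.∣⇒∣ᵤ (≈0⇒∣ e))))

  -- The gcd d of g and p is 1 or p up to sign, and p is excluded because it would divide g. The
  -- factor d in both coefficients corrects the sign, as d² = 1.
  unit-mod : ∀ {g} → ¬ g ≈ 0ℤ → Σ ℤ λ x → Σ ℤ λ y → x * g + y * π ≡ 1ℤ
  unit-mod {g} g≉0 = d * x , d * y ,
    trans (cong₂ (λ s t → d * x * s + d * y * t) a≡ b≡)
    (trans (collect d x y a′ b′) (trans (cong (_*_ (d * d)) bezout) (trans (*-identityʳ (d * d)) d²)))
    where
    open Bezout (bezoutLemma g π) renaming (g to d)
    collect : ∀ d x y a b → d * x * (d * a) + d * y * (d * b) ≡ d * d * (x * a + y * b)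
    collect = solve-∀
    d∣p : ∣ d ∣ ℕ∣.∣ p
    d∣p = ℕ∣.divides ∣ b′ ∣ (trans (cong ∣_∣ b≡) (trans (abs-* d b′) (ℕₚ.*-comm ∣ d ∣ ∣ b′ ∣)))
    abs-one : ∀ d → ∣ d ∣ ≡ 1 → d * d ≡ 1ℤ
    abs-one (+ .1) refl = refl
    abs-one -[1+ 0 ] refl = refl
    d² : d * d ≡ 1ℤ
    d² with prime⇒irreducible pPrime d∣p
    ... | inj₁ d≡1 = abs-one d d≡1
    ... | inj₂ d≡p = contradiction (∣⇒≈0 (∣ₛ.∣ᵤ⇒∣ (ℕ∣.divides ∣ a′ ∣
            (trans (cong ∣_∣ a≡) (trans (abs-* d a′) (trans (cong (ℕ._* ∣ a′ ∣) d≡p) (ℕₚ.*-comm p ∣ a′ ∣))))))) g≉0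

  ∑-≈0 : ∀ {A : Set} (xs : List A) {f : A → ℤ} → (∀ x → f x ≈ 0ℤ) → ∑ xs f ≈ 0ℤ
  ∑-≈0 [] e = ≈-refl
  ∑-≈0 (x ∷ xs) e = ≈-+ (e x) (∑-≈0 xs e)

  ap-≋ : (f : Lin I J) {v w : I → ℤ} → v ≋ w → ap f v ≋ ap f w
  ap-≋ f {v} {w} e j = ap f (quot ∘ e) j with-eq trans (ap-cong f (eq ∘ e) j)
    (trans (ap-+ f w (λ i → π * quot (e i)) j) (cong (_+_ (ap f w j)) (ap-* f π (quot ∘ e) j)))

  ap-≋0 : (f : Lin I J) {v : I → ℤ} → v ≋ 𝟎 → ap f v ≋ 𝟎
  ap-≋0 f e j = ≈-trans (ap-≋ f e j) (≡⇒≈ (ap-0 f j))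

keepFirst : End (I ⊎ J)
keepFirst = ⟨ π₁ , 0L ⟩

shear : ∀ {n} → Lin (Fin n) ⊤ → Iso (Fin (suc n)) (Fin (suc n))
shear ρ = record
  { to = eval zero +L ρ ∘L reindex suc ◂L reindex suc
  ; from = eval zero +L (- 1ℤ) ∙L ρ ∘L reindex suc ◂L reindex suc
  ; from-to = λ { v zero → cancel (v zero) (ap ρ (v ∘ suc) tt) ; v (suc i) → refl }
  ; to-from = λ { v zero → cancel′ (v zero) (ap ρ (v ∘ suc) tt) ; v (suc i) → refl }
  }
  where
  cancel : ∀ a b → a + b + - 1ℤ * b ≡ a
  cancel = solve-∀
  cancel′ : ∀ a b → a + - 1ℤ * b + b ≡ a
  cancel′ = solve-∀

module Elimination (p : ℕ) (pPrime : Prime p) where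

  open Modulo p pPrime

  -- Only the equation holds modulo p; the changes of basis `P` and `Q` are invertible over ℤ, as
  -- the conjugation in `upper-similar` requires.
  record Reduced {n} (B : End (Fin n)) : Set where
    field
      m m′ : ℕ
      m+m′ : m ℕ.+ m′ ≡ n
      P Q : Iso (Fin n) (Fin m ⊎ Fin m′)
      reduces : ∀ v → ap (to P) (ap B v) ≋ ap keepFirst (ap (to Q) v)

  InjectiveMod : Lin I J → Set
  InjectiveMod f = ∀ v → ap f v ≋ 𝟎 → v ≋ 𝟎

  private

    split : ∀ {n} (D : End (Fin (suc n))) → ap D first ≐ first →
            let ρ = eval zero ∘L D ∘L embed ; D″ = reindex suc ∘L D ∘L embed in
            ∀ u → ap D u ≐ (u zero + ap ρ (u ∘ suc) tt) ◂ ap D″ (u ∘ suc)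
    split D column u zero = trans (ap-decompose D u zero)
      (cong (_+ ap D (ap embed (u ∘ suc)) zero) (trans (cong (_*_ (u zero)) (column zero)) (*-identityʳ (u zero))))
    split D column u (suc i) = trans (ap-decompose D u (suc i))
      (trans (cong (_+ ap D (ap embed (u ∘ suc)) (suc i)) (trans (cong (_*_ (u zero)) (column (suc i))) (*-zeroʳ (u zero))))
             (+-identityˡ _))

  reduceToFirst : ∀ n (v : Fin (suc n) → ℤ) →
                  Σ (Iso (Fin (suc n)) (Fin (suc n))) λ P → Σ ℤ λ g → ap (to P) v ≐ λ i → g * first i
  reduceToFirst n v with reduceVector n v
  ... | P , clear = P , ap (to P) v zero , λ
    { zero → sym (*-identityʳ (ap (to P) v zero))
    ; (suc i) → trans (clear i) (sym (*-zeroʳ (ap (to P) v zero))) }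

  record UnimodularColumn {n} (B : End (Fin (suc n))) : Set where
    field
      P R : Iso (Fin (suc n)) (Fin (suc n))
      D : End (Fin (suc n))
      column : ap D first ≐ first
      D≋ : ∀ v → ap D (ap (to R) v) ≋ ap (to P) (ap B v)

  multiple-of-first : ∀ {n} g → ¬ g ≈ 0ℤ → (B : End (Fin (suc (suc n)))) → ap B first ≐ (λ i → g * first i) →
                      UnimodularColumn B
  multiple-of-first {n} g g≉0 B B-first with unit-mod g≉0
  ... | x , y , unimodular = record
    { P = P ; R = idI ; D = to P ∘L C ; column = column ; D≋ = λ v → ap-≋ (to P) (C≋ v) }
    where
    P = rotate {n} x y g π unimodular
    -- Modulo p the first column (g, 0, …) may be replaced by (g, p, 0, …), which is unimodular.
    C : End (Fin (suc (suc n)))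
    C = B +L π ∙L ((0ℤ ◂ first) ⊗ eval zero)
    C≋ : ∀ u → ap C u ≋ ap B u
    C≋ u l = ≈-trans (≈-+ (≈-refl {ap B u l}) (multiple≈0 (u zero * (0ℤ ◂ first) l))) (≡⇒≈ (+-identityʳ (ap B u l)))
    C-first : ap C first ≐ (g ◂ π ◂ λ _ → 0ℤ)
    C-first zero = trans (cong (_+ π * (1ℤ * 0ℤ)) (B-first zero)) (simplify g π)
      where
      simplify : ∀ g π → g * 1ℤ + π * (1ℤ * 0ℤ) ≡ g
      simplify = solve-∀
    C-first (suc zero) = trans (cong (_+ π * (1ℤ * 1ℤ)) (B-first (suc zero))) (simplify g π)
      where
      simplify : ∀ g π → g * 0ℤ + π * (1ℤ * 1ℤ) ≡ π
      simplify = solve-∀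
    C-first (suc (suc l)) = trans (cong (_+ π * (1ℤ * 0ℤ)) (B-first (suc (suc l)))) (simplify g π)
      where
      simplify : ∀ g π → g * 0ℤ + π * (1ℤ * 0ℤ) ≡ 0ℤ
      simplify = solve-∀
    column : ap (to P ∘L C) first ≐ first
    column zero = trans (cong₂ (λ s t → x * s + y * t) (C-first zero) (C-first (suc zero))) unimodular
    column (suc zero) = trans (cong₂ (λ s t → - π * s + g * t) (C-first zero) (C-first (suc zero))) (cancel g π)
      where
      cancel : ∀ g π → - π * g + g * π ≡ 0ℤ
      cancel = solve-∀
    column (suc (suc l)) = C-first (suc (suc l))

  unimodularColumn : ∀ {n} (B : End (Fin (suc (suc n)))) {i j} → ¬ ap B (unit j) i ≈ 0ℤ → UnimodularColumn B
  unimodularColumn {n} B {i} {j} entry≉0 with reduceToFirst (suc n) (unit j)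
  ... | R , h , unit-reduced with reduceToFirst (suc n) (ap (B ∘L from R) first)
  ...   | P , g , column-reduced = record
    { P = U.P ∘I P ; R = U.R ∘I R ; D = U.D ; column = U.column
    ; D≋ = λ v l → ≈-trans (U.D≋ (ap (to R) v) l) (≡⇒≈ (ap-cong (to U.P ∘L to P ∘L B) (from-to R v) l)) }
    where
    first≈0 : g ≈ 0ℤ → ap (B ∘L from R) first ≋ 𝟎
    first≈0 g≈0 l = ≈-trans (≡⇒≈ (sym (from-to P (ap (B ∘L from R) first) l))) (ap-≋0 (from P)
      (λ l → ≈-trans (≡⇒≈ (trans (column-reduced l) (*-comm g (first l))))
             (≈-trans (≈-* (first l) g≈0) (≡⇒≈ (*-zeroʳ (first l))))) l)
    g≉0 : ¬ g ≈ 0ℤ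
    g≉0 g≈0 = entry≉0 (≈-trans (≡⇒≈ (trans (ap-cong B (λ l → sym (from-to R (unit j) l)) i)
                (trans (ap-cong (B ∘L from R) unit-reduced i) (ap-* (B ∘L from R) h first i))))
              (≈-trans (≈-* h (first≈0 g≈0 i)) (≡⇒≈ (*-zeroʳ h))))
    module U = UnimodularColumn (multiple-of-first g g≉0 (to P ∘L B ∘L from R) column-reduced)

  -- Up to base changes and multiples of p, B is `[1, ρ; 0, D″]`. A shear of the source removes ρ,
  -- and a kernel vector modulo p is determined by its tail, which D″ kills.
  eliminate : ∀ {n} {B : End (Fin (suc n))} → UnimodularColumn B →
              (∀ D″ → Reduced {n} D″ ⊎ InjectiveMod D″) → Reduced B ⊎ InjectiveMod B
  eliminate {n} {B} U recurse = Sum.map reduced injective (recurse D″)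
    where
    open UnimodularColumn U
    ρ : Lin (Fin n) ⊤
    ρ = eval zero ∘L D ∘L embed
    D″ : End (Fin n)
    D″ = reindex suc ∘L D ∘L embed
    reduced : Reduced D″ → Reduced B
    reduced S = record
      { m = suc m ; m′ = m′ ; m+m′ = cong suc m+m′
      ; P = prepend P″ ∘I P ; Q = prepend Q″ ∘I shear ρ ∘I R
      ; reduces = λ v l → ≈-trans (≈-sym (ap-≋ (to (prepend P″)) (D≋ v) l))
          (≈-trans (≡⇒≈ (ap-cong (to (prepend P″)) (split D column (ap (to R) v)) l)) (block (ap (to R) v) l)) }
      where
      open Reduced S renaming (P to P″; Q to Q″)
      block : ∀ u → ap (to (prepend P″)) ((u zero + ap ρ (u ∘ suc) tt) ◂ ap D″ (u ∘ suc)) ≋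
                    ap keepFirst (ap (to (prepend Q″ ∘I shear ρ)) u)
      block u (inj₁ zero) = ≈-refl
      block u (inj₁ (suc l)) = reduces (u ∘ suc) (inj₁ l)
      block u (inj₂ l) = reduces (u ∘ suc) (inj₂ l)
    injective : InjectiveMod D″ → InjectiveMod B
    injective inj v v≋0 l = ≈-trans (≡⇒≈ (sym (from-to R v l))) (ap-≋0 (from R) u≋0 l)
      where
      u = ap (to R) v
      Du≋0 : ((u zero + ap ρ (u ∘ suc) tt) ◂ ap D″ (u ∘ suc)) ≋ 𝟎
      Du≋0 l = ≈-trans (≡⇒≈ (sym (split D column u l))) (≈-trans (D≋ v l) (ap-≋0 (to P) v≋0 l))
      tail≋0 : (u ∘ suc) ≋ 𝟎
      tail≋0 = inj (u ∘ suc) (λ l → Du≋0 (suc l))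
      u≋0 : u ≋ 𝟎
      u≋0 zero = ≈-trans (≡⇒≈ (sym (+-identityʳ (u zero))))
                 (≈-trans (≈-+ (≈-refl {u zero}) (≈-sym (ap-≋0 ρ tail≋0 tt))) (Du≋0 zero))
      u≋0 (suc l) = tail≋0 l

  -- Each pivot is made 1 by means of a second row. If the remaining matrix becomes 0 modulo p, the
  -- normal form is reached. Otherwise a 1 × 1 matrix with a unit modulo p is left; in general it
  -- cannot be turned into 1, but then B is injective modulo p.
  reduce : ∀ n (B : End (Fin n)) → Reduced B ⊎ InjectiveMod B
  reduce n B with Finₚ.any? (λ j → Finₚ.any? (λ i → ¬? (ap B (unit j) i ≈0?)))
  ... | no vanishes = inj₁ record
    { m = 0 ; m′ = n ; m+m′ = refl ; P = trivial ; Q = trivial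
    ; reduces = λ { v (inj₂ i) → ≈-trans (≡⇒≈ (ap-expand B v i)) (∑-≈0 (elems {Fin n})
        (λ j → ≈-trans (≈-* (v j) (entry≈0 i j)) (≡⇒≈ (*-zeroʳ (v j))))) } }
    where
    trivial : Iso (Fin n) (Fin 0 ⊎ Fin n)
    trivial = record { to = ι₂ ; from = π₂ ; from-to = λ _ _ → refl ; to-from = λ { w (inj₂ j) → refl } }
    entry≈0 : ∀ i j → ap B (unit j) i ≈ 0ℤ
    entry≈0 i j = decidable-stable (ap B (unit j) i ≈0?) (λ ne → vanishes (j , i , ne))
  reduce (suc zero) B | yes (zero , zero , entry≉0) = inj₂ λ
    { v v≋0 zero → [ id , (λ e → contradiction e entry≉0) ] (≈0-prime (v zero) (ap B (unit zero) zero)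
        (≈-trans (≡⇒≈ (sym (trans (ap-expand B v zero) (+-identityʳ _)))) (v≋0 zero))) }
  reduce (suc (suc n)) B | yes (j , i , entry≉0) = eliminate (unimodularColumn B {i} {j} entry≉0) (reduce (suc n))

module Rank (p : ℕ) (pPrime : Prime p) where

  open Modulo p pPrime public
  open Elimination p pPrime public

  private instance
    p-nonZero : ℕ.NonZero p
    p-nonZero = prime⇒nonZero pPrime

  -- The images of the G (unit k) are a basis of the image of f modulo p.
  record RankBasis (K : Set) (f : Lin I J) : Set where
    field
      G : Lin K I
      independent : InjectiveMod (f ∘L G)
      spanning : ∀ v → Σ (K → ℤ) λ x → ap f v ≋ ap f (ap G x)

  open RankBasis

  RankBasis-similar : {M : End I} {N : End J} → Similar M N → RankBasis K M → RankBasis K N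
  RankBasis-similar {M = M} {N} (P by e) b = record
    { G = to P ∘L G b
    ; independent = λ x Nx≋0 → independent b x (λ i → ≈-trans (≡⇒≈ (sym (from-to P (ap M (ap (G b) x)) i)))
        (ap-≋0 (from P) (λ j → ≈-trans (≡⇒≈ (e (ap (G b) x) j)) (Nx≋0 j)) i))
    ; spanning = λ w → let x , s = spanning b (ap (from P) w) in x , λ j →
        ≈-trans (≡⇒≈ (trans (ap-cong N (λ k → sym (to-from P w k)) j) (sym (e (ap (from P) w) j))))
        (≈-trans (ap-≋ (to P) s j) (≡⇒≈ (e (ap (G b) x) j)))
    }

  RankBasis-reindex : {f : Lin I J} → K ↔ L → RankBasis K f → RankBasis L f
  RankBasis-reindex {f = f} h b = record
    { G = G b ∘L reindex (Inverse.to h)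
    ; independent = λ x e l → ≈-trans (≡⇒≈ (cong x (sym (Inverse.strictlyInverseˡ h l)))) (independent b (x ∘ Inverse.to h) e (Inverse.from h l))
    ; spanning = λ v → let x , s = spanning b v in x ∘ Inverse.from h , λ j →
        ≈-trans (s j) (≡⇒≈ (ap-cong (f ∘L G b) (λ k → cong x (sym (Inverse.strictlyInverseʳ h k))) j))
    }

  RankBasis-injective : {f : Lin I J} → InjectiveMod f → RankBasis I f
  RankBasis-injective inj = record { G = idL ; independent = inj ; spanning = λ v → v , λ _ → ≈-refl }

  RankBasis-keepFirst : RankBasis I (keepFirst {I} {J})
  RankBasis-keepFirst = record
    { G = ι₁ ; independent = λ x e i → e (inj₁ i) ; spanning = λ v → v ∘ inj₁ , λ { (inj₁ _) → ≈-refl ; (inj₂ _) → ≈-refl } }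

  RankBasis-upper : {B : Lin J I} → RankBasis K B → RankBasis K (upper π B)
  RankBasis-upper {B = B} b = record
    { G = ι₂ ∘L G b
    ; independent = λ x e → independent b x (λ i → ≈-trans (≈-sym (top (ap ι₂ (ap (G b) x)) i)) (e (inj₁ i)))
    ; spanning = λ v → let x , s = spanning b (v ∘ inj₂) in x , λ
        { (inj₁ i) → ≈-trans (top v i) (≈-trans (s i) (≈-sym (top (ap ι₂ (ap (G b) x)) i)))
        ; (inj₂ _) → ≈-refl }
    }
    where
    top : ∀ v i → ap (upper π B) v (inj₁ i) ≈ ap B (v ∘ inj₂) i
    top v i = ≈-trans (≈-+ (multiple≈0 (v (inj₁ i))) (≈-refl {ap B (v ∘ inj₂) i})) (≡⇒≈ (+-identityˡ _))

  RankBasis-⊞ : ∀ {I J K I′ J′ K′ : Set} {f : Lin I J} {g : Lin I′ J′} →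
                RankBasis K f → RankBasis K′ g → RankBasis (K ⊎ K′) (f ⊞ g)
  RankBasis-⊞ b c = record
    { G = G b ⊞ G c
    ; independent = λ { x e (inj₁ k) → independent b (x ∘ inj₁) (e ∘ inj₁) k
                      ; x e (inj₂ k) → independent c (x ∘ inj₂) (e ∘ inj₂) k }
    ; spanning = λ v → let x , s = spanning b (v ∘ inj₁) ; y , t = spanning c (v ∘ inj₂) in
        [ x , y ] , λ { (inj₁ i) → s i ; (inj₂ i) → t i }
    }

  residue : ℤ → Fin p
  residue a = fromℕ< (ℤ÷.n%ℕd<d a p)

  toℕ-residue : ∀ a → + toℕ (residue a) ≈ a
  toℕ-residue a = ≈-sym (a ℤ÷./ℕ p with-eq trans (ℤ÷.a≡a%ℕn+[a/ℕn]*n a p)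
    (cong₂ _+_ (cong +_ (sym (Finₚ.toℕ-fromℕ< (ℤ÷.n%ℕd<d a p)))) (*-comm (a ℤ÷./ℕ p) π)))

  ≈⇒≡-below : ∀ {m n} → m ℕ.< p → + m ≈ + n → n ℕ.≤ m → m ≡ n
  ≈⇒≡-below {m} {n} m<p e n≤m = ℕₚ.≤-antisym (ℕₚ.m∸n≡0⇒m≤n (divisor-zero (m ℕ.∸ n) (ℕₚ.≤-<-trans (ℕₚ.m∸n≤m m n) m<p) difference)) n≤m
    where
    difference : p ℕ∣.∣ (m ℕ.∸ n)
    difference = subst (p ℕ∣.∣_) (cong ∣_∣ (trans (m-n≡m⊖n m n) (⊖-≥ n≤m))) (∣ₛ.∣⇒∣ᵤ (≈0⇒∣ (≈⇒-≈0 e)))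
    divisor-zero : ∀ d → d ℕ.< p → p ℕ∣.∣ d → d ≡ 0
    divisor-zero zero _ _ = refl
    divisor-zero (suc d) d<p p∣d = contradiction d<p (ℕₚ.≤⇒≯ (ℕ∣.∣⇒≤ p∣d))

  ≈⇒≡-Fin : ∀ {i j : Fin p} → + toℕ i ≈ + toℕ j → i ≡ j
  ≈⇒≡-Fin {i} {j} e with ℕₚ.≤-total (toℕ j) (toℕ i)
  ... | inj₁ j≤i = Finₚ.toℕ-injective (≈⇒≡-below (Finₚ.toℕ<n i) e j≤i)
  ... | inj₂ i≤j = Finₚ.toℕ-injective (sym (≈⇒≡-below (Finₚ.toℕ<n j) (≈-sym e) i≤j))

  private
    funToFin-cong : ∀ {m n} {f g : Fin m → Fin n} → (∀ i → f i ≡ g i) → funToFin f ≡ funToFin g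
    funToFin-cong {zero} e = refl
    funToFin-cong {suc m} e = cong₂ Fin.combine (e zero) (funToFin-cong (e ∘ suc))

  -- By counting vectors over ℤ/p.
  rank-≤ : ∀ {k l} {f : Lin I J} → RankBasis (Fin k) f → RankBasis (Fin l) f → k ℕ.≤ l
  rank-≤ {k = k} {l} {f} b c with k ℕ.≤? l
  ... | yes k≤l = k≤l
  ... | no k≰l = contradiction (Finₚ.injective⇒≤ code-injective)
                   (ℕₚ.<⇒≱ (ℕₚ.^-monoʳ-< p (ℕ.nonTrivial⇒n>1 p ⦃ prime⇒nonTrivial pPrime ⦄) (ℕₚ.≰⇒> k≰l)))
    where
    change : (Fin k → ℤ) → Fin l → ℤ
    change x = proj₁ (spanning c (ap (G b) x))
    change-injective : ∀ {x y} → change x ≋ change y → x ≋ y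
    change-injective {x} {y} e i = -≈0⇒≈ (independent b (λ j → x j - y j) (λ j →
      ≈-trans (≡⇒≈ (ap-sub (f ∘L G b) x y j)) (≈⇒-≈0 (≈-trans (proj₂ (spanning c (ap (G b) x)) j)
        (≈-trans (ap-≋ (f ∘L G c) e j) (≈-sym (proj₂ (spanning c (ap (G b) y)) j)))))) i)
    digits : Fin (p ℕ.^ k) → Fin k → ℤ
    digits a i = + toℕ (finToFun a i)
    code : Fin (p ℕ.^ k) → Fin (p ℕ.^ l)
    code a = funToFin (residue ∘ change (digits a))
    residues-agree : ∀ {a b} → code a ≡ code b → change (digits a) ≋ change (digits b)
    residues-agree {a} {b} e i = ≈-trans (≈-sym (toℕ-residue (change (digits a) i))) (≈-trans (≡⇒≈ (cong (λ r → + toℕ r)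
      (trans (sym (Finₚ.finToFun-funToFin (residue ∘ change (digits a)) i))
      (trans (cong (λ r → finToFun r i) e) (Finₚ.finToFun-funToFin (residue ∘ change (digits b)) i)))))
      (toℕ-residue (change (digits b) i)))
    code-injective : ∀ {a b} → code a ≡ code b → a ≡ b
    code-injective {a} {b} e = trans (sym (Finₚ.funToFin-finToFin {k} {p} a))
      (trans (funToFin-cong (λ i → ≈⇒≡-Fin (change-injective {digits a} {digits b} (residues-agree {a} {b} e) i)))
             (Finₚ.funToFin-finToFin {k} {p} b))

  rank-unique : ∀ {k l} {f : Lin I J} → RankBasis (Fin k) f → RankBasis (Fin l) f → k ≡ l
  rank-unique b c = ℕₚ.≤-antisym (rank-≤ b c) (rank-≤ c b)

  -- Since p can be cancelled, the quotients are unique and inherit linearity from f.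
  divide : (f : Lin I J) → (∀ v → ap f v ≋ 𝟎) → Σ (Lin I J) λ g → ∀ v → ap f v ≐ λ j → π * ap g v j
  divide f f≋0 = record
    { ap = λ v j → quot (f≋0 v j)
    ; ap-cong = λ {v} {w} e j → cancel-*ˡ π≢0 _ _ (trans (sym (quotient v j)) (trans (ap-cong f e j) (quotient w j)))
    ; ap-+ = λ v w j → cancel-*ˡ π≢0 _ _ (trans (sym (quotient (λ i → v i + w i) j)) (trans (ap-+ f v w j)
        (trans (cong₂ _+_ (quotient v j) (quotient w j)) (sym (*-distribˡ-+ π (quot (f≋0 v j)) (quot (f≋0 w j)))))))
    ; ap-* = λ k v j → cancel-*ˡ π≢0 _ _ (trans (sym (quotient (λ i → k * v i) j)) (trans (ap-* f k v j)
        (trans (cong (_*_ k) (quotient v j)) (*-exchange k π (quot (f≋0 v j))))))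
    } , quotient
    where
    quotient : ∀ v j → ap f v j ≡ π * quot (f≋0 v j)
    quotient v j = trans (eq (f≋0 v j)) (+-identityˡ _)

  -- Conjugation by `[P, Γ; 0, Q]`, where p Γ = P B - B′ Q. The corner Γ is what absorbs multiples
  -- of p in B, because the upper left block is p times the identity.
  upper-similar : ∀ {J′ I′ : Set} {B : Lin J I} {B′ : Lin J′ I′} (P : Iso I I′) (Q : Iso J J′) →
                  (∀ v → ap (to P) (ap B v) ≋ ap B′ (ap (to Q) v)) → Similar (upper π B) (upper π B′)
  upper-similar {J} {I} {J′} {I′} {B} {B′} P Q e =
    record
      { to = ⟨ to P ∘L π₁ +L Γ ∘L π₂ , to Q ∘L π₂ ⟩
      ; from = ⟨ from P ∘L (π₁ +L (- 1ℤ) ∙L Γ ∘L from Q ∘L π₂) , from Q ∘L π₂ ⟩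
      ; from-to = λ { v (inj₁ i) → trans (ap-cong (from P) (λ i′ → trans
                        (cong (λ z → ap (to P) (v ∘ inj₁) i′ + ap Γ (v ∘ inj₂) i′ + - 1ℤ * z) (ap-cong Γ (from-to Q (v ∘ inj₂)) i′))
                        (cancel (ap (to P) (v ∘ inj₁) i′) (ap Γ (v ∘ inj₂) i′))) i) (from-to P (v ∘ inj₁) i)
                    ; v (inj₂ j) → from-to Q (v ∘ inj₂) j }
      ; to-from = λ { w (inj₁ i) → trans (cong (_+ ap Γ (ap (from Q) (w ∘ inj₂)) i) (to-from P _ i))
                        (cancel′ (w (inj₁ i)) (ap Γ (ap (from Q) (w ∘ inj₂)) i))
                    ; w (inj₂ j) → to-from Q (w ∘ inj₂) j }
      } by λ
      { v (inj₁ i) → trans (cong₂ _+_ (trans (ap-+ (to P) (λ l → π * v (inj₁ l)) (ap B (v ∘ inj₂)) i)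
                        (cong (_+ ap (to P) (ap B (v ∘ inj₂)) i) (ap-* (to P) π (v ∘ inj₁) i)))
                        (ap-0 Γ i))
          (regroup π (ap (to P) (v ∘ inj₁) i) (ap (to P) (ap B (v ∘ inj₂)) i) (ap Γ (v ∘ inj₂) i)
             (ap B′ (ap (to Q) (v ∘ inj₂)) i) (Γ-eq (v ∘ inj₂) i))
      ; v (inj₂ j) → ap-0 (to Q) j }
    where
    difference : Lin J I′
    difference = to P ∘L B +L (- 1ℤ) ∙L B′ ∘L to Q
    difference≋0 : ∀ v → ap difference v ≋ 𝟎
    difference≋0 v i = ≈-trans (≡⇒≈ (cong (_+_ (ap (to P) (ap B v) i)) (-1*i≡-i _))) (≈⇒-≈0 (e v i))
    Γ = proj₁ (divide difference difference≋0)
    Γ-eq = proj₂ (divide difference difference≋0)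
    cancel : ∀ a b → a + b + - 1ℤ * b ≡ a
    cancel = solve-∀
    cancel′ : ∀ a b → a + - 1ℤ * b + b ≡ a
    cancel′ = solve-∀
    regroup : ∀ π x b γ b′ → b + - 1ℤ * b′ ≡ π * γ → π * x + b + 0ℤ ≡ π * (x + γ) + b′
    regroup π x b γ b′ e = trans (expose π x b b′) (trans (cong (λ z → π * x + z + b′) e) (collect π x γ b′))
      where
      expose : ∀ π x b b′ → π * x + b + 0ℤ ≡ π * x + (b + - 1ℤ * b′) + b′
      expose = solve-∀
      collect : ∀ π x γ b′ → π * x + π * γ + b′ ≡ π * (x + γ) + b′
      collect = solve-∀

Similar-refl : {M : End I} → Similar M M
Similar-refl = idI by λ _ _ → refl

Similar-⊞ : ∀ {I J K L : Set} {M : End I} {N : End J} {O : End K} {Q : End L} →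
            Similar M N → Similar O Q → Similar (M ⊞ O) (N ⊞ Q)
Similar-⊞ (P by e) (R by f) = (P ⊕ R) by λ { v (inj₁ i) → e (v ∘ inj₁) i ; v (inj₂ k) → f (v ∘ inj₂) k }

-- Similarity classification

module Classification (p : ℕ) (pPrime : Prime p) (s : ℕ) (2≤s : 2 ℕ.≤ s) (p+1≡2s : suc p ≡ s ℕ.+ s) where

  open Rank p pPrime

  S : ℤ
  S = + s

  σ′ : ℤ
  σ′ = S * (S - 1ℤ)

  π≡ : π ≡ + 2 * S - 1ℤ
  π≡ = +-cancelˡ 1ℤ π (+ 2 * S - 1ℤ) (trans (cong +_ p+1≡2s) (trans (pos-+ s s) (double S)))
    where
    double : ∀ S → S + S ≡ 1ℤ + (+ 2 * S - 1ℤ)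
    double = solve-∀

  -- The matrix of N in the basis (δ, N δ, 1) of the summand of ℤ^I generated by a unit vector δ.
  nX : End (Fin 3)
  nX = 0L ◂L eval zero +L π ∙L eval (suc zero) ◂L σ′ ∙L eval (suc zero) +L (S * π) ∙L eval (suc (suc zero)) ◂L 0L

  model : ∀ m m′ → End (Fin 3 ⊎ ((Fin m ⊎ Fin m′) ⊎ (Fin m ⊎ Fin m′)))
  model m m′ = nX ⊞ upper π keepFirst

  trace-nX : trace nX ≡ π + S * π
  trace-nX = expanded π S σ′
    where
    expanded : ∀ π S σ′ → 0ℤ + (0ℤ + π * 1ℤ + (σ′ * 0ℤ + (S * π) * 1ℤ + 0ℤ)) ≡ π + S * π
    expanded = solve-∀

  -- The image of the constant function is divisible by p. The images of δ and N δ remain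
  -- independent because s (s - 1) is a unit modulo p.
  RankBasis-nX : RankBasis (Fin 2) nX
  RankBasis-nX = record
    { G = eval zero ◂L eval (suc zero) ◂L 0L
    ; independent = λ x e →
        let x₁≈0 : x (suc zero) ≈ 0ℤ
            x₁≈0 = unit-σ′ (x (suc zero)) (≈-trans (≡⇒≈ (drop (σ′ * x (suc zero)) (S * π))) (e (suc (suc zero)))) in
        λ { zero → ≈-trans (≡⇒≈ (sym (+-identityʳ (x zero))))
                   (≈-trans (≈-+ (≈-refl {x zero}) (≈-sym (multiple≈0 (x (suc zero))))) (e (suc zero)))
          ; (suc zero) → x₁≈0 }
    ; spanning = λ v → (v zero ◂ v (suc zero) ◂ λ ()) , λ
        { zero → ≈-refl ; (suc zero) → ≈-refl
        ; (suc (suc zero)) → ≈-+ (≈-refl {σ′ * v (suc zero)})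
            (≈-trans (≡⇒≈ (pull S π (v (suc (suc zero))))) (≈-trans (multiple≈0 _) (≡⇒≈ (sym (*-zeroʳ (S * π)))))) }
    }
    where
    drop : ∀ a b → a ≡ a + b * 0ℤ
    drop = solve-∀
    pull : ∀ S π a → S * π * a ≡ π * (S * a)
    pull = solve-∀
    -- 4 s (s − 1) = p² − 1
    unit-σ′ : ∀ a → σ′ * a ≈ 0ℤ → a ≈ 0ℤ
    unit-σ′ a e = ≈-trans (≡⇒≈ (rewritten π≡)) (≈-trans (≈-- (multiple≈0 (π * a)) (≈-* (+ 4) e)) (≡⇒≈ (cong (λ z → 0ℤ - z) (*-zeroʳ (+ 4)))))
      where
      identity : ∀ S a → a ≡ (+ 2 * S - 1ℤ) * ((+ 2 * S - 1ℤ) * a) - + 4 * (S * (S - 1ℤ) * a)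
      identity = solve-∀
      rewritten : ∀ {π} → π ≡ + 2 * S - 1ℤ → a ≡ π * (π * a) - + 4 * (σ′ * a)
      rewritten refl = identity S a

  RankBasis-upper-nX : ∀ {k} {B : Lin J K} → RankBasis (Fin k) B → RankBasis (Fin (2 ℕ.+ k)) (nX ⊞ upper π B)
  RankBasis-upper-nX {k = k} {B = B} b = RankBasis-reindex {f = nX ⊞ upper π B} (↔ₚ.↔-sym (Finₚ.+↔⊎ {2} {k}))
    (RankBasis-⊞ {f = nX} {g = upper π B} RankBasis-nX (RankBasis-upper {B = B} b))

  -- These data force N into a normal form that depends on p alone. σ is the sum of all values. The
  -- values prescribed for φ are those of the sum of two evaluations, at a neighbour and at a
  -- non-neighbour of the vertex that supports δ; they make the determinant of φ, φ N, σ on δ, N δ,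
  -- 1 equal to 1.
  record SRG {I : Set} ⦃ _ : Finite I ⦄ (N : End I) : Set where
    field
      n : ℕ
      enumeration : I ↔ Fin n
      order : trace (idL {I}) ≡ π * π
      trace-N : trace N ≡ S * (π * π)
      σ φ : Lin I ⊤
      δ : I → ℤ
      square : ∀ v → ap N (ap N v) ≐ λ i → π * ap N v i + σ′ * ap σ v tt
      N-1 : ap N (const 1ℤ) ≐ λ _ → S * π
      σ-N : ∀ v → ap σ (ap N v) tt ≡ S * π * ap σ v tt
      σ-1 : ap σ (const 1ℤ) tt ≡ π * π
      σ-δ : ap σ δ tt ≡ 1ℤ
      φ-δ : ap φ δ tt ≡ 0ℤ
      φ-Nδ : ap φ (ap N δ) tt ≡ 1ℤ
      φ-1 : ap φ (const 1ℤ) tt ≡ + 2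
      rankBasis : RankBasis (Fin (s ℕ.* s)) N

  module Split {I : Set} ⦃ _ : Finite I ⦄ {N : End I} (H : SRG N) where

    open SRG H

    ξ : Lin (Fin 3) I
    ξ = (δ ⊗ eval zero) +L (ap N δ ⊗ eval (suc zero)) +L (const 1ℤ ⊗ eval (suc (suc zero)))

    -- The functionals φ, φ N, σ restrict to the span of δ, N δ, 1 with determinant 1; this is the inverse matrix.
    coordinate : ℤ → ℤ → ℤ → Lin I ⊤
    coordinate a b c = a ∙L φ +L b ∙L (φ ∘L N) +L c ∙L σ

    πX : Lin I (Fin 3)
    πX = coordinate (- (π * π)) π (+ 2 - + 2 * S) ◂L coordinate π (- + 2) (+ 2) ◂L coordinate (1ℤ - S) 1ℤ (- 1ℤ) ◂L 0L

    private
      φN-N : ∀ v → ap φ (ap N (ap N v)) tt ≡ π * ap φ (ap N v) tt + σ′ * ap σ v tt * + 2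
      φN-N v = trans (ap-cong φ (square v) tt) (trans (ap-cong φ (λ i → cong (_+_ (π * ap N v i)) (sym (*-identityʳ (σ′ * ap σ v tt)))) tt)
        (trans (ap-+ φ (λ i → π * ap N v i) (λ _ → σ′ * ap σ v tt * 1ℤ) tt)
        (cong₂ _+_ (ap-* φ π (ap N v) tt) (trans (ap-* φ (σ′ * ap σ v tt) (const 1ℤ) tt) (cong (_*_ (σ′ * ap σ v tt)) φ-1)))))

      coordinate-value : ∀ a b c v {x y z} → ap φ v tt ≡ x → ap φ (ap N v) tt ≡ y → ap σ v tt ≡ z →
                         ap (coordinate a b c) v tt ≡ a * x + b * y + c * z
      coordinate-value a b c v refl refl refl = refl

    πX-δ : ap πX δ ≐ 1ℤ ◂ 0ℤ ◂ 0ℤ ◂ λ ()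
    πX-δ zero = trans (coordinate-value (- (π * π)) π (+ 2 - + 2 * S) δ φ-δ φ-Nδ σ-δ) (value π≡)
      where
      identity : ∀ S π → - (π * π) * 0ℤ + π * 1ℤ + (+ 2 - + 2 * S) * 1ℤ ≡ π - (+ 2 * S - 1ℤ) + 1ℤ
      identity = solve-∀
      value : ∀ {π} → π ≡ + 2 * S - 1ℤ → - (π * π) * 0ℤ + π * 1ℤ + (+ 2 - + 2 * S) * 1ℤ ≡ 1ℤ
      value refl = trans (identity S (+ 2 * S - 1ℤ)) (cong (_+ 1ℤ) (+-inverseʳ (+ 2 * S - 1ℤ)))
    πX-δ (suc zero) = trans (coordinate-value π (- + 2) (+ 2) δ φ-δ φ-Nδ σ-δ) (identity π)
      where
      identity : ∀ π → π * 0ℤ + - + 2 * 1ℤ + + 2 * 1ℤ ≡ 0ℤ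
      identity = solve-∀
    πX-δ (suc (suc zero)) = trans (coordinate-value (1ℤ - S) 1ℤ (- 1ℤ) δ φ-δ φ-Nδ σ-δ) (identity S)
      where
      identity : ∀ S → (1ℤ - S) * 0ℤ + 1ℤ * 1ℤ + - 1ℤ * 1ℤ ≡ 0ℤ
      identity = solve-∀

    πX-1 : ap πX (const 1ℤ) ≐ 0ℤ ◂ 0ℤ ◂ 1ℤ ◂ λ ()
    πX-1 = λ
      { zero → trans (coordinate-value (- (π * π)) π (+ 2 - + 2 * S) (const 1ℤ) φ-1 φ-N1 σ-1) (identity₀ S π)
      ; (suc zero) → trans (coordinate-value π (- + 2) (+ 2) (const 1ℤ) φ-1 φ-N1 σ-1) (value₁ π≡)
      ; (suc (suc zero)) → trans (coordinate-value (1ℤ - S) 1ℤ (- 1ℤ) (const 1ℤ) φ-1 φ-N1 σ-1) (value₂ π≡) }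
      where
      φ-N1 : ap φ (ap N (const 1ℤ)) tt ≡ S * π * + 2
      φ-N1 = trans (ap-cong φ (λ i → trans (N-1 i) (sym (*-identityʳ (S * π)))) tt)
             (trans (ap-* φ (S * π) (const 1ℤ) tt) (cong (_*_ (S * π)) φ-1))
      identity₀ : ∀ S π → - (π * π) * + 2 + π * (S * π * + 2) + (+ 2 - + 2 * S) * (π * π) ≡ 0ℤ
      identity₀ = solve-∀
      identity₁ : ∀ S → (+ 2 * S - 1ℤ) * + 2 + - + 2 * (S * (+ 2 * S - 1ℤ) * + 2) + + 2 * ((+ 2 * S - 1ℤ) * (+ 2 * S - 1ℤ)) ≡ 0ℤ
      identity₁ = solve-∀
      value₁ : ∀ {π} → π ≡ + 2 * S - 1ℤ → π * + 2 + - + 2 * (S * π * + 2) + + 2 * (π * π) ≡ 0ℤ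
      value₁ refl = identity₁ S
      identity₂ : ∀ S → (1ℤ - S) * + 2 + 1ℤ * (S * (+ 2 * S - 1ℤ) * + 2) + - 1ℤ * ((+ 2 * S - 1ℤ) * (+ 2 * S - 1ℤ)) ≡ 1ℤ
      identity₂ = solve-∀
      value₂ : ∀ {π} → π ≡ + 2 * S - 1ℤ → (1ℤ - S) * + 2 + 1ℤ * (S * π * + 2) + - 1ℤ * (π * π) ≡ 1ℤ
      value₂ refl = identity₂ S

    πX-N : ∀ v → ap πX (ap N v) ≐ ap nX (ap πX v)
    πX-N v = λ
      { zero → trans (cong₂ (λ y z → - (π * π) * b + π * y + (+ 2 - + 2 * S) * z) (φN-N v) (σ-N v)) (identity₀ S π b c)
      ; (suc zero) → trans (cong₂ (λ y z → π * b + - + 2 * y + + 2 * z) (φN-N v) (σ-N v)) (value₁ π≡)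
      ; (suc (suc zero)) → trans (cong₂ (λ y z → (1ℤ - S) * b + 1ℤ * y + - 1ℤ * z) (φN-N v) (σ-N v)) (value₂ π≡) }
      where
      a = ap φ v tt
      b = ap φ (ap N v) tt
      c = ap σ v tt
      identity₀ : ∀ S π b c → - (π * π) * b + π * (π * b + S * (S - 1ℤ) * c * + 2) + (+ 2 - + 2 * S) * (S * π * c) ≡ 0ℤ
      identity₀ = solve-∀
      identity₁ : ∀ S a b c → let π = + 2 * S - 1ℤ in
        π * b + - + 2 * (π * b + S * (S - 1ℤ) * c * + 2) + + 2 * (S * π * c) ≡
        - (π * π) * a + π * b + (+ 2 - + 2 * S) * c + π * (π * a + - + 2 * b + + 2 * c)
      identity₁ = solve-∀
      value₁ : ∀ {π} → π ≡ + 2 * S - 1ℤ →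
        π * b + - + 2 * (π * b + S * (S - 1ℤ) * c * + 2) + + 2 * (S * π * c) ≡
        - (π * π) * a + π * b + (+ 2 - + 2 * S) * c + π * (π * a + - + 2 * b + + 2 * c)
      value₁ refl = identity₁ S a b c
      identity₂ : ∀ S a b c → let π = + 2 * S - 1ℤ in
        (1ℤ - S) * b + 1ℤ * (π * b + S * (S - 1ℤ) * c * + 2) + - 1ℤ * (S * π * c) ≡
        S * (S - 1ℤ) * (π * a + - + 2 * b + + 2 * c) + S * π * ((1ℤ - S) * a + 1ℤ * b + - 1ℤ * c)
      identity₂ = solve-∀
      value₂ : ∀ {π} → π ≡ + 2 * S - 1ℤ →
        (1ℤ - S) * b + 1ℤ * (π * b + S * (S - 1ℤ) * c * + 2) + - 1ℤ * (S * π * c) ≡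
        S * (S - 1ℤ) * (π * a + - + 2 * b + + 2 * c) + S * π * ((1ℤ - S) * a + 1ℤ * b + - 1ℤ * c)
      value₂ refl = identity₂ S a b c

    N-ξ : ∀ x → ap N (ap ξ x) ≐ ap ξ (ap nX x)
    N-ξ x i = trans (ap-+ N (λ j → x zero * δ j + x (suc zero) * ap N δ j) (λ _ → x (suc (suc zero)) * 1ℤ) i)
      (trans (cong₂ _+_ (trans (ap-+ N (λ j → x zero * δ j) (λ j → x (suc zero) * ap N δ j) i)
                               (cong₂ _+_ (ap-* N (x zero) δ i) (trans (ap-* N (x (suc zero)) (ap N δ) i) (cong (_*_ (x (suc zero))) (trans (square δ i) (cong (λ z → π * ap N δ i + σ′ * z) σ-δ))))))
                        (trans (ap-* N (x (suc (suc zero))) (const 1ℤ) i) (cong (_*_ (x (suc (suc zero)))) (N-1 i))))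
             (regroup (x zero) (x (suc zero)) (x (suc (suc zero))) (δ i) (ap N δ i) π σ′ (S * π)))
      where
      regroup : ∀ a b c d e π σ′ k → a * e + b * (π * e + σ′ * 1ℤ) + c * k ≡ 0ℤ * d + (a + π * b) * e + (σ′ * b + k * c) * 1ℤ
      regroup = solve-∀

    πX-ξ : ∀ x → ap πX (ap ξ x) ≐ x
    πX-ξ x i = trans (ap-+ πX (λ j → x zero * δ j + x (suc zero) * ap N δ j) (λ _ → x (suc (suc zero)) * 1ℤ) i)
      (trans (cong₂ _+_ (trans (ap-+ πX (λ j → x zero * δ j) (λ j → x (suc zero) * ap N δ j) i)
                               (cong₂ _+_ (trans (ap-* πX (x zero) δ i) (cong (_*_ (x zero)) (πX-δ i)))
                                          (trans (ap-* πX (x (suc zero)) (ap N δ) i) (cong (_*_ (x (suc zero))) (πX-Nδ i)))))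
                        (trans (ap-* πX (x (suc (suc zero))) (const 1ℤ) i) (cong (_*_ (x (suc (suc zero)))) (πX-1 i))))
             (combine i))
      where
      πX-Nδ : ap πX (ap N δ) ≐ 0ℤ ◂ 1ℤ ◂ 0ℤ ◂ λ ()
      πX-Nδ i = trans (πX-N δ i) (trans (ap-cong nX πX-δ i) (value i))
        where
        value : ap nX (1ℤ ◂ 0ℤ ◂ 0ℤ ◂ λ ()) ≐ 0ℤ ◂ 1ℤ ◂ 0ℤ ◂ λ ()
        value zero = refl
        value (suc zero) = identity π
          where
          identity : ∀ π → 1ℤ + π * 0ℤ ≡ 1ℤ
          identity = solve-∀
        value (suc (suc zero)) = identity σ′ (S * π)
          where
          identity : ∀ a b → a * 0ℤ + b * 0ℤ ≡ 0ℤ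
          identity = solve-∀
      combine : ∀ i → x zero * (1ℤ ◂ 0ℤ ◂ 0ℤ ◂ λ ()) i + x (suc zero) * (0ℤ ◂ 1ℤ ◂ 0ℤ ◂ λ ()) i + x (suc (suc zero)) * (0ℤ ◂ 0ℤ ◂ 1ℤ ◂ λ ()) i ≡ x i
      combine zero = identity (x zero) (x (suc zero)) (x (suc (suc zero)))
        where
        identity : ∀ a b c → a * 1ℤ + b * 0ℤ + c * 0ℤ ≡ a
        identity = solve-∀
      combine (suc zero) = identity (x zero) (x (suc zero)) (x (suc (suc zero)))
        where
        identity : ∀ a b c → a * 0ℤ + b * 1ℤ + c * 0ℤ ≡ b
        identity = solve-∀
      combine (suc (suc zero)) = identity (x zero) (x (suc zero)) (x (suc (suc zero)))
        where
        identity : ∀ a b c → a * 0ℤ + b * 0ℤ + c * 1ℤ ≡ c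
        identity = solve-∀

    -- The projection onto the common kernel of the three coordinates in `πX`. It is integral
    -- because these coordinates are, and so its image is a free complement to the span of δ, N δ,
    -- 1.
    E : End I
    E = idL +L (- 1ℤ) ∙L (ξ ∘L πX)

    πX-E : ∀ v → ap πX (ap E v) ≐ λ _ → 0ℤ
    πX-E v i = trans (ap-+ πX v (λ j → - 1ℤ * ap ξ (ap πX v) j) i)
      (trans (cong (_+_ (ap πX v i)) (trans (ap-* πX (- 1ℤ) (ap ξ (ap πX v)) i) (cong (_*_ (- 1ℤ)) (πX-ξ (ap πX v) i)))) (cancel (ap πX v i)))
      where
      cancel : ∀ a → a + - 1ℤ * a ≡ 0ℤ
      cancel = solve-∀

    E-fixes : ∀ v → ap πX v ≐ (λ _ → 0ℤ) → ap E v ≐ v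
    E-fixes v e i = trans (cong (λ z → v i + - 1ℤ * z) (trans (ap-cong ξ e i) (ap-0 ξ i))) (+-identityʳ (v i))

    E-ξ : ∀ x → ap E (ap ξ x) ≐ λ _ → 0ℤ
    E-ξ x i = trans (cong (λ z → ap ξ x i + - 1ℤ * z) (ap-cong ξ (πX-ξ x) i)) (cancel (ap ξ x i))
      where
      cancel : ∀ a → a + - 1ℤ * a ≡ 0ℤ
      cancel = solve-∀

    private
      h = reindexI enumeration

    abstract
      splitting : Splitting (to h ∘L E ∘L from h)
      splitting = splitIdempotent (to h ∘L E ∘L from h) (λ v i →
        trans (ap-cong (to h ∘L E) (from-to h (ap E (ap (from h) v))) i)
              (ap-cong (to h) (E-fixes (ap E (ap (from h) v)) (πX-E (ap (from h) v))) i))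

    open Splitting splitting public using () renaming (r to y; rank to y-rank; ι to ι₀; π to π₀; πι to πι₀; ιπ to ιπ₀)

    ι : Lin (Fin y) I
    ι = from h ∘L ι₀

    πY : Lin I (Fin y)
    πY = π₀ ∘L to h

    πY-ι : ∀ u → ap πY (ap ι u) ≐ u
    πY-ι u i = trans (ap-cong π₀ (to-from h (ap ι₀ u)) i) (πι₀ u i)

    ι-πY : ∀ v → ap ι (ap πY v) ≐ ap E v
    ι-πY v i = trans (ap-cong (from h) (ιπ₀ (ap (to h) v)) i)
               (trans (from-to h (ap E (ap (from h) (ap (to h) v))) i) (ap-cong E (from-to h v) i))

    πY-ξ : ∀ x → ap πY (ap ξ x) ≐ λ _ → 0ℤ
    πY-ξ x i = trans (sym (πY-ι (ap πY (ap ξ x)) i)) (trans (ap-cong πY (λ j → trans (ι-πY (ap ξ x) j) (E-ξ x j)) i) (ap-0 πY i))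

    πX-ι : ∀ u → ap πX (ap ι u) ≐ λ _ → 0ℤ
    πX-ι u i = trans (ap-cong (πX ∘L ι) (λ j → sym (πY-ι u j)) i)
               (trans (ap-cong πX (ι-πY (ap ι u)) i) (πX-E (ap ι u) i))

    decomposition : Iso I (Fin 3 ⊎ Fin y)
    decomposition = record
      { to = ⟨ πX , πY ⟩
      ; from = ξ ∘L π₁ +L ι ∘L π₂
      ; from-to = λ v i → trans (cong (_+_ (ap ξ (ap πX v) i)) (ι-πY v i)) (cancel (ap ξ (ap πX v) i) (v i))
      ; to-from = λ
        { w (inj₁ i) → trans (ap-+ πX (ap ξ (w ∘ inj₁)) (ap ι (w ∘ inj₂)) i)
                       (trans (cong₂ _+_ (πX-ξ (w ∘ inj₁) i) (πX-ι (w ∘ inj₂) i)) (+-identityʳ (w (inj₁ i))))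
        ; w (inj₂ i) → trans (ap-+ πY (ap ξ (w ∘ inj₁)) (ap ι (w ∘ inj₂)) i)
                       (trans (cong₂ _+_ (πY-ξ (w ∘ inj₁) i) (πY-ι (w ∘ inj₂) i)) (+-identityˡ (w (inj₂ i)))) }
      }
      where
      cancel : ∀ a b → a + (b + - 1ℤ * a) ≡ b
      cancel = solve-∀

    NY : End (Fin y)
    NY = πY ∘L N ∘L ι

    NY-πY : ∀ v → ap πY (ap N v) ≐ ap NY (ap πY v)
    NY-πY v i = trans (ap-cong (πY ∘L N) {v} {λ j → ap ξ (ap πX v) j + ap E v j} (λ j → expose (ap ξ (ap πX v) j) (v j)) i)
      (trans (ap-+ (πY ∘L N) (ap ξ (ap πX v)) (ap E v) i)
      (trans (cong₂ _+_ (trans (ap-cong πY (N-ξ (ap πX v)) i) (πY-ξ (ap nX (ap πX v)) i))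
                        (ap-cong (πY ∘L N) (λ j → sym (ι-πY v j)) i))
             (+-identityˡ (ap NY (ap πY v) i))))
      where
      expose : ∀ a b → b ≡ a + (b + - 1ℤ * a)
      expose = solve-∀

    N-similar : Similar N (nX ⊞ NY)
    N-similar = decomposition by λ { v (inj₁ i) → πX-N v i ; v (inj₂ i) → NY-πY v i }

    -- The summand s (s - 1) J has constant functions as values, and these lie in the part that `πY`
    -- kills.
    NY-square : ∀ u → ap NY (ap NY u) ≐ λ i → π * ap NY u i
    NY-square u i = trans (sym (NY-πY (ap N (ap ι u)) i)) (trans (ap-cong πY (square (ap ι u)) i)
      (trans (ap-+ πY (λ j → π * ap N (ap ι u) j) (λ _ → σ′ * ap σ (ap ι u) tt) i)
      (trans (cong₂ _+_ (ap-* πY π (ap N (ap ι u)) i)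
                        (trans (ap-cong πY (λ j → sym (*-identityʳ (σ′ * ap σ (ap ι u) tt))) i) (trans (ap-* πY (σ′ * ap σ (ap ι u) tt) (const 1ℤ) i)
                          (trans (cong (_*_ (σ′ * ap σ (ap ι u) tt)) (πY-1 i)) (*-zeroʳ (σ′ * ap σ (ap ι u) tt))))))
             (+-identityʳ (π * ap NY u i)))))
      where
      πY-1 : ap πY (const 1ℤ) ≐ λ _ → 0ℤ
      πY-1 i = trans (ap-cong πY (λ j → sym (one (δ j) (ap N δ j))) i) (πY-ξ (0ℤ ◂ 0ℤ ◂ 1ℤ ◂ λ ()) i)
        where
        one : ∀ a b → 0ℤ * a + 0ℤ * b + 1ℤ * 1ℤ ≡ 1ℤ
        one = solve-∀

    rank-Y : + y ≡ π * π - + 3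
    rank-Y = trans y-rank (trans (sym (Similar-trace (conjugate h E)))
      (trans (trace-+ idL ((- 1ℤ) ∙L (ξ ∘L πX)))
             (cong₂ _+_ order (trans (trace-∙ (- 1ℤ) (ξ ∘L πX)) (cong (_*_ (- 1ℤ)) (trans (trace-comm πX ξ)
               (trace-cong {M = πX ∘L ξ} {idL} πX-ξ)))))))

    trace-NY : trace NY ≡ S * (π * π) - (π + S * π)
    trace-NY = trans (trace-comm (N ∘L ι) πY) (trans (trace-cong {M = (N ∘L ι) ∘L πY} {N +L (- 1ℤ) ∙L (ξ ∘L (nX ∘L πX))} restrict)
      (trans (trace-+ N ((- 1ℤ) ∙L (ξ ∘L (nX ∘L πX))))
             (cong₂ _+_ trace-N (trans (trace-∙ (- 1ℤ) (ξ ∘L (nX ∘L πX))) (trans (cong (_*_ (- 1ℤ)) (trans (trace-comm (nX ∘L πX) ξ)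
               (trans (trace-cong {M = (nX ∘L πX) ∘L ξ} {nX} (λ x → ap-cong nX (πX-ξ x))) trace-nX))) (-1*i≡-i (π + S * π)))))))
      where
      restrict : ∀ v → ap N (ap ι (ap πY v)) ≐ λ i → ap N v i + - 1ℤ * ap ξ (ap nX (ap πX v)) i
      restrict v i = trans (ap-cong N (ι-πY v) i) (trans (ap-+ N v (λ j → - 1ℤ * ap ξ (ap πX v) j) i)
        (cong (_+_ (ap N v i)) (trans (ap-* N (- 1ℤ) (ap ξ (ap πX v)) i) (cong (_*_ (- 1ℤ)) (N-ξ (ap πX v) i)))))

  record Classified {I : Set} (N : End I) : Set where
    field
      m m′ : ℕ
      rank : 2 ℕ.+ m ≡ s ℕ.* s
      size : + (m ℕ.+ m′) ≡ + 2 * S * S - + 2 * S - 1ℤ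
      similar : Similar N (model m m′)

  classify : ∀ {I : Set} ⦃ _ : Finite I ⦄ {N : End I} → SRG N → Classified N
  classify {I} {N} H = conclude t≡r T.B T.similar
    where
    open SRG H
    module X = Split H
    abstract
      triangular : Triangular π X.NY
      triangular = triangularize X.y π≢0 X.NY X.NY-square
    module T = Triangular triangular

    -- The trace of `upper π B` is p r, and the trace on the complement is s p² - p - s p; hence r =
    -- s p - s - 1, which is 2 s² - 2 s - 1.
    value-r : ∀ {π} → π ≡ + 2 * S - 1ℤ → π ≢ 0ℤ → ∀ r → π * r ≡ S * (π * π) - (π + S * π) → r ≡ + 2 * S * S - + 2 * S - 1ℤ
    value-r refl π≢0 r e = cancel-*ˡ π≢0 _ _ (trans e (identity S))
      where
      identity : ∀ S → S * ((+ 2 * S - 1ℤ) * (+ 2 * S - 1ℤ)) - ((+ 2 * S - 1ℤ) + S * (+ 2 * S - 1ℤ)) ≡ (+ 2 * S - 1ℤ) * (+ 2 * S * S - + 2 * S - 1ℤ)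
      identity = solve-∀
    r-value : + T.r ≡ + 2 * S * S - + 2 * S - 1ℤ
    r-value = value-r π≡ π≢0 (+ T.r) (trans (sym (trace-upper π T.B)) (trans (sym (Similar-trace T.similar)) X.trace-NY))
    -- The complement has rank p² - 3 = 2 r, so B is square and elimination applies to it.
    value-t : ∀ {π} → π ≡ + 2 * S - 1ℤ → ∀ r t → r + t ≡ π * π - + 3 → r ≡ + 2 * S * S - + 2 * S - 1ℤ → t ≡ r
    value-t refl r t e refl = +-cancelˡ r t r (trans e (identity S))
      where
      identity : ∀ S → (+ 2 * S - 1ℤ) * (+ 2 * S - 1ℤ) - + 3 ≡ (+ 2 * S * S - + 2 * S - 1ℤ) + (+ 2 * S * S - + 2 * S - 1ℤ)
      identity = solve-∀
    t≡r : T.t ≡ T.r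
    t≡r = +-injective (value-t π≡ (+ T.r) (+ T.t) (trans (sym (pos-+ T.r T.t)) (trans (cong +_ T.r+t) X.rank-Y)) r-value)

    conclude : ∀ {t} → t ≡ T.r → (B : Lin (Fin t) (Fin T.r)) → Similar X.NY (upper π B) → Classified N
    conclude refl B NY-similar = Sum.[ reduced , full ] (reduce T.r B)
      where
      N-upper : Similar N (nX ⊞ upper π B)
      N-upper = Similar-trans X.N-similar (Similar-⊞ {M = nX} {N = nX} {O = X.NY} {Q = upper π B} (Similar-refl {M = nX}) NY-similar)
      reduced : Reduced B → Classified N
      reduced R = record
        { m = m ; m′ = m′
        ; rank = rank-unique {f = model m m′} (RankBasis-upper-nX {B = keepFirst {Fin m} {Fin m′}} RankBasis-keepFirst) (RankBasis-similar N-model rankBasis)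
        ; size = trans (cong +_ m+m′) r-value
        ; similar = N-model }
        where
        open Reduced R
        N-model : Similar N (model m m′)
        N-model = Similar-trans N-upper (Similar-⊞ {M = nX} {N = nX} {O = upper π B} {Q = upper π (keepFirst {Fin m} {Fin m′})}
          (Similar-refl {M = nX}) (upper-similar {B = B} {B′ = keepFirst} P Q reduces))
      full : InjectiveMod B → Classified N
      full inj = contradiction (rank-unique {f = nX ⊞ upper π B} (RankBasis-upper-nX {B = B} (RankBasis-injective {f = B} inj)) (RankBasis-similar N-upper rankBasis)) impossible
        where
        -- Equality amounts to (s - 1)² = 0, against 2 ≤ s.
        impossible : 2 ℕ.+ T.r ≢ s ℕ.* s
        impossible e = contradiction (+-injective {s} {1} S≡1) (λ { refl → contradiction 2≤s (λ { (ℕ.s≤s ()) }) })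
          where
          S²-identity : ∀ S r → r ≡ + 2 * S * S - + 2 * S - 1ℤ → + 2 + r ≡ S * S → (S - 1ℤ) * (S - 1ℤ) ≡ 0ℤ
          S²-identity S r refl e = trans (identity S) (trans (cong (λ z → z - S * S) e) (+-inverseʳ (S * S)))
            where
            identity : ∀ S → (S - 1ℤ) * (S - 1ℤ) ≡ + 2 + (+ 2 * S * S - + 2 * S - 1ℤ) - S * S
            identity = solve-∀
          S≡1 : S ≡ 1ℤ
          S≡1 = i-j≡0⇒i≡j S 1ℤ (Sum.[ id , id ] (i*j≡0⇒i≡0∨j≡0 (S - 1ℤ) (S²-identity S (+ T.r) r-value
                  (trans (sym (pos-+ 2 T.r)) (trans (cong +_ e) (pos-* s s))))))

  -- The rank and size equations in `Classified` determine m and m′ from s, so both operators are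
  -- similar to the same model.
  SRG-similar : ∀ {I J : Set} ⦃ _ : Finite I ⦄ ⦃ _ : Finite J ⦄ {M : End I} {N : End J} → SRG M → SRG N → Similar M N
  SRG-similar {M = M} {N} H H′ = agree (classify H) (classify H′)
    where
    agree : Classified M → Classified N → Similar M N
    agree c c′ with ℕₚ.+-cancelˡ-≡ 2 (Classified.m c) (Classified.m c′) (trans (Classified.rank c) (sym (Classified.rank c′)))
    agree record { m = m ; m′ = m′ ; size = size ; similar = f } record { m′ = m″ ; size = size′ ; similar = g } | refl
      with ℕₚ.+-cancelˡ-≡ m m′ m″ (+-injective (trans size (sym size′)))
    ... | refl = Similar-trans f (Similar-sym g)

∑L : ∀ {A : Set} → List A → Lin A ⊤
∑L xs = record
  { ap = λ v _ → ∑ xs v ; ap-cong = λ e _ → ∑-cong xs e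
  ; ap-+ = λ v w _ → ∑-+ xs v w ; ap-* = λ k v _ → ∑-* xs k v }

-- Line sums on the plane and their rank

record Abelian (G : Set) : Set where
  infixl 6 _⊹_
  field
    _⊹_ : G → G → G
    0g : G
    ⊖_ : G → G
    assoc : ∀ x y z → (x ⊹ y) ⊹ z ≡ x ⊹ (y ⊹ z)
    comm : ∀ x y → x ⊹ y ≡ y ⊹ x
    identityʳ : ∀ x → x ⊹ 0g ≡ x
    inverseʳ : ∀ x → x ⊹ (⊖ x) ≡ 0g

  infixr 7 _⋆_
  _⋆_ : ℕ → G → G
  zero ⋆ x = 0g
  suc n ⋆ x = x ⊹ n ⋆ x

  Exponent : ℕ → Set
  Exponent n = ∀ x → n ⋆ x ≡ 0g

  identityˡ : ∀ x → 0g ⊹ x ≡ x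
  identityˡ x = trans (comm 0g x) (identityʳ x)

  inverseˡ : ∀ x → (⊖ x) ⊹ x ≡ 0g
  inverseˡ x = trans (comm (⊖ x) x) (inverseʳ x)

  cancelʳ : ∀ x y z → x ⊹ z ≡ y ⊹ z → x ≡ y
  cancelʳ x y z e = trans (sym (restore x)) (trans (cong (_⊹ (⊖ z)) e) (restore y))
    where
    restore : ∀ x → x ⊹ z ⊹ (⊖ z) ≡ x
    restore x = trans (assoc x z (⊖ z)) (trans (cong (x ⊹_) (inverseʳ z)) (identityʳ x))

  exchange : ∀ x y z → x ⊹ y ⊹ z ≡ x ⊹ z ⊹ y
  exchange x y z = trans (assoc x y z) (trans (cong (x ⊹_) (comm y z)) (sym (assoc x z y)))

suc-*ʳ : ∀ n a → n * a + a ≡ (1ℤ + n) * a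
suc-*ʳ = solve-∀

telescope : ∀ a b c → a - b + (b - c) ≡ a - c
telescope = solve-∀

module Translations (p : ℕ) (pPrime : Prime p) {G : Set} ⦃ FG : Finite G ⦄ (𝔾 : Abelian G)
                    (exponent : Abelian.Exponent 𝔾 p) where

  open Abelian 𝔾
  open Modulo p pPrime

  shift : G → End G
  shift w = reindex (_⊹ w)

  Δ : G → End G
  Δ w = idL +L (- 1ℤ) ∙L shift w

  -- With τ_d for `shift d`, this is the geometric sum 1 + τ_d + ⋯ + τ_d^(n-1), and `Δ d` is 1 -
  -- τ_d. For n = p it is the sum B_d over a line, and 1 - τ_d^p = 0.
  segment : ℕ → G → End G
  segment zero d = 0L
  segment (suc n) d = segment n d +L shift (n ⋆ d)

  lineSum : G → End G
  lineSum = segment p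

  lineSums : List G → End G
  lineSums [] = 0L
  lineSums (d ∷ ds) = lineSum d +L lineSums ds

  Δs : List G → End G
  Δs [] = idL
  Δs (w ∷ ws) = Δ w ∘L Δs ws

  Δ≡ : ∀ w v x → ap (Δ w) v x ≡ v x - v (x ⊹ w)
  Δ≡ w v x = cong (_+_ (v x)) (-1*i≡-i (v (x ⊹ w)))

  Equivariant : End G → Set
  Equivariant f = ∀ w v → ap f (ap (shift w) v) ≐ ap (shift w) (ap f v)

  module _ {f : End G} (eqv : Equivariant f) where

    Δ-comm : ∀ w v → ap f (ap (Δ w) v) ≐ ap (Δ w) (ap f v)
    Δ-comm w v x = trans (ap-+ f v (λ y → - 1ℤ * v (y ⊹ w)) x)
      (cong (_+_ (ap f v x)) (trans (ap-* f (- 1ℤ) (ap (shift w) v) x) (cong (_*_ (- 1ℤ)) (eqv w v x))))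

    segment-comm : ∀ n d v → ap f (ap (segment n d) v) ≐ ap (segment n d) (ap f v)
    segment-comm zero d v x = ap-0 f x
    segment-comm (suc n) d v x = trans (ap-+ f (ap (segment n d) v) (ap (shift (n ⋆ d)) v) x)
      (cong₂ _+_ (segment-comm n d v x) (eqv (n ⋆ d) v x))

    lineSums-comm : ∀ ds v → ap f (ap (lineSums ds) v) ≐ ap (lineSums ds) (ap f v)
    lineSums-comm [] v x = ap-0 f x
    lineSums-comm (d ∷ ds) v x = trans (ap-+ f (ap (lineSum d) v) (ap (lineSums ds) v) x)
      (cong₂ _+_ (segment-comm p d v x) (lineSums-comm ds v x))

    Δs-comm : ∀ ws v → ap f (ap (Δs ws) v) ≐ ap (Δs ws) (ap f v)
    Δs-comm [] v x = refl
    Δs-comm (w ∷ ws) v x = trans (Δ-comm w (ap (Δs ws) v) x) (ap-cong (Δ w) (Δs-comm ws v) x)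

  shift-shift : ∀ u → Equivariant (shift u)
  shift-shift u w v x = cong v (exchange x u w)

  eqv-Δ : ∀ u → Equivariant (Δ u)
  eqv-Δ u w v x = sym (Δ-comm {shift w} (shift-shift w) u v x)

  eqv-lineSum : ∀ d → Equivariant (lineSum d)
  eqv-lineSum d w v x = sym (segment-comm {shift w} (shift-shift w) p d v x)

  eqv-lineSums : ∀ ds → Equivariant (lineSums ds)
  eqv-lineSums ds w v x = sym (lineSums-comm {shift w} (shift-shift w) ds v x)

  eqv-Δs : ∀ ws → Equivariant (Δs ws)
  eqv-Δs ws w v x = sym (Δs-comm {shift w} (shift-shift w) ws v x)

  ⋆-suc : ∀ n d x → x ⊹ n ⋆ d ⊹ d ≡ x ⊹ suc n ⋆ d
  ⋆-suc n d x = trans (assoc x (n ⋆ d) d) (cong (x ⊹_) (comm (n ⋆ d) d))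

  segment-telescope : ∀ n d v x → ap (segment n d) (ap (Δ d) v) x ≡ v x - v (x ⊹ n ⋆ d)
  segment-telescope zero d v x = sym (trans (cong (λ y → v x - v y) (identityʳ x)) (+-inverseʳ (v x)))
  segment-telescope (suc n) d v x = trans (cong₂ _+_ (segment-telescope n d v x)
      (trans (Δ≡ d v (x ⊹ n ⋆ d)) (cong (λ y → v (x ⊹ n ⋆ d) - v y) (⋆-suc n d x))))
    (telescope (v x) (v (x ⊹ n ⋆ d)) (v (x ⊹ suc n ⋆ d)))

  lineSum-Δ : ∀ d v → ap (lineSum d) (ap (Δ d) v) ≐ λ _ → 0ℤ
  lineSum-Δ d v x = trans (segment-telescope p d v x)
    (trans (cong (λ y → v x - v y) (trans (cong (x ⊹_) (exponent d)) (identityʳ x))) (+-inverseʳ (v x)))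

  -- In the group ring, 1 - τ_w τ_u = (1 - τ_w) + (1 - τ_u) τ_w.
  Δ-⊹ : ∀ w u v → ap (Δ (w ⊹ u)) v ≐ λ x → ap (Δ w) v x + ap (Δ u) (ap (shift w) v) x
  Δ-⊹ w u v x = trans (Δ≡ (w ⊹ u) v x) (sym (trans (cong₂ _+_ (Δ≡ w v x) (Δ≡ u (ap (shift w) v) x))
    (trans (telescope (v x) (v (x ⊹ w)) (v (x ⊹ u ⊹ w))) (cong (λ y → v x - v y) (trans (exchange x u w) (assoc x w u))))))

  -- The divisibility of 1 - τ^n by 1 - τ.
  Δ-multiple : ∀ n d v → Σ (G → ℤ) λ v′ → ap (Δ (n ⋆ d)) v ≐ ap (Δ d) v′
  Δ-multiple zero d v = (λ _ → 0ℤ) , λ x → trans (Δ≡ 0g v x)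
    (trans (cong (λ y → v x - v y) (identityʳ x)) (trans (+-inverseʳ (v x)) (sym (ap-0 (Δ d) x))))
  Δ-multiple (suc n) d v = let v′ , e = Δ-multiple n d (ap (shift d) v) in
    (λ x → v x + v′ x) , λ x → trans (Δ-⊹ d (n ⋆ d) v x) (trans (cong (_+_ (ap (Δ d) v x)) (e x)) (sym (ap-+ (Δ d) v v′ x)))

  lineSum-Δ-multiple : ∀ n d v → ap (lineSum d) (ap (Δ (n ⋆ d)) v) ≐ λ _ → 0ℤ
  lineSum-Δ-multiple n d v x = let v′ , e = Δ-multiple n d v in
    trans (ap-cong (lineSum d) e x) (lineSum-Δ d v′ x)

  lineSum-invariant : ∀ d v → ap (shift d) (ap (lineSum d) v) ≐ ap (lineSum d) v
  lineSum-invariant d v x = sym (i-j≡0⇒i≡j _ _ (trans (sym (Δ≡ d (ap (lineSum d) v) x))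
    (trans (sym (Δ-comm {lineSum d} (eqv-lineSum d) d v x)) (lineSum-Δ d v x))))

  segment-invariant : ∀ n d v → ap (shift d) v ≐ v → ap (segment n d) v ≐ λ x → + n * v x
  segment-invariant zero d v inv x = sym (*-zeroˡ (v x))
  segment-invariant (suc n) d v inv x = trans (cong₂ _+_ (segment-invariant n d v inv x) (shifted n x))
    (suc-*ʳ (+ n) (v x))
    where
    shifted : ∀ n x → v (x ⊹ n ⋆ d) ≡ v x
    shifted zero x = cong v (identityʳ x)
    shifted (suc n) x = trans (cong v (sym (⋆-suc n d x))) (trans (inv (x ⊹ n ⋆ d)) (shifted n x))

  lineSum-lineSum : ∀ d v → ap (lineSum d) (ap (lineSum d) v) ≐ λ x → π * ap (lineSum d) v x
  lineSum-lineSum d v = segment-invariant p d (ap (lineSum d) v) (lineSum-invariant d v)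

  lineSums-1 : ∀ ds → ap (lineSums ds) (const 1ℤ) ≐ λ _ → + length ds * π
  lineSums-1 [] x = sym (*-zeroˡ π)
  lineSums-1 (d ∷ ds) x = trans (cong₂ _+_ (segment-invariant p d (const 1ℤ) (λ _ → refl) x) (lineSums-1 ds x))
    (next π (+ length ds))
    where
    next : ∀ π n → π * 1ℤ + n * π ≡ (1ℤ + n) * π
    next = solve-∀

  -- `planeSum` is the identity B_d B_w = J, on which the quadratic equation rests; `generate`
  -- propagates invariance under d and w to the whole plane.
  record Transversal (d w : G) : Set where
    field
      generate : ∀ x → Σ ℕ λ a → Σ ℕ λ b → x ≡ a ⋆ d ⊹ b ⋆ w
      planeSum : ∀ v x → ap (lineSum d) (ap (lineSum w) v) x ≡ Sum v

  open Transversal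

  lineSum-lineSums : ∀ {d} ds → All (Transversal d) ds → ∀ v → ap (lineSum d) (ap (lineSums ds) v) ≐ λ _ → + length ds * Sum v
  lineSum-lineSums {d} [] [] v x = trans (ap-0 (lineSum d) x) (sym (*-zeroˡ (Sum v)))
  lineSum-lineSums {d} (w ∷ ds) (t ∷ ts) v x = trans (ap-+ (lineSum d) (ap (lineSum w) v) (ap (lineSums ds) v) x)
    (trans (cong₂ _+_ (planeSum t v x) (lineSum-lineSums ds ts v x))
    (sym (suc-* (+ length ds) (Sum v))))

  -- On the diagonal B_d² = p B_d, and each of the s (s - 1) ordered pairs of distinct directions
  -- contributes J.
  lineSums-square : ∀ ds → AllPairs Transversal ds → ∀ v →
    ap (lineSums ds) (ap (lineSums ds) v) ≐ λ x → π * ap (lineSums ds) v x + + length ds * (+ length ds - 1ℤ) * Sum v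
  lineSums-square [] [] v x = sym (simplify π (Sum v))
    where
    simplify : ∀ π a → π * 0ℤ + 0ℤ * (0ℤ - 1ℤ) * a ≡ 0ℤ
    simplify = solve-∀
  lineSums-square (d ∷ ds) (ts ∷ tss) v x = trans (cong₂ _+_
      (trans (ap-+ (lineSum d) (ap (lineSum d) v) (ap (lineSums ds) v) x) (cong₂ _+_ (lineSum-lineSum d v x) (lineSum-lineSums ds ts v x)))
      (trans (ap-+ (lineSums ds) (ap (lineSum d) v) (ap (lineSums ds) v) x)
        (cong₂ _+_ (trans (sym (lineSums-comm {lineSum d} (eqv-lineSum d) ds v x)) (lineSum-lineSums ds ts v x)) (lineSums-square ds tss v x))))
    (regroup π (ap (lineSum d) v x) (ap (lineSums ds) v x) (+ length ds) (Sum v))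
    where
    regroup : ∀ π a b n j → π * a + n * j + (n * j + (π * b + n * (n - 1ℤ) * j)) ≡ π * (a + b) + (1ℤ + n) * (1ℤ + n - 1ℤ) * j
    regroup = solve-∀

  -- J = B_d B_w commutes with translations and its values are constant functions, so translating
  -- the argument only moves the point at which a constant is read off.
  Sum-shift : ∀ {d w} → Transversal d w → ∀ u v → Sum (ap (shift u) v) ≡ Sum v
  Sum-shift {d} {w} t u v = trans (sym (planeSum t (ap (shift u) v) 0g))
    (trans (ap-cong (lineSum d) (eqv-lineSum w u v) 0g)
    (trans (eqv-lineSum d u (ap (lineSum w) v) 0g) (planeSum t v (0g ⊹ u))))

  Sum-Δ : ∀ {d w} → Transversal d w → ∀ u v → Sum (ap (Δ u) v) ≡ 0ℤ
  Sum-Δ t u v = trans (∑-+ elems v (λ x → - 1ℤ * v (x ⊹ u)))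
    (trans (cong (_+_ (Sum v)) (trans (∑-* elems (- 1ℤ) (ap (shift u) v)) (trans (-1*i≡-i _) (cong -_ (Sum-shift t u v))))) (+-inverseʳ (Sum v)))

  Sum-segment : ∀ {d w} → Transversal d w → ∀ n u v → Sum (ap (segment n u) v) ≡ + n * Sum v
  Sum-segment t zero u v = trans (∑-zero (elems {G}) (λ _ → refl)) (sym (*-zeroˡ (Sum v)))
  Sum-segment t (suc n) u v = trans (∑-+ elems (ap (segment n u) v) (ap (shift (n ⋆ u)) v))
    (trans (cong₂ _+_ (Sum-segment t n u v) (Sum-shift t (n ⋆ u) v)) (suc-*ʳ (+ n) (Sum v)))

  Sum-lineSums : ∀ {d w} → Transversal d w → ∀ ds v → Sum (ap (lineSums ds) v) ≡ + length ds * π * Sum v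
  Sum-lineSums t [] v = trans (∑-zero (elems {G}) (λ _ → refl)) (sym (*-zeroˡ (Sum v)))
  Sum-lineSums t (d ∷ ds) v = trans (∑-+ elems (ap (lineSum d) v) (ap (lineSums ds) v))
    (trans (cong₂ _+_ (Sum-segment t p d v) (Sum-lineSums t ds v))
    (next π (+ length ds) (Sum v)))
    where
    next : ∀ π n a → π * a + n * π * a ≡ (1ℤ + n) * π * a
    next = solve-∀

-- The rank modulo p of the sum over half of the directions.

module PlaneRank (p : ℕ) (pPrime : Prime p) {G : Set} ⦃ FG : Finite G ⦄ (𝔾 : Abelian G)
                 (exponent : Abelian.Exponent 𝔾 p) where

  open Abelian 𝔾
  open Rank p pPrime
  open Translations p pPrime 𝔾 exponent
  open Transversal

  power : ℕ → G → End G
  power zero e = idL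
  power (suc k) e = power k e ∘L Δ e

  -- The multiples of e represent the lines in direction d: by `unique`, the line through b e
  -- contains no multiple of e other than b e itself.
  record Complement (d e : G) : Set where
    field
      spans : ∀ x → Σ ℕ λ a → Σ ℕ λ b → x ≡ a ⋆ d ⊹ b ⋆ e
      unique : ∀ {j b n} → j ℕ.< p → b ℕ.< p → n ℕ.< p → j ⋆ e ≡ b ⋆ e ⊹ n ⋆ d → j ≡ b × n ≡ 0

  open Complement

  Invariant : G → (G → ℤ) → Set
  Invariant d v = ap (shift d) v ≋ v

  invariant-⋆ : ∀ n {d v} → Invariant d v → Invariant (n ⋆ d) v
  invariant-⋆ zero {v = v} inv x = ≡⇒≈ (cong v (identityʳ x))
  invariant-⋆ (suc n) {d} {v} inv x = ≈-trans (≡⇒≈ (cong v (sym (⋆-suc n d x)))) (≈-trans (inv (x ⊹ n ⋆ d)) (invariant-⋆ n inv x))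

  Δ≋0⇒invariant : ∀ w v → ap (Δ w) v ≋ 𝟎 → Invariant w v
  Δ≋0⇒invariant w v e x = ≈-sym (-≈0⇒≈ (≈-trans (≡⇒≈ (sym (Δ≡ w v x))) (e x)))

  invariant⇒Δ≋0 : ∀ w v → Invariant w v → ap (Δ w) v ≋ 𝟎
  invariant⇒Δ≋0 w v inv x = ≈-trans (≡⇒≈ (Δ≡ w v x)) (≈⇒-≈0 (≈-sym (inv x)))

  -- A function invariant under d and under a transversal w is constant modulo p.
  peel : ∀ {d} e ws → All (Transversal d) ws → ∀ u → Invariant d u → ap (Δs ws) u ≋ 𝟎 → ap (power (length ws) e) u ≋ 𝟎
  peel e [] [] u inv z = z
  peel {d} e (w ∷ ws) (t ∷ ts) u inv z = peel e ws ts (ap (Δ e) u) (Δ-inv e u inv)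
      (λ x → ≈-trans (≡⇒≈ (sym (Δs-comm {Δ e} (eqv-Δ e) ws u x))) (invariant⇒Δ≋0 e y everywhere x))
    where
    y = ap (Δs ws) u
    Δ-inv : ∀ w u → Invariant d u → Invariant d (ap (Δ w) u)
    Δ-inv w u inv x = ≈-trans (≡⇒≈ (sym (eqv-Δ w d u x))) (ap-≋ (Δ w) inv x)
    y-inv-d : Invariant d y
    y-inv-d x = ≈-trans (≡⇒≈ (sym (eqv-Δs ws d u x))) (ap-≋ (Δs ws) inv x)
    y-inv-w : Invariant w y
    y-inv-w = Δ≋0⇒invariant w y z
    everywhere : Invariant e y
    everywhere x with generate t e
    ... | a , b , refl = ≈-trans (≡⇒≈ (cong y (sym (assoc x (a ⋆ d) (b ⋆ w)))))
                         (≈-trans (invariant-⋆ b y-inv-w (x ⊹ a ⋆ d)) (invariant-⋆ a y-inv-d x))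

  -- A sequence with vanishing k-th differences behaves like a polynomial of degree less than k, so
  -- k consecutive zeros annihilate it. The differences have k - 1 consecutive zeros, hence vanish
  -- by induction, and the sequence is constant.
  power-zero : ∀ k e (u : G → ℤ) b → (∀ j → j ℕ.< k → u ((j ℕ.+ b) ⋆ e) ≈ 0ℤ) → ap (power k e) u ≋ 𝟎 → ∀ n → u (n ⋆ e) ≈ 0ℤ
  power-zero zero e u b zeros vanish n = vanish (n ⋆ e)
  power-zero (suc k) e u b zeros vanish n = ≈-trans (to-origin n) (≈-trans (≈-sym (to-origin b)) (zeros 0 (ℕ.s≤s ℕ.z≤n)))
    where
    difference : ∀ n → ap (Δ e) u (n ⋆ e) ≡ u (n ⋆ e) - u (suc n ⋆ e)
    difference n = trans (Δ≡ e u (n ⋆ e)) (cong (λ y → u (n ⋆ e) - u y) (comm (n ⋆ e) e))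
    Δ-zero : ∀ n → ap (Δ e) u (n ⋆ e) ≈ 0ℤ
    Δ-zero = power-zero k e (ap (Δ e) u) b (λ j j<k → ≈-trans (≡⇒≈ (difference (j ℕ.+ b)))
      (≈-- (zeros j (ℕₚ.m<n⇒m<1+n j<k)) (zeros (suc j) (ℕ.s≤s j<k)))) vanish
    to-origin : ∀ n → u (n ⋆ e) ≈ u 0g
    to-origin zero = ≈-refl
    to-origin (suc n) = ≈-trans (≈-sym (-≈0⇒≈ (≈-trans (≡⇒≈ (sym (difference n))) (Δ-zero n)))) (to-origin n)

  points : ∀ {k} → (Fin k → G) → Lin (Fin k) G
  points {zero} f = 0L
  points {suc k} f = (unit (f zero) ⊗ eval zero) +L points (f ∘ suc) ∘L reindex suc

  points-sum : ∀ {k} (f : Fin k → G) c → ap (points f) c ≐ λ x → Sum (λ j → c j * unit (f j) x)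
  points-sum {zero} f c x = refl
  points-sum {suc k} f c x = trans (cong (_+_ (c zero * unit (f zero) x)) (points-sum (f ∘ suc) (c ∘ suc) x))
    (sym (∑-Fin-suc (λ j → c j * unit (f j) x)))

  -- Modulo direction d the powers of τ_e below p are distinct, so a combination of points on the
  -- transversal line can be read off from its line sums.
  lineSum-unit : ∀ {d e} → Complement d e → ∀ j b → j ℕ.< p → b ℕ.< p →
                 ap (lineSum d) (unit (j ⋆ e)) (b ⋆ e) ≡ indicator (j ℕ.≟ b)
  lineSum-unit {d} {e} C j b j<p b<p = trans (below p ℕₚ.≤-refl) (peak p (ℕₚ.≤-<-trans ℕ.z≤n b<p))
    where
    peak : ∀ n → 0 ℕ.< n → indicator (j ℕ.≟ b) * indicator (0 ℕ.<? n) ≡ indicator (j ℕ.≟ b)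
    peak n 0<n = trans (cong (_*_ (indicator (j ℕ.≟ b))) (indicator-yes (0 ℕ.<? n) 0<n)) (*-identityʳ _)
    term′ : ∀ n → n ℕ.< p → (d₁ : Dec (j ≡ b)) (d₂ : Dec (n ≡ 0)) → unit (j ⋆ e) (b ⋆ e ⊹ n ⋆ d) ≡ indicator d₁ * indicator d₂
    term′ n n<p (yes refl) (yes refl) = indicator-yes (j ⋆ e ≟ (j ⋆ e ⊹ 0g)) (sym (identityʳ (j ⋆ e)))
    term′ n n<p (yes _) (no n≢0) = indicator-no (j ⋆ e ≟ (b ⋆ e ⊹ n ⋆ d)) (λ q → n≢0 (proj₂ (unique C j<p b<p n<p q)))
    term′ n n<p (no j≢b) d₂ = trans (indicator-no (j ⋆ e ≟ (b ⋆ e ⊹ n ⋆ d)) (λ q → j≢b (proj₁ (unique C j<p b<p n<p q)))) (sym (*-zeroˡ (indicator d₂)))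
    term : ∀ n → n ℕ.< p → unit (j ⋆ e) (b ⋆ e ⊹ n ⋆ d) ≡ indicator (j ℕ.≟ b) * indicator (n ℕ.≟ 0)
    term n n<p = term′ n n<p (j ℕ.≟ b) (n ℕ.≟ 0)
    -- Only the term n = 0 of the segment can hit the point, so the partial sums are constant from
    -- length 1 on.
    below : ∀ n → n ℕ.≤ p → ap (segment n d) (unit (j ⋆ e)) (b ⋆ e) ≡ indicator (j ℕ.≟ b) * indicator (0 ℕ.<? n)
    below zero _ = sym (*-zeroʳ (indicator (j ℕ.≟ b)))
    below (suc zero) n≤p = trans (cong (_+_ 0ℤ) (term 0 n≤p)) (+-identityˡ _)
    below (suc (suc n)) n≤p = trans (cong₂ _+_ (below (suc n) (ℕₚ.<⇒≤ n≤p)) (trans (term (suc n) n≤p) (*-zeroʳ (indicator (j ℕ.≟ b)))))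
      (+-identityʳ _)

  lineSum-points : ∀ {d e k} → Complement d e → k ℕ.≤ p → ∀ (c : Fin k → ℤ) b → b ℕ.< p →
                   ap (lineSum d) (ap (points (λ j → toℕ j ⋆ e)) c) (b ⋆ e) ≡ Sum (λ j → c j * indicator (toℕ j ℕ.≟ b))
  lineSum-points {d} {e} {k} C k≤p c b b<p =
    trans (ap-cong (lineSum d) (points-sum (λ j → toℕ j ⋆ e) c) (b ⋆ e))
    (trans (ap-∑ (lineSum d) (elems {Fin k}) c (λ j → unit (toℕ j ⋆ e)) (b ⋆ e))
    (∑-cong (elems {Fin k}) (λ j → cong (_*_ (c j)) (lineSum-unit C (toℕ j) b (ℕₚ.<-≤-trans (Finₚ.toℕ<n j) k≤p) b<p))))

  points-coefficient : ∀ {d e k} → Complement d e → k ℕ.≤ p → ∀ (c : Fin k → ℤ) i →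
                       ap (lineSum d) (ap (points (λ j → toℕ j ⋆ e)) c) (toℕ i ⋆ e) ≡ c i
  points-coefficient {k = k} C k≤p c i = trans (lineSum-points C k≤p c (toℕ i) (ℕₚ.<-≤-trans (Finₚ.toℕ<n i) k≤p))
    (trans (∑-cong (elems {Fin k}) (λ j → trans (*-comm (c j) _)
      (cong (_* c j) (indicator-map (toℕ j ℕ.≟ toℕ i) (i Fin.≟ j) (λ q → sym (Finₚ.toℕ-injective q)) (λ q → cong toℕ (sym q))))))
    (∑-indicator i c))

  points-outside : ∀ {d e k} → Complement d e → k ℕ.≤ p → ∀ (c : Fin k → ℤ) b → k ℕ.≤ b → b ℕ.< p →
                   ap (lineSum d) (ap (points (λ j → toℕ j ⋆ e)) c) (b ⋆ e) ≡ 0ℤ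
  points-outside {k = k} C k≤p c b k≤b b<p = trans (lineSum-points C k≤p c b b<p)
    (∑-zero (elems {Fin k}) (λ j → trans (cong (_*_ (c j)) (indicator-no (toℕ j ℕ.≟ b) (λ q → ℕₚ.<⇒≢ (ℕₚ.<-≤-trans (Finₚ.toℕ<n j) k≤b) q)))
                                          (*-zeroʳ (c j))))

  -- Two families of directions, of size s = (p + 1) / 2 each, that together make up all directions.
  module Halves (s′ : ℕ) (p≡ : p ≡ suc (s′ ℕ.+ s′)) (e : G → G) (dS dU : List G)
                (sizeS : length dS ≡ suc s′) (sizeU : length dU ≡ suc s′)
                (complementS : All (λ d → Complement d (e d)) dS)
                (transversalSS : AllPairs Transversal dS)
                (transversalSym : ∀ {d w} → Transversal d w → Transversal w d)
                (transversalSU : All (λ d → All (Transversal d) dU) dS)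
                (total : ∀ v x → ap (lineSums dS) v x + ap (lineSums dU) v x ≡ π * v x + Sum v) where

    s = suc s′

    N : End G
    N = lineSums dS

    s≤p : s ℕ.≤ p
    s≤p = subst (s ℕ.≤_) (sym p≡) (ℕ.s≤s (ℕₚ.m≤m+n s′ s′))

    row : G → Lin (Fin s) G
    row d = points (λ j → toℕ j ⋆ e d)

    Block : List G → Set
    Block [] = ⊥
    Block (d ∷ ds) = Fin s ⊎ Block ds

    -- The nesting puts the rows of all later directions under Δ_d, so that the line sums in
    -- direction d see none of them. Taking the row of d away leaves the same problem with one more
    -- factor Δ_d.
    family : ∀ L → Lin (Block L) G
    family [] = 0L
    family (d ∷ L) = row d ∘L π₁ +L (Δ d ∘L family L) ∘L π₂

    Block↔Fin : ∀ L → Block L ↔ Fin (length L ℕ.* s)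
    Block↔Fin [] = ↔ₚ.↔-sym Finₚ.0↔⊥
    Block↔Fin (d ∷ L) = ↔ₚ.↔-trans (↔ₚ.↔-refl ⊎ₚ.⊎-↔ Block↔Fin L) (↔ₚ.↔-sym Finₚ.+↔⊎)

    lineSums-Δs : ∀ L v → ap (lineSums L) (ap (Δs L) v) ≐ 𝟎
    lineSums-Δs [] v x = refl
    lineSums-Δs (d ∷ L) v x = cong₂ _+_ (lineSum-Δ d (ap (Δs L) v) x)
      (trans (Δ-comm {lineSums L} (eqv-lineSums L) d (ap (Δs L) v) x) (trans (ap-cong (Δ d) (lineSums-Δs L v) x) (ap-0 (Δ d) x)))

    Δs-++ : ∀ L D v → ap (Δs (L ++ D)) v ≐ ap (Δs L) (ap (Δs D) v)
    Δs-++ [] D v x = refl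
    Δs-++ (w ∷ L) D v x = ap-cong (Δ w) (Δs-++ L D v) x

    -- The invariant of both inductions: D consists of the directions whose factor Δ is already in
    -- front, L of those still to be treated, and together they make up S.
    record Stage (D L : List G) : Set where
      field
        split : ∀ v → ap N v ≐ λ x → ap (lineSums D) v x + ap (lineSums L) v x
        complement : All (λ d → Complement d (e d)) L
        transversalLL : AllPairs Transversal L
        transversalLD : All (λ d → All (Transversal d) D) L
        transversalLU : All (λ d → All (Transversal d) dU) L
        size : length L ℕ.+ length D ≡ s

    start : Stage [] dS
    start = record
      { split = λ v x → sym (+-identityˡ (ap N v x)) ; complement = complementS ; transversalLL = transversalSS
      ; transversalLD = All.universal (λ _ → []) dS ; transversalLU = transversalSU
      ; size = trans (ℕₚ.+-identityʳ (length dS)) sizeS }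

    next : ∀ {D d L} → Stage D (d ∷ L) → Stage (d ∷ D) L
    next {D} {d} {L} record { split = split ; complement = _ ∷ c ; transversalLL = t ∷ ts ; transversalLD = _ ∷ tD ; transversalLU = _ ∷ tU ; size = size } = record
      { split = λ v x → trans (split v x) (exchange₃ (ap (lineSums D) v x) (ap (lineSum d) v x) (ap (lineSums L) v x))
      ; complement = c ; transversalLL = ts
      ; transversalLD = All.zipWith (λ (u , us) → transversalSym u ∷ us) (t , tD)
      ; transversalLU = tU ; size = trans (ℕₚ.+-suc (length L) (length D)) size }
      where
      exchange₃ : ∀ a b c → a + (b + c) ≡ b + a + c
      exchange₃ = solve-∀

    -- Multiplying by Δs L leaves only the line sums in direction d.
    isolate : ∀ {D d L} → Stage D (d ∷ L) → ∀ r f →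
              ap N (ap (Δs L) (ap (Δs D) (λ x → r x + ap (Δ d) f x))) ≐ ap (Δs (L ++ D)) (ap (lineSum d) r)
    isolate {D} {d} {L} st r f x = trans (split y x)
      (trans (cong₂ _+_ (trans (Δs-comm {lineSums D} (eqv-lineSums D) L (ap (Δs D) w) x)
                               (trans (ap-cong (Δs L) (lineSums-Δs D w) x) (ap-0 (Δs L) x)))
                        (cong₂ _+_ (trans (Δs-comm {lineSum d} (eqv-lineSum d) L (ap (Δs D) w) x)
                                   (trans (ap-cong (Δs L) (λ z → trans (Δs-comm {lineSum d} (eqv-lineSum d) D w z) (ap-cong (Δs D) killed z)) x)
                                          (sym (Δs-++ L D (ap (lineSum d) r) x))))
                                   (lineSums-Δs L (ap (Δs D) w) x)))
             (simplify (ap (Δs (L ++ D)) (ap (lineSum d) r) x)))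
      where
      open Stage st
      w : G → ℤ
      w z = r z + ap (Δ d) f z
      y = ap (Δs L) (ap (Δs D) w)
      killed : ap (lineSum d) w ≐ ap (lineSum d) r
      killed z = trans (ap-+ (lineSum d) r (ap (Δ d) f) z) (trans (cong (_+_ (ap (lineSum d) r z)) (lineSum-Δ d f z)) (+-identityʳ _))
      simplify : ∀ a → 0ℤ + (a + 0ℤ) ≡ a
      simplify = solve-∀

    -- Let u be the line sums in direction d of the row of d. It is invariant under d and
    -- annihilated by Δ for the s - 1 other directions of S, hence by s - 1 differences along e.
    -- Having s - 1 consecutive zeros it vanishes, and so do the coefficients of the row; the factor
    -- Δ_d then moves to D.
    family-independent : ∀ D L → Stage D L → ∀ x → ap N (ap (Δs D) (ap (family L) x)) ≋ 𝟎 → x ≋ 𝟎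
    family-independent D [] st x vanish ()
    family-independent D (d ∷ L) st@record { complement = C ∷ _ ; transversalLL = tL ∷ _ ; transversalLD = tD ∷ _ ; size = size } x vanish =
      λ { (inj₁ i) → c≋0 i ; (inj₂ i) → rest i }
      where
      c = x ∘ inj₁
      r = ap (row d) c
      f = ap (family L) (x ∘ inj₂)
      u = ap (lineSum d) r
      isolated : ap (Δs (L ++ D)) u ≋ 𝟎
      isolated z = ≈-trans (≡⇒≈ (trans (sym (isolate st r f z)) (Δs-comm {N} (eqv-lineSums dS) L _ z))) (ap-≋0 (Δs L) vanish z)
      len : length (L ++ D) ≡ s′
      len = trans (Listₚ.length-++ L) (ℕₚ.suc-injective size)
      differences : ap (power s′ (e d)) u ≋ 𝟎
      differences = subst (λ n → ap (power n (e d)) u ≋ 𝟎) len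
        (peel (e d) (L ++ D) (Allₚ.++⁺ tL tD) u (λ z → ≡⇒≈ (lineSum-invariant d r z)) isolated)
      -- The row is supported on the multiples below s, which leaves the p - s = s - 1 multiples
      -- from s to p - 1.
      zeros : ∀ j → j ℕ.< s′ → u ((j ℕ.+ s) ⋆ e d) ≈ 0ℤ
      zeros j j<s′ = ≡⇒≈ (points-outside C s≤p c (j ℕ.+ s) (ℕₚ.m≤n+m s j)
        (subst (j ℕ.+ s ℕ.<_) (trans (ℕₚ.+-suc s′ s′) (sym p≡)) (ℕₚ.+-monoˡ-< s j<s′)))
      c≋0 : c ≋ 𝟎
      c≋0 i = ≈-trans (≡⇒≈ (sym (points-coefficient C s≤p c i))) (power-zero s′ (e d) u s zeros differences (toℕ i))
      rest : (x ∘ inj₂) ≋ 𝟎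
      rest = family-independent (d ∷ D) L (next st) (x ∘ inj₂) (λ z → ≈-trans
        (≡⇒≈ (ap-cong N (λ z → sym (Δ-comm {Δs D} (eqv-Δs D) d f z)) z))
        (≈-trans (ap-≋ (N ∘L Δs D) (λ z → ≈-trans (≡⇒≈ (sym (+-identityˡ _))) (≈-+ (≈-sym (ap-≋0 (row d) c≋0 z)) (≈-refl {ap (Δ d) f z}))) z) (vanish z)))

    eqv-power : ∀ k w → Equivariant (power k w)
    eqv-power zero w u v x = refl
    eqv-power (suc k) w u v x = trans (ap-cong (power k w) (eqv-Δ w u v) x) (eqv-power k w u (ap (Δ w) v) x)

    unit-shift : ∀ w z x → unit (w ⊹ z) (x ⊹ w) ≡ unit z x
    unit-shift w z x = indicator-map ((w ⊹ z) ≟ (x ⊹ w)) (z ≟ x)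
      (λ q → cancelʳ z x w (trans (comm z w) q)) (λ q → trans (comm w z) (cong (_⊹ w) q))

    Δ-unit : ∀ w z → ap (Δ w) (unit (w ⊹ z)) ≐ λ x → unit (w ⊹ z) x - unit z x
    Δ-unit w z x = trans (Δ≡ w (unit (w ⊹ z)) x) (cong (λ a → unit (w ⊹ z) x - a) (unit-shift w z x))

    module Reduction {d : G} (C : Complement d (e d)) where

      -- The operator ∏ (1 - τ) over suitable multiples of the directions us that are congruent to e d modulo d.
      scaled : ∀ us → All (Transversal d) us → End G
      scaled [] [] = idL
      scaled (u ∷ us) (t ∷ ts) = Δ (proj₁ (proj₂ (generate t (e d))) ⋆ u) ∘L scaled us ts

      scaled-killed : ∀ us ts v → ap (lineSums us) (ap (scaled us ts) v) ≐ 𝟎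
      scaled-killed [] [] v x = refl
      scaled-killed (u ∷ us) (t ∷ ts) v x = cong₂ _+_ (lineSum-Δ-multiple b u (ap (scaled us ts) v) x)
        (trans (Δ-comm {lineSums us} (eqv-lineSums us) (b ⋆ u) (ap (scaled us ts) v) x)
        (trans (ap-cong (Δ (b ⋆ u)) (scaled-killed us ts v) x) (ap-0 (Δ (b ⋆ u)) x)))
        where b = proj₁ (proj₂ (generate t (e d)))

      eqv-scaled : ∀ us ts → Equivariant (scaled us ts)
      eqv-scaled [] [] w v x = refl
      eqv-scaled (u ∷ us) (t ∷ ts) w v x = trans (ap-cong (Δ (b ⋆ u)) (eqv-scaled us ts w v) x) (eqv-Δ (b ⋆ u) w (ap (scaled us ts) v) x)
        where b = proj₁ (proj₂ (generate t (e d)))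

      -- Writing e = a d + b u gives 1 - τ_e = (1 - τ_{bu}) + (1 - τ_{ad}) τ_{bu}, where the last
      -- term is a multiple of Δ_d. One factor 1 - τ_e is exchanged for each u.
      scaled-power : ∀ us ts v → Σ (G → ℤ) λ v′ → ap (power (length us) (e d)) v ≐ λ x → ap (scaled us ts) v x + ap (Δ d) v′ x
      scaled-power [] [] v = (λ _ → 0ℤ) , λ x → sym (trans (cong (_+_ (v x)) (ap-0 (Δ d) x)) (+-identityʳ (v x)))
      scaled-power (u ∷ us) (t ∷ ts) v with generate t (e d)
      ... | a , b , e≡ = (λ x → v₁ x + ap (power k (e d)) v₂ x) , λ x →
        trans (ap-cong (power k (e d)) Δe x) (trans (ap-+ (power k (e d)) (ap (Δ (b ⋆ u)) v) (ap (Δ d) v₂) x)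
        (trans (cong₂ _+_ (trans (≡₁ x) (cong (_+ ap (Δ d) v₁ x) (Δ-comm {scaled us ts} (eqv-scaled us ts) (b ⋆ u) v x)))
                          (Δ-comm {power k (e d)} (eqv-power k (e d)) d v₂ x))
        (trans (+-assoc (ap (Δ (b ⋆ u)) (ap (scaled us ts) v) x) (ap (Δ d) v₁ x) (ap (Δ d) (ap (power k (e d)) v₂) x)) (cong (_+_ (ap (Δ (b ⋆ u)) (ap (scaled us ts) v) x)) (sym (ap-+ (Δ d) v₁ (ap (power k (e d)) v₂) x))))))
        where
        k = length us
        multiple = Δ-multiple a d (ap (shift (b ⋆ u)) v)
        v₂ = proj₁ multiple
        Δe : ap (Δ (e d)) v ≐ λ x → ap (Δ (b ⋆ u)) v x + ap (Δ d) v₂ x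
        Δe x = trans (cong (λ w → ap (Δ w) v x) (trans e≡ (comm (a ⋆ d) (b ⋆ u))))
               (trans (Δ-⊹ (b ⋆ u) (a ⋆ d) v x) (cong (_+_ (ap (Δ (b ⋆ u)) v x)) (proj₂ multiple x)))
        IH = scaled-power us ts (ap (Δ (b ⋆ u)) v)
        v₁ = proj₁ IH
        ≡₁ = proj₂ IH

    module Spanning {d : G} (C : Complement d (e d)) (ts : All (Transversal d) dU) where

      open Reduction C

      -- The three parts of a function at one stage: a row, which belongs to the basis; a multiple
      -- of Δ_d, which is passed to the next stage; and a multiple of `scaled`, which N kills modulo
      -- p.
      R : Lin (Fin s ⊎ (G ⊎ G)) G
      R = row d ∘L π₁ +L (Δ d ∘L π₁ +L scaled dU ts ∘L π₂) ∘L π₂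

      Reducible : (G → ℤ) → Set
      Reducible = Image R

      row-reducible : ∀ c → Reducible (ap (row d) c)
      row-reducible c = [ c , 𝟎 ] , λ x → sym (trans (cong (_+_ (ap (row d) c x)) (ap-0 (Δ d +L scaled dU ts) x)) (+-identityʳ _))

      Δ-reducible : ∀ v → Reducible (ap (Δ d) v)
      Δ-reducible v = [ 𝟎 , [ v , 𝟎 ] ] , λ x → sym (trans (cong₂ (λ a b → a + (ap (Δ d) v x + b)) (ap-0 (row d) x) (ap-0 (scaled dU ts) x)) (drop (ap (Δ d) v x)))
        where
        drop : ∀ a → 0ℤ + (a + 0ℤ) ≡ a
        drop = solve-∀

      power-reducible : ∀ v → Reducible (ap (power s (e d)) v)
      power-reducible v = let v′ , q = scaled-power dU ts v in [ 𝟎 , [ v′ , v ] ] , λ x →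
        trans (cong (λ n → ap (power n (e d)) v x) (sym sizeU)) (trans (q x) (trans (rearrange (ap (scaled dU ts) v x) (ap (Δ d) v′ x))
          (cong (_+ (ap (Δ d) v′ x + ap (scaled dU ts) v x)) (sym (ap-0 (row d) x)))))
        where
        rearrange : ∀ a b → a + b ≡ 0ℤ + (b + a)
        rearrange = solve-∀

      multiple : ℕ → G → ℤ
      multiple b = unit (b ⋆ e d)

      power-multiple : ∀ k b → ap (power (suc k) (e d)) (multiple (suc b)) ≐
                       λ x → ap (power k (e d)) (multiple (suc b)) x - ap (power k (e d)) (multiple b) x
      power-multiple k b x = trans (ap-cong (power k (e d)) (Δ-unit (e d) (b ⋆ e d)) x)
        (ap-sub (power k (e d)) (multiple (suc b)) (multiple b) x)

      small : ∀ k b → b ℕ.< s → k ℕ.≤ b → Reducible (ap (power k (e d)) (multiple b))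
      small zero b b<s _ = Image-cong R (λ x → trans (points-sum (λ j → toℕ j ⋆ e d) (unit i) x)
        (trans (∑-indicator i (λ j → unit (toℕ j ⋆ e d) x)) (cong (λ n → unit (n ⋆ e d) x) (Finₚ.toℕ-fromℕ< b<s)))) (row-reducible (unit i))
        where i = fromℕ< b<s
      small (suc k) (suc b) b<s (ℕ.s≤s k≤b) = Image-cong R (λ x → sym (power-multiple k b x))
        (Image-sub R (small k (suc b) b<s (ℕₚ.m≤n⇒m≤1+n k≤b)) (small k b (ℕₚ.<-trans (ℕₚ.n<1+n b) b<s) k≤b))

      -- Division by the monic polynomial (1 - τ)^s, as a downward induction on k. For k = s the
      -- element is a multiple of `scaled` up to Δ_d. For smaller k, passing from b to b + 1 costs
      -- one more factor 1 - τ, and the start b = k < s is covered by `small`. The case k = 0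
      -- reaches every multiple of `e d`.
      large : ∀ m k → k ℕ.+ m ≡ s → ∀ b → k ℕ.≤ b → Reducible (ap (power k (e d)) (multiple b))
      large zero k k+m≡s b k≤b = subst (λ k → Reducible (ap (power k (e d)) (multiple b))) (trans (sym k+m≡s) (ℕₚ.+-identityʳ k)) (power-reducible (multiple b))
      large (suc m) k k+m≡s = from-k
        where
        base : ∀ b → b ≡ k → Reducible (ap (power k (e d)) (multiple b))
        base b refl = small k k (subst (k ℕ.<_) k+m≡s (ℕₚ.m<m+n k ℕ.z<s)) ℕₚ.≤-refl
        from-k : ∀ b → k ℕ.≤ b → Reducible (ap (power k (e d)) (multiple b))
        from-k b k≤b with ℕₚ.m≤n⇒m<n∨m≡n k≤b
        from-k b _ | inj₂ k≡b = base b (sym k≡b)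
        from-k (suc b) _ | inj₁ (ℕ.s≤s k≤b) = Image-cong R
          (λ x → trans (cong (_+ ap (power k (e d)) (multiple b) x) (power-multiple k b x)) (restore (ap (power k (e d)) (multiple (suc b)) x) (ap (power k (e d)) (multiple b) x)))
          (Image-+ R (large m (suc k) (trans (sym (ℕₚ.+-suc k m)) k+m≡s) (suc b) (ℕ.s≤s k≤b)) (from-k b k≤b))
          where
          restore : ∀ a b → a - b + b ≡ a
          restore = solve-∀

      unit-reducible : ∀ x → Reducible (unit x)
      unit-reducible x with Complement.spans C x
      ... | a , b , refl = translate a
        where
        restore : ∀ a b → b + (a - b) ≡ a
        restore = solve-∀
        translate : ∀ a → Reducible (unit (a ⋆ d ⊹ b ⋆ e d))
        translate zero = Image-cong R (λ x → cong (λ z → unit z x) (sym (identityˡ (b ⋆ e d)))) (large s 0 refl b ℕ.z≤n)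
        translate (suc a) = Image-cong R
          (λ x → trans (cong (_+_ (unit z x)) (Δ-unit d z x)) (trans (restore (unit (d ⊹ z) x) (unit z x)) (cong (λ y → unit y x) (sym (assoc d (a ⋆ d) (b ⋆ e d))))))
          (Image-+ R (translate a) (Δ-reducible (unit (d ⊹ z))))
          where z = a ⋆ d ⊹ b ⋆ e d

      reducible : ∀ v → Reducible v
      reducible v = Image-cong R (λ x → sym (expand v x)) (sum-reducible elems)
        where
        sum-reducible : ∀ xs → Reducible (λ y → ∑ xs (λ x → v x * unit x y))
        sum-reducible [] = Image-cong R (λ x → ap-0 (Δ d) x) (Δ-reducible 𝟎)
        sum-reducible (x ∷ xs) = Image-+ R (Image-* R (v x) (unit-reducible x)) (sum-reducible xs)

    -- The line sums over U annihilate w, and so does J. As the line sums over S and U add up to p +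
    -- J, the operator N acts on w as multiplication by p.
    opposite-killed : ∀ {d} (C : Complement d (e d)) ts T → Equivariant T → ∀ v →
                      ap N (ap T (ap (Reduction.scaled C dU ts) v)) ≋ 𝟎
    opposite-killed {d} C ts T eqv-T v x = ≈-trans (≡⇒≈ (trans (isolate-N (ap N w x) (ap (lineSums dU) w x) (π * w x) (Sum w) (total w x) killed sum-zero) refl)) (multiple≈0 (w x))
      where
      open Reduction C
      w = ap T (ap (scaled dU ts) v)
      killed : ap (lineSums dU) w x ≡ 0ℤ
      killed = trans (sym (lineSums-comm {T} eqv-T dU (ap (scaled dU ts) v) x)) (trans (ap-cong T (scaled-killed dU ts v) x) (ap-0 T x))
      -- A single factor Δ makes the sum vanish; the length s ≥ 1 guarantees that there is one.
      sum-scaled : ∀ us ts → length us ≡ s → Sum (ap T (ap (scaled us ts) v)) ≡ 0ℤ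
      sum-scaled (u ∷ us) (t ∷ ts) _ = trans (∑-cong elems (Δ-comm {T} eqv-T _ (ap (scaled us ts) v))) (Sum-Δ t _ (ap T (ap (scaled us ts) v)))
      sum-zero : Sum w ≡ 0ℤ
      sum-zero = sum-scaled dU ts sizeU
      isolate-N : ∀ a b c σ → a + b ≡ c + σ → b ≡ 0ℤ → σ ≡ 0ℤ → a ≡ c
      isolate-N a b c σ q refl refl = trans (sym (+-identityʳ a)) (trans q (+-identityʳ c))

    family-spans : ∀ D L → Stage D L → ∀ v → Σ (Block L → ℤ) λ x → ap N (ap (Δs D) v) ≋ ap N (ap (Δs D) (ap (family L) x))
    family-spans D [] st v = (λ ()) , λ z → ≡⇒≈ (trans (killed v z) (sym (killed (λ _ → 0ℤ) z)))
      where
      killed : ∀ v → ap N (ap (Δs D) v) ≐ 𝟎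
      killed v z = trans (Stage.split st (ap (Δs D) v) z) (trans (+-identityʳ _) (lineSums-Δs D v z))
    family-spans D (d ∷ L) st@record { complement = C ∷ _ ; transversalLU = ts ∷ _ } v with Spanning.reducible C ts v
    ... | w , reduces = [ w ∘ inj₁ , x ] , λ z →
      ≈-trans (≡⇒≈ (trans (ap-cong T reduces z) (trans (ap-+ T r (λ y → ap (Δ d) v₁ y + κ y) z) (cong (_+_ (ap T r z)) (ap-+ T (ap (Δ d) v₁) κ z)))))
      (≈-trans (≈-+ (≈-refl {ap T r z}) (≈-+ (≈-trans (≡⇒≈ (ap-cong N (Δ-comm {Δs D} (eqv-Δs D) d v₁) z))
          (≈-trans (q z) (≡⇒≈ (ap-cong N (λ y → sym (Δ-comm {Δs D} (eqv-Δs D) d (ap (family L) x) y)) z))))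
          (opposite-killed C ts (Δs D) (eqv-Δs D) (w ∘ inj₂ ∘ inj₂) z)))
      (≡⇒≈ (trans (cong (_+_ (ap T r z)) (+-identityʳ _)) (sym (ap-+ T r (ap (Δ d) (ap (family L) x)) z)))))
      where
      T = N ∘L Δs D
      r = ap (row d) (w ∘ inj₁)
      v₁ = w ∘ inj₂ ∘ inj₁
      κ = ap (Reduction.scaled C dU ts) (w ∘ inj₂ ∘ inj₂)
      IH = family-spans (d ∷ D) L (next st) v₁
      x = proj₁ IH
      q = proj₂ IH

    rankBasis : RankBasis (Fin (s ℕ.* s)) N
    rankBasis = RankBasis-reindex {f = N} (subst (λ n → Block dS ↔ Fin (n ℕ.* s)) sizeS (Block↔Fin dS)) record
      { G = family dS
      ; independent = family-independent [] dS start
      ; spanning = family-spans [] dS start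
      }

module PlaneSRG (p : ℕ) (pPrime : Prime p) {G : Set} ⦃ FG : Finite G ⦄ (𝔾 : Abelian G)
                (exponent : Abelian.Exponent 𝔾 p)
                (s′ : ℕ) (p≡ : p ≡ suc (suc s′ ℕ.+ suc s′))
                (enumeration : G ↔ Fin (p ℕ.* p)) where

  open Abelian 𝔾
  open Modulo p pPrime using (π)
  open Translations p pPrime 𝔾 exponent
  open PlaneRank p pPrime 𝔾 exponent using (Complement; module Halves)

  s : ℕ
  s = suc (suc s′)

  2≤s : 2 ℕ.≤ s
  2≤s = ℕ.s≤s (ℕ.s≤s ℕ.z≤n)

  p+1≡2s : suc p ≡ s ℕ.+ s
  p+1≡2s = trans (cong suc p≡) (cong suc (sym (ℕₚ.+-suc (suc s′) (suc s′))))

  open Classification p pPrime s 2≤s p+1≡2s using (SRG; S) public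

  module _ (e : G → G) (dS dU : List G)
           (sizeS : length dS ≡ s) (sizeU : length dU ≡ s)
           (complementS : All (λ d → Complement d (e d)) dS)
           (transversalSS : AllPairs Transversal dS)
           (transversalSU : All (λ d → All (Transversal d) dU) dS)
           (total : ∀ v x → ap (lineSums dS) v x + ap (lineSums dU) v x ≡ π * v x + Sum v)
           (card : Sum {G} (λ _ → 1ℤ) ≡ π * π)
           {d w : G} (t : Transversal d w)
           (a : G → G → ℤ) (adjacency : ∀ v x → ap (lineSums dS) v x ≡ S * v x + Sum (λ y → a x y * v y))
           (a-irreflexive : ∀ x → a x x ≡ 0ℤ)
           {x₁ x₀ : G} (x₁≢0 : 0g ≢ x₁) (x₀≢0 : 0g ≢ x₀) (a-x₁ : a x₁ 0g ≡ 1ℤ) (a-x₀ : a x₀ 0g ≡ 0ℤ) where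

    transversal-sym : ∀ {d w} → Transversal d w → Transversal w d
    transversal-sym {d} {w} t = record
      { generate = λ x → let a , b , q = generate x in b , a , trans q (comm (a ⋆ d) (b ⋆ w))
      ; planeSum = λ v x → trans (segment-comm {lineSum w} (eqv-lineSum w) p d v x) (planeSum v x) }
      where open Transversal t

    open Halves (suc s′) p≡ e dS dU sizeS sizeU complementS transversalSS transversal-sym transversalSU total using (rankBasis)

    N-unit : ∀ x y → ap (lineSums dS) (unit x) y ≡ S * unit x y + a y x
    N-unit x y = trans (adjacency (unit x) y) (cong (_+_ (S * unit x y))
      (trans (∑-cong elems (λ z → *-comm (a y z) (unit x z))) (∑-indicator x (a y))))

    plane-SRG : SRG (lineSums dS)
    plane-SRG = record
      { n = p ℕ.* p
      ; enumeration = enumeration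
      ; order = trans (∑-cong elems (unit-diag {G})) card
      ; trace-N = trans (∑-cong elems {g = λ _ → S * 1ℤ} (λ x → trans (N-unit x x) (trans (cong₂ _+_ (cong (_*_ S) (unit-diag x)) (a-irreflexive x)) (+-identityʳ (S * 1ℤ)))))
                  (trans (∑-* (elems {G}) S (λ _ → 1ℤ)) (cong (_*_ S) card))
      ; σ = ∑L elems
      -- Since x₁ is adjacent to 0 and x₀ is not, this takes the values 0, 1 and 2 on δ, N δ and the
      -- constant 1.
      ; φ = eval x₁ +L eval x₀
      ; δ = unit 0g
      ; square = λ v x → trans (lineSums-square dS transversalSS v x)
                   (cong (λ n → π * ap (lineSums dS) v x + + n * (+ n - 1ℤ) * Sum v) sizeS)
      ; N-1 = λ x → trans (lineSums-1 dS x) (cong (λ n → + n * π) sizeS)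
      ; σ-N = λ v → trans (Sum-lineSums t dS v) (cong (λ n → + n * π * Sum v) sizeS)
      ; σ-1 = card
      ; σ-δ = trans (∑-cong elems (λ y → sym (*-identityʳ (unit 0g y)))) (∑-indicator 0g (λ _ → 1ℤ))
      ; φ-δ = cong₂ _+_ (indicator-no (0g ≟ x₁) x₁≢0) (indicator-no (0g ≟ x₀) x₀≢0)
      ; φ-Nδ = cong₂ _+_ (value x₁≢0 a-x₁) (value x₀≢0 a-x₀)
      ; φ-1 = refl
      ; rankBasis = rankBasis
      }
      where
      value : ∀ {x k} → 0g ≢ x → a x 0g ≡ k → ap (lineSums dS) (unit 0g) x ≡ k
      value {x} {k} 0≢x e = trans (N-unit 0g x) (trans (cong₂ _+_ (trans (cong (_*_ S) (indicator-no (0g ≟ x) 0≢x)) (*-zeroʳ S)) e) (+-identityˡ k))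

-- The field F_q and its parallel classes

module FieldArithmetic (p : ℕ) .⦃ _ : ℕ.NonZero p ⦄ (pPrime : Prime p) where

  open Modulo p pPrime public
  open Rank p pPrime using (≈⇒≡-Fin)

  infixl 6 _⊕ₚ_ _+ₖ_
  infixl 7 _⊛ₚ_ _*ₖ_
  _⊕ₚ_ _⊛ₚ_ : Fp p → Fp p → Fp p
  _⊕ₚ_ = _+p_ p
  _⊛ₚ_ = _*p_ p
  ⊝_ : Fp p → Fp p
  ⊝_ = -p_ p

  _+ₖ_ _*ₖ_ : Fq p → Fq p → Fq p
  _+ₖ_ = _+q_ p
  _*ₖ_ = _*q_ p
  -ₖ_ : Fq p → Fq p
  -ₖ (a , b) = ⊝ a , ⊝ b
  0ₖ 1ₖ : Fq p
  0ₖ = 0q p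
  1ₖ = 1q p

  ⟦_⟧ : Fp p → ℤ
  ⟦ a ⟧ = + toℕ a

  ⟦mod⟧ : ∀ n → ⟦ n mod p ⟧ ≈ + n
  ⟦mod⟧ n = ≈-sym (+ (n / p) with-eq trans (cong +_ (m≡m%n+[m/n]*n n p))
    (trans (pos-+ (n % p) (n / p ℕ.* p)) (cong₂ _+_ (cong +_ (sym (Finₚ.toℕ-fromℕ< (m%n<n n p)))) (trans (pos-* (n / p) p) (*-comm (+ (n / p)) π)))))

  ⟦+⟧ : ∀ {a b x y} → ⟦ a ⟧ ≈ x → ⟦ b ⟧ ≈ y → ⟦ a ⊕ₚ b ⟧ ≈ x + y
  ⟦+⟧ {a} {b} e f = ≈-trans (⟦mod⟧ (toℕ a ℕ.+ toℕ b)) (≈-trans (≡⇒≈ (pos-+ (toℕ a) (toℕ b))) (≈-+ e f))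

  ⟦*⟧ : ∀ {a b x y} → ⟦ a ⟧ ≈ x → ⟦ b ⟧ ≈ y → ⟦ a ⊛ₚ b ⟧ ≈ x * y
  ⟦*⟧ {a} {b} {x} {y} e f = ≈-trans (⟦mod⟧ (toℕ a ℕ.* toℕ b)) (≈-trans (≡⇒≈ (pos-* (toℕ a) (toℕ b)))
    (≈-trans (≈-* ⟦ a ⟧ f) (≈-trans (≡⇒≈ (*-comm ⟦ a ⟧ y)) (≈-trans (≈-* y e) (≡⇒≈ (*-comm y x))))))

  ⟦-⟧ : ∀ {a x} → ⟦ a ⟧ ≈ x → ⟦ ⊝ a ⟧ ≈ - x
  ⟦-⟧ {a} e = ≈-trans (⟦mod⟧ (p ℕ.∸ toℕ a)) (≈-trans (≡⇒≈ (trans (sym (⊖-≥ (ℕₚ.<⇒≤ (Finₚ.toℕ<n a)))) (trans (sym (m-n≡m⊖n p (toℕ a))) (one π ⟦ a ⟧))))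
    (≈-trans (≈-+ (multiple≈0 1ℤ) (≈-neg e)) (≡⇒≈ (+-identityˡ _))))
    where
    one : ∀ π a → π - a ≡ π * 1ℤ + - a
    one = solve-∀

  ⟦0⟧ : ⟦ 0p p ⟧ ≈ 0ℤ
  ⟦0⟧ = ⟦mod⟧ 0

  ⟦1⟧ : ⟦ 1 mod p ⟧ ≈ 1ℤ
  ⟦1⟧ = ⟦mod⟧ 1

  r : ∀ a → ⟦ a ⟧ ≈ ⟦ a ⟧
  r _ = ≈-refl

  same : ∀ {a b x y} → ⟦ a ⟧ ≈ x → ⟦ b ⟧ ≈ y → x ≡ y → a ≡ b
  same e f refl = ≈⇒≡-Fin (≈-trans e (≈-sym f))

  -- Reduction modulo p from ℤ[i], by which the ring laws of F_q are inherited.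
  infixl 6 _+ᵍ_
  infixl 7 _*ᵍ_
  _+ᵍ_ _*ᵍ_ : ℤ × ℤ → ℤ × ℤ → ℤ × ℤ
  (a , b) +ᵍ (c , d) = a + c , b + d
  (a , b) *ᵍ (c , d) = a * c + - (b * d) , a * d + b * c
  -ᵍ_ : ℤ × ℤ → ℤ × ℤ
  -ᵍ (a , b) = - a , - b

  infix 4 _∼_
  record _∼_ (x : Fq p) (z : ℤ × ℤ) : Set where
    constructor _&_
    field
      re : ⟦ proj₁ x ⟧ ≈ proj₁ z
      im : ⟦ proj₂ x ⟧ ≈ proj₂ z

  ⟪_⟫ : Fq p → ℤ × ℤ
  ⟪ a , b ⟫ = ⟦ a ⟧ , ⟦ b ⟧

  ∼-refl : ∀ x → x ∼ ⟪ x ⟫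
  ∼-refl x = ≈-refl & ≈-refl

  ∼-0 : 0ₖ ∼ (0ℤ , 0ℤ)
  ∼-0 = ⟦0⟧ & ⟦0⟧

  ∼-1 : 1ₖ ∼ (1ℤ , 0ℤ)
  ∼-1 = ⟦1⟧ & ⟦0⟧

  ∼-+ : ∀ {x y z w} → x ∼ z → y ∼ w → x +ₖ y ∼ z +ᵍ w
  ∼-+ (a & b) (c & d) = ⟦+⟧ a c & ⟦+⟧ b d

  ∼-* : ∀ {x y z w} → x ∼ z → y ∼ w → x *ₖ y ∼ z *ᵍ w
  ∼-* (a & b) (c & d) = ⟦+⟧ (⟦*⟧ a c) (⟦-⟧ (⟦*⟧ b d)) & ⟦+⟧ (⟦*⟧ a d) (⟦*⟧ b c)

  ∼-neg : ∀ {x z} → x ∼ z → -ₖ x ∼ -ᵍ z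
  ∼-neg (a & b) = ⟦-⟧ a & ⟦-⟧ b

  ∼⇒≡ : ∀ {x y z w} → x ∼ z → y ∼ w → z ≡ w → x ≡ y
  ∼⇒≡ (a & b) (c & d) refl = cong₂ _,_ (same a c refl) (same b d refl)

  private
    module Gaussian where

      +-assocᵍ : ∀ z w u → z +ᵍ w +ᵍ u ≡ z +ᵍ (w +ᵍ u)
      +-assocᵍ (a , b) (c , d) (e , f) = cong₂ _,_ (+-assoc a c e) (+-assoc b d f)

      +-commᵍ : ∀ z w → z +ᵍ w ≡ w +ᵍ z
      +-commᵍ (a , b) (c , d) = cong₂ _,_ (+-comm a c) (+-comm b d)

      *-commᵍ : ∀ z w → z *ᵍ w ≡ w *ᵍ z
      *-commᵍ (a , b) (c , d) = cong₂ _,_ (real a b c d) (imaginary a b c d)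
        where
        real : ∀ a b c d → a * c + - (b * d) ≡ c * a + - (d * b)
        real = solve-∀
        imaginary : ∀ a b c d → a * d + b * c ≡ c * b + d * a
        imaginary = solve-∀

      *-assocᵍ : ∀ z w u → z *ᵍ w *ᵍ u ≡ z *ᵍ (w *ᵍ u)
      *-assocᵍ (a , b) (c , d) (e , f) = cong₂ _,_ (real a b c d e f) (imaginary a b c d e f)
        where
        real : ∀ a b c d e f → (a * c + - (b * d)) * e + - ((a * d + b * c) * f) ≡ a * (c * e + - (d * f)) + - (b * (c * f + d * e))
        real = solve-∀
        imaginary : ∀ a b c d e f → (a * c + - (b * d)) * f + (a * d + b * c) * e ≡ a * (c * f + d * e) + b * (c * e + - (d * f))
        imaginary = solve-∀

      *-identityˡᵍ : ∀ z → (1ℤ , 0ℤ) *ᵍ z ≡ z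
      *-identityˡᵍ (a , b) = cong₂ _,_ (real a b) (imaginary a b)
        where
        real : ∀ a b → 1ℤ * a + - (0ℤ * b) ≡ a
        real = solve-∀
        imaginary : ∀ a b → 1ℤ * b + 0ℤ * a ≡ b
        imaginary = solve-∀

      *-zeroˡᵍ : ∀ z → (0ℤ , 0ℤ) *ᵍ z ≡ (0ℤ , 0ℤ)
      *-zeroˡᵍ (a , b) = cong₂ _,_ (real a b) (imaginary a b)
        where
        real : ∀ a b → 0ℤ * a + - (0ℤ * b) ≡ 0ℤ
        real = solve-∀
        imaginary : ∀ a b → 0ℤ * b + 0ℤ * a ≡ 0ℤ
        imaginary = solve-∀

      *-distribʳᵍ : ∀ z w u → (w +ᵍ u) *ᵍ z ≡ w *ᵍ z +ᵍ u *ᵍ z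
      *-distribʳᵍ (a , b) (c , d) (e , f) = cong₂ _,_ (real a b c d e f) (imaginary a b c d e f)
        where
        real : ∀ a b c d e f → (c + e) * a + - ((d + f) * b) ≡ c * a + - (d * b) + (e * a + - (f * b))
        real = solve-∀
        imaginary : ∀ a b c d e f → (c + e) * b + (d + f) * a ≡ c * b + d * a + (e * b + f * a)
        imaginary = solve-∀

      neg-*ᵍ : ∀ z w → (-ᵍ z) *ᵍ w ≡ -ᵍ (z *ᵍ w)
      neg-*ᵍ (a , b) (c , d) = cong₂ _,_ (real a b c d) (imaginary a b c d)
        where
        real : ∀ a b c d → - a * c + - (- b * d) ≡ - (a * c + - (b * d))
        real = solve-∀
        imaginary : ∀ a b c d → - a * d + - b * c ≡ - (a * d + b * c)
        imaginary = solve-∀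

    open Gaussian

    v = ∼-refl

  +ₖ-assoc : ∀ x y z → (x +ₖ y) +ₖ z ≡ x +ₖ (y +ₖ z)
  +ₖ-assoc x y z = ∼⇒≡ (∼-+ (∼-+ (v x) (v y)) (v z)) (∼-+ (v x) (∼-+ (v y) (v z))) (+-assocᵍ ⟪ x ⟫ ⟪ y ⟫ ⟪ z ⟫)

  +ₖ-comm : ∀ x y → x +ₖ y ≡ y +ₖ x
  +ₖ-comm x y = ∼⇒≡ (∼-+ (v x) (v y)) (∼-+ (v y) (v x)) (+-commᵍ ⟪ x ⟫ ⟪ y ⟫)

  +ₖ-identityʳ : ∀ x → x +ₖ 0ₖ ≡ x
  +ₖ-identityʳ x = ∼⇒≡ (∼-+ (v x) ∼-0) (v x) (cong₂ _,_ (+-identityʳ ⟦ proj₁ x ⟧) (+-identityʳ ⟦ proj₂ x ⟧))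

  +ₖ-inverseʳ : ∀ x → x +ₖ (-ₖ x) ≡ 0ₖ
  +ₖ-inverseʳ x = ∼⇒≡ (∼-+ (v x) (∼-neg (v x))) ∼-0 (cong₂ _,_ (+-inverseʳ ⟦ proj₁ x ⟧) (+-inverseʳ ⟦ proj₂ x ⟧))

  𝔽 : Abelian (Fq p)
  𝔽 = record { _⊹_ = _+ₖ_ ; 0g = 0ₖ ; ⊖_ = -ₖ_ ; assoc = +ₖ-assoc ; comm = +ₖ-comm ; identityʳ = +ₖ-identityʳ ; inverseʳ = +ₖ-inverseʳ }

  open Abelian 𝔽 public using (_⋆_; cancelʳ; inverseˡ; identityˡ)

  *ₖ-comm : ∀ x y → x *ₖ y ≡ y *ₖ x
  *ₖ-comm x y = ∼⇒≡ (∼-* (v x) (v y)) (∼-* (v y) (v x)) (*-commᵍ ⟪ x ⟫ ⟪ y ⟫)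

  *ₖ-assoc : ∀ x y z → (x *ₖ y) *ₖ z ≡ x *ₖ (y *ₖ z)
  *ₖ-assoc x y z = ∼⇒≡ (∼-* (∼-* (v x) (v y)) (v z)) (∼-* (v x) (∼-* (v y) (v z))) (*-assocᵍ ⟪ x ⟫ ⟪ y ⟫ ⟪ z ⟫)

  *ₖ-identityˡ : ∀ x → 1ₖ *ₖ x ≡ x
  *ₖ-identityˡ x = ∼⇒≡ (∼-* ∼-1 (v x)) (v x) (*-identityˡᵍ ⟪ x ⟫)

  *ₖ-zeroˡ : ∀ x → 0ₖ *ₖ x ≡ 0ₖ
  *ₖ-zeroˡ x = ∼⇒≡ (∼-* ∼-0 (v x)) ∼-0 (*-zeroˡᵍ ⟪ x ⟫)

  *ₖ-distribʳ : ∀ x y z → (y +ₖ z) *ₖ x ≡ y *ₖ x +ₖ z *ₖ x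
  *ₖ-distribʳ x y z = ∼⇒≡ (∼-* (∼-+ (v y) (v z)) (v x)) (∼-+ (∼-* (v y) (v x)) (∼-* (v z) (v x))) (*-distribʳᵍ ⟪ x ⟫ ⟪ y ⟫ ⟪ z ⟫)

  -ₖ-* : ∀ x y → (-ₖ x) *ₖ y ≡ -ₖ (x *ₖ y)
  -ₖ-* x y = ∼⇒≡ (∼-* (∼-neg (v x)) (v y)) (∼-neg (∼-* (v x) (v y))) (neg-*ᵍ ⟪ x ⟫ ⟪ y ⟫)

  -- The copy of F_p inside F_q.
  Scalar : Fq p → Set
  Scalar x = proj₂ x ≡ 0p p

  scalar-* : ∀ {x y} → Scalar x → Scalar y → Scalar (x *ₖ y)
  scalar-* {a , _} {c , _} refl refl = same (⟦+⟧ (⟦*⟧ (r a) ⟦0⟧) (⟦*⟧ ⟦0⟧ (r c))) ⟦0⟧ (vanish ⟦ a ⟧ ⟦ c ⟧)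
    where
    vanish : ∀ a c → a * 0ℤ + 0ℤ * c ≡ 0ℤ
    vanish = solve-∀

  ⋆≈ : ∀ n x → (⟦ proj₁ (n ⋆ x) ⟧ ≈ + n * ⟦ proj₁ x ⟧) × (⟦ proj₂ (n ⋆ x) ⟧ ≈ + n * ⟦ proj₂ x ⟧)
  ⋆≈ zero x = ⟦0⟧ , ⟦0⟧
  ⋆≈ (suc n) x = let e , f = ⋆≈ n x in
    ≈-trans (⟦+⟧ (r (proj₁ x)) e) (≡⇒≈ (next ⟦ proj₁ x ⟧)) , ≈-trans (⟦+⟧ (r (proj₂ x)) f) (≡⇒≈ (next ⟦ proj₂ x ⟧))
    where
    next : ∀ a → a + + n * a ≡ + suc n * a
    next = λ a → sym (suc-* (+ n) a)

  exponent : ∀ x → p ⋆ x ≡ 0ₖ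
  exponent x = cong₂ _,_ (kill (proj₁ (⋆≈ p x))) (kill (proj₂ (⋆≈ p x)))
    where
    kill : ∀ {a c} → ⟦ a ⟧ ≈ π * c → a ≡ 0p p
    kill {c = c} e = same (≈-trans e (multiple≈0 c)) ⟦0⟧ refl

  ⋆-* : ∀ n x → n ⋆ x ≡ (n mod p , 0p p) *ₖ x
  ⋆-* n x = cong₂ _,_
    (same (proj₁ (⋆≈ n x)) (⟦+⟧ (⟦*⟧ (⟦mod⟧ n) (r (proj₁ x))) (⟦-⟧ (⟦*⟧ ⟦0⟧ (r (proj₂ x))))) (real (+ n) ⟦ proj₁ x ⟧ ⟦ proj₂ x ⟧))
    (same (proj₂ (⋆≈ n x)) (⟦+⟧ (⟦*⟧ (⟦mod⟧ n) (r (proj₂ x))) (⟦*⟧ ⟦0⟧ (r (proj₁ x)))) (imaginary (+ n) ⟦ proj₁ x ⟧ ⟦ proj₂ x ⟧))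
    where
    real : ∀ n a b → n * a ≡ n * a + - (0ℤ * b)
    real = solve-∀
    imaginary : ∀ n a b → n * b ≡ n * b + 0ℤ * a
    imaginary = solve-∀

-- Bijections of finite sets and sums over exponents.

injective⇒surjective : ∀ {n} (f : Fin n → Fin n) → (∀ {x y} → f x ≡ f y → x ≡ y) → ∀ y → Σ (Fin n) λ x → f x ≡ y
injective⇒surjective {suc n} f inj y with Finₚ.any? (λ x → f x Fin.≟ y)
... | yes found = found
... | no missed = contradiction (Finₚ.injective⇒≤ {f = g} g-injective) ℕₚ.1+n≰n
  where
  y≢ : ∀ x → y ≢ f x
  y≢ x q = missed (x , sym q)
  g : Fin (suc n) → Fin n
  g x = Fin.punchOut (y≢ x)
  g-injective : ∀ {x x′} → g x ≡ g x′ → x ≡ x′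
  g-injective {x} {x′} q = inj (Finₚ.punchOut-injective (y≢ x) (y≢ x′) q)

injective⇒↔ : ∀ {n} → I ↔ Fin n → J ↔ Fin n → (f : I → J) → (∀ {x y} → f x ≡ f y → x ≡ y) → I ↔ J
injective⇒↔ {I = I} {J = J} {n = n} h k f inj = mk↔ₛ′ f g f-g (λ x → inj (f-g (f x)))
  where
  module h = Inverse h
  module k = Inverse k
  φ : Fin n → Fin n
  φ i = k.to (f (h.from i))
  φ-injective : ∀ {i j} → φ i ≡ φ j → i ≡ j
  φ-injective {i} {j} q = trans (sym (h.strictlyInverseˡ i)) (trans (cong h.to (inj
    (trans (sym (k.strictlyInverseʳ _)) (trans (cong k.from q) (k.strictlyInverseʳ _))))) (h.strictlyInverseˡ j))
  preimage : ∀ y → Σ (Fin n) λ i → φ i ≡ k.to y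
  preimage y = injective⇒surjective φ φ-injective (k.to y)
  g : J → I
  g y = h.from (proj₁ (preimage y))
  f-g : ∀ y → f (g y) ≡ y
  f-g y = trans (sym (k.strictlyInverseʳ _)) (trans (cong k.from (proj₂ (preimage y))) (k.strictlyInverseʳ y))

Sum-reindex : ⦃ FI : Finite I ⦄ ⦃ FJ : Finite J ⦄ (h : I ↔ J) (f : J → ℤ) → Sum f ≡ Sum (f ∘ Inverse.to h)
Sum-reindex {I = I} {J = J} h f = sym (trans
  (∑-cong (elems {I}) (λ x → sym (∑-indicator (h.to x) f)))
  (trans (∑-swap (elems {I}) (elems {J}) (λ x y → unit (h.to x) y * f y))
  (∑-cong (elems {J}) (λ y → trans (∑-cong (elems {I}) (λ x → trans (*-comm (unit (h.to x) y) (f y)) (cong (_*_ (f y)) (transfer x y))))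
    (trans (∑-* (elems {I}) (f y) (unit (h.from y))) (trans (cong (_*_ (f y)) (total y)) (*-identityʳ (f y))))))))
  where
  module h = Inverse h
  transfer : ∀ x y → unit (h.to x) y ≡ unit (h.from y) x
  transfer x y = indicator-map (h.to x ≟ y) (h.from y ≟ x)
    (λ q → trans (cong h.from (sym q)) (h.strictlyInverseʳ x)) (λ q → trans (cong h.to (sym q)) (h.strictlyInverseˡ y))
  total : ∀ y → Sum (unit (h.from y)) ≡ 1ℤ
  total y = trans (∑-cong (elems {I}) (λ x → sym (*-identityʳ (unit (h.from y) x)))) (∑-indicator (h.from y) (λ _ → 1ℤ))

∑< : ℕ → (ℕ → ℤ) → ℤ
∑< zero f = 0ℤ
∑< (suc n) f = ∑< n f + f n

∑<-cong : ∀ n {f g : ℕ → ℤ} → (∀ i → f i ≡ g i) → ∑< n f ≡ ∑< n g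
∑<-cong zero e = refl
∑<-cong (suc n) e = cong₂ _+_ (∑<-cong n e) (e n)

∑<-+ : ∀ n (f g : ℕ → ℤ) → ∑< n (λ i → f i + g i) ≡ ∑< n f + ∑< n g
∑<-+ zero f g = refl
∑<-+ (suc n) f g = trans (cong (_+ (f n + g n)) (∑<-+ n f g)) (+-interchange (∑< n f) (∑< n g) (f n) (g n))

∑<-* : ∀ n k (f : ℕ → ℤ) → ∑< n (λ i → k * f i) ≡ k * ∑< n f
∑<-* zero k f = sym (*-zeroʳ k)
∑<-* (suc n) k f = trans (cong (_+ k * f n) (∑<-* n k f)) (sym (*-distribˡ-+ k (∑< n f) (f n)))

∑<-const : ∀ n k → ∑< n (λ _ → k) ≡ + n * k
∑<-const zero k = sym (*-zeroˡ k)
∑<-const (suc n) k = trans (cong (_+ k) (∑<-const n k)) (suc-*ʳ (+ n) k)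

∑<-suc : ∀ n (f : ℕ → ℤ) → ∑< (suc n) f ≡ f 0 + ∑< n (f ∘ suc)
∑<-suc zero f = +-comm 0ℤ (f 0)
∑<-suc (suc n) f = trans (cong (_+ f (suc n)) (∑<-suc n f)) (+-assoc (f 0) (∑< n (f ∘ suc)) (f (suc n)))

∑<-Fin : ∀ n (f : ℕ → ℤ) → ∑< n f ≡ Sum {Fin n} (f ∘ toℕ)
∑<-Fin zero f = refl
∑<-Fin (suc n) f = trans (∑<-suc n f) (trans (cong (_+_ (f 0)) (∑<-Fin n (f ∘ suc))) (sym (∑-Fin-suc {n} (f ∘ toℕ))))

∑<-++ : ∀ n k (f : ℕ → ℤ) → ∑< (n ℕ.+ k) f ≡ ∑< n f + ∑< k (λ i → f (n ℕ.+ i))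
∑<-++ n zero f = trans (cong (λ n → ∑< n f) (ℕₚ.+-identityʳ n)) (sym (+-identityʳ (∑< n f)))
∑<-++ n (suc k) f = trans (cong (λ n → ∑< n f) (ℕₚ.+-suc n k)) (trans (cong (_+ f (n ℕ.+ k)) (∑<-++ n k f)) (+-assoc (∑< n f) (∑< k (λ i → f (n ℕ.+ i))) (f (n ℕ.+ k))))

-- Writing exponents as j m + i groups the powers of β by parallel class i.
∑<-product : ∀ h m (f : ℕ → ℤ) → ∑< (h ℕ.* m) f ≡ ∑< m (λ i → ∑< h (λ j → f (j ℕ.* m ℕ.+ i)))
∑<-product zero m f = sym (trans (∑<-const m 0ℤ) (*-zeroʳ (+ m)))
∑<-product (suc h) m f = trans (cong (λ n → ∑< n f) (ℕₚ.+-comm m (h ℕ.* m))) (trans (∑<-++ (h ℕ.* m) m f)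
  (trans (cong (_+ ∑< m (λ i → f (h ℕ.* m ℕ.+ i))) (∑<-product h m f)) (sym (∑<-+ m (λ i → ∑< h (λ j → f (j ℕ.* m ℕ.+ i))) (λ i → f (h ℕ.* m ℕ.+ i))))))

module Least {P : ℕ → Set} (P? : ∀ n → Dec (P n)) where

  below : ∀ n → (Σ ℕ λ m → m ℕ.< n × P m × (∀ j → j ℕ.< m → ¬ P j)) ⊎ (∀ j → j ℕ.< n → ¬ P j)
  below zero = inj₂ (λ _ ())
  below (suc n) with below n
  ... | inj₁ (m , m<n , Pm , min) = inj₁ (m , ℕₚ.m<n⇒m<1+n m<n , Pm , min)
  ... | inj₂ none with P? n
  ...   | yes Pn = inj₁ (n , ℕₚ.n<1+n n , Pn , none)
  ...   | no ¬Pn = inj₂ (λ j j<1+n → [ none j , (λ { refl → ¬Pn }) ]′ (ℕₚ.m<1+n⇒m<n∨m≡n j<1+n))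

  least : ∀ n → P n → Σ ℕ λ m → P m × (∀ j → j ℕ.< m → ¬ P j)
  least n Pn with below (suc n)
  ... | inj₁ (m , _ , Pm , min) = m , Pm , min
  ... | inj₂ none = contradiction Pn (none n (ℕₚ.n<1+n n))

-- Discrete logarithms with respect to β.

module Powers (p : ℕ) .⦃ _ : ℕ.NonZero p ⦄ (pPrime : Prime p) (2<p : 2 ℕ.< p) (β : Fq p) (generates : IsPrimitive p β) where

  open FieldArithmetic p pPrime public
  open Rank p pPrime using (≈⇒≡-Fin; ≈⇒≡-below)

  pw : ℕ → Fq p
  pw = _^q_ p β

  small≉0 : ∀ {n} → n ≢ 0 → n ℕ.< p → ¬ + n ≈ 0ℤ
  small≉0 n≢0 n<p e = n≢0 (≈⇒≡-below n<p e ℕ.z≤n)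

  1<p : 1 ℕ.< p
  1<p = ℕₚ.<-trans (ℕₚ.n<1+n 1) 2<p

  1ₖ≢0ₖ : 1ₖ ≢ 0ₖ
  1ₖ≢0ₖ q = small≉0 (λ ()) 1<p (≈-trans (≈-sym ⟦1⟧) (≈-trans (≡⇒≈ (cong (⟦_⟧ ∘ proj₁) q)) ⟦0⟧))

  *ₖ-identityʳ : ∀ x → x *ₖ 1ₖ ≡ x
  *ₖ-identityʳ x = trans (*ₖ-comm x 1ₖ) (*ₖ-identityˡ x)

  pw-+ : ∀ a b → pw (a ℕ.+ b) ≡ pw a *ₖ pw b
  pw-+ zero b = sym (*ₖ-identityˡ (pw b))
  pw-+ (suc a) b = trans (cong (β *ₖ_) (pw-+ a b)) (sym (*ₖ-assoc β (pw a) (pw b)))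

  minusOne : Fq p
  minusOne = -ₖ 1ₖ

  minusOne² : minusOne *ₖ minusOne ≡ 1ₖ
  minusOne² = trans (-ₖ-* 1ₖ minusOne) (trans (cong -ₖ_ (*ₖ-identityˡ minusOne))
    (cong₂ _,_ (same (⟦-⟧ (⟦-⟧ ⟦1⟧)) ⟦1⟧ refl) (same (⟦-⟧ (⟦-⟧ ⟦0⟧)) ⟦0⟧ refl)))

  minusOne≢0ₖ : minusOne ≢ 0ₖ
  minusOne≢0ₖ q = 1ₖ≢0ₖ (trans (sym minusOne²) (trans (cong (_*ₖ minusOne) q) (*ₖ-zeroˡ minusOne)))

  minusOne≢1ₖ : minusOne ≢ 1ₖ
  minusOne≢1ₖ q = small≉0 {2} (λ ()) 2<p (≈-trans (≈-+ (≈-refl {1ℤ}) (≈-sym (≈-trans (≈-sym (⟦-⟧ ⟦1⟧)) (≈-trans (≡⇒≈ (cong (⟦_⟧ ∘ proj₁) q)) ⟦1⟧)))) ≈-refl)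

  minusOne-log : ∃ λ k → pw k ≡ minusOne
  minusOne-log = proj₂ generates minusOne minusOne≢0ₖ

  private
    Unity : ℕ → Set
    Unity n = pw (suc n) ≡ 1ₖ

    -- Primitivity alone might represent 1 by the exponent 0. Squaring a power equal to -1 gives a
    -- positive exponent, because -1 ≠ 1 makes the exponent of -1 nonzero.
    unity : ∀ k → pw k ≡ minusOne → Σ ℕ Unity
    unity zero q = contradiction (sym q) minusOne≢1ₖ
    unity (suc k) q = k ℕ.+ suc k , trans (pw-+ (suc k) (suc k)) (trans (cong₂ _*ₖ_ q q) minusOne²)

    leastUnity : Σ ℕ λ n → Unity n × (∀ j → j ℕ.< n → ¬ Unity j)
    leastUnity = let n , q = unity (proj₁ minusOne-log) (proj₂ minusOne-log) in
      Least.least {Unity} (λ n → pw (suc n) ≟ 1ₖ) n q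

  abstract
    n₁ : ℕ
    n₁ = proj₁ leastUnity

  n₀ : ℕ
  n₀ = suc n₁

  abstract
    pw-n₀ : pw n₀ ≡ 1ₖ
    pw-n₀ = proj₁ (proj₂ leastUnity)

    minimal : ∀ j → j ℕ.< n₁ → pw (suc j) ≢ 1ₖ
    minimal = proj₂ (proj₂ leastUnity)

  pw-multiple : ∀ c → pw (c ℕ.* n₀) ≡ 1ₖ
  pw-multiple zero = refl
  pw-multiple (suc c) = trans (pw-+ n₀ (c ℕ.* n₀)) (trans (cong₂ _*ₖ_ pw-n₀ (pw-multiple c)) (*ₖ-identityˡ 1ₖ))

  pw-% : ∀ k → pw k ≡ pw (k % n₀)
  pw-% k = trans (cong pw (m≡m%n+[m/n]*n k n₀)) (trans (pw-+ (k % n₀) (k / n₀ ℕ.* n₀))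
    (trans (cong (pw (k % n₀) *ₖ_) (pw-multiple (k / n₀))) (*ₖ-identityʳ (pw (k % n₀)))))

  pw-inverse : ∀ k → pw k *ₖ pw (k ℕ.* n₁) ≡ 1ₖ
  pw-inverse k = trans (sym (pw-+ k (k ℕ.* n₁))) (trans (cong pw (sym (ℕₚ.*-suc k n₁))) (pw-multiple k))

  pw-cancel : ∀ k {x y} → pw k *ₖ x ≡ pw k *ₖ y → x ≡ y
  pw-cancel k {x} {y} q = trans (sym (undo x)) (trans (cong (pw (k ℕ.* n₁) *ₖ_) q) (undo y))
    where
    undo : ∀ x → pw (k ℕ.* n₁) *ₖ (pw k *ₖ x) ≡ x
    undo x = trans (sym (*ₖ-assoc (pw (k ℕ.* n₁)) (pw k) x)) (trans (cong (_*ₖ x) (trans (*ₖ-comm (pw (k ℕ.* n₁)) (pw k)) (pw-inverse k))) (*ₖ-identityˡ x))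

  pw≢0 : ∀ k → pw k ≢ 0ₖ
  pw≢0 k q = 1ₖ≢0ₖ (trans (sym (pw-inverse k)) (trans (cong (_*ₖ pw (k ℕ.* n₁)) q) (*ₖ-zeroˡ (pw (k ℕ.* n₁)))))

  private
    pw-injective-≤ : ∀ {i j} → i ℕ.≤ j → j ℕ.< n₀ → pw i ≡ pw j → i ≡ j
    pw-injective-≤ {i} {j} i≤j j<n₀ q with j ℕ.∸ i in d
    ... | zero = ℕₚ.≤-antisym i≤j (ℕₚ.m∸n≡0⇒m≤n d)
    ... | suc t = contradiction (pw-cancel i (trans (sym (pw-+ i (suc t)))
            (trans (cong pw (trans (cong (i ℕ.+_) (sym d)) (ℕₚ.m+[n∸m]≡n i≤j))) (trans (sym q) (sym (*ₖ-identityʳ (pw i)))))))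
            (minimal t (ℕ.s≤s⁻¹ (ℕₚ.≤-<-trans (subst (ℕ._≤ j) d (ℕₚ.m∸n≤m j i)) j<n₀)))

  pw-injective : ∀ {i j} → i ℕ.< n₀ → j ℕ.< n₀ → pw i ≡ pw j → i ≡ j
  pw-injective {i} {j} i<n₀ j<n₀ q with ℕₚ.≤-total i j
  ... | inj₁ i≤j = pw-injective-≤ i≤j j<n₀ q
  ... | inj₂ j≤i = sym (pw-injective-≤ j≤i i<n₀ (sym q))

  pw-≡⇒% : ∀ i j → pw i ≡ pw j → i % n₀ ≡ j % n₀
  pw-≡⇒% i j q = pw-injective (m%n<n i n₀) (m%n<n j n₀) (trans (sym (pw-% i)) (trans q (pw-% j)))

  log : ∀ x → x ≢ 0ₖ → Σ ℕ λ k → k ℕ.< n₀ × pw k ≡ x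
  log x x≢0 = let k , q = proj₂ generates x x≢0 in k % n₀ , m%n<n k n₀ , trans (sym (pw-% k)) q

  zero∪powers : Fin (suc n₀) ↔ Fq p
  zero∪powers = mk↔ₛ′ value index value-index (λ i → value-injective (value-index (value i)))
    where
    value : Fin (suc n₀) → Fq p
    value zero = 0ₖ
    value (suc i) = pw (toℕ i)
    value-injective : ∀ {i j} → value i ≡ value j → i ≡ j
    value-injective {zero} {zero} q = refl
    value-injective {zero} {suc j} q = contradiction (sym q) (pw≢0 (toℕ j))
    value-injective {suc i} {zero} q = contradiction q (pw≢0 (toℕ i))
    value-injective {suc i} {suc j} q = cong suc (Finₚ.toℕ-injective (pw-injective (Finₚ.toℕ<n i) (Finₚ.toℕ<n j) q))
    indexDec : ∀ x → Dec (x ≡ 0ₖ) → Fin (suc n₀)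
    indexDec x (yes _) = zero
    indexDec x (no x≢0) = suc (fromℕ< (proj₁ (proj₂ (log x x≢0))))
    index : Fq p → Fin (suc n₀)
    index x = indexDec x (x ≟ 0ₖ)
    value-indexDec : ∀ x d → value (indexDec x d) ≡ x
    value-indexDec x (yes x≡0) = sym x≡0
    value-indexDec x (no x≢0) = trans (cong pw (Finₚ.toℕ-fromℕ< (proj₁ (proj₂ (log x x≢0))))) (proj₂ (proj₂ (log x x≢0)))
    value-index : ∀ x → value (index x) ≡ x
    value-index x = value-indexDec x (x ≟ 0ₖ)

  Fq↔Fin : Fq p ↔ Fin (p ℕ.* p)
  Fq↔Fin = ↔ₚ.↔-sym Finₚ.*↔×

  order : suc n₀ ≡ p ℕ.* p
  order = ↔⇒≡ (↔ₚ.↔-trans zero∪powers Fq↔Fin)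

module Directions (p : ℕ) .⦃ _ : ℕ.NonZero p ⦄ (pPrime : Prime p) (2<p : 2 ℕ.< p) (β : Fq p) (generates : IsPrimitive p β) where

  open Powers p pPrime 2<p β generates public
  open Rank p pPrime using (≈⇒≡-Fin; ≈⇒≡-below)
  open Translations p pPrime 𝔽 exponent public
  open PlaneRank p pPrime 𝔽 exponent using (Complement)

  private
    ScalarPower : ℕ → Set
    ScalarPower n = Scalar (pw (suc n))

    leastScalar : Σ ℕ λ n → ScalarPower n × (∀ j → j ℕ.< n → ¬ ScalarPower j)
    leastScalar = Least.least {ScalarPower} (λ n → proj₂ (pw (suc n)) Fin.≟ 0p p) n₁ (cong proj₂ pw-n₀)

  abstract
    m₁ : ℕ
    m₁ = proj₁ leastScalar

  m : ℕ
  m = suc m₁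

  abstract
    scalar-m : Scalar (pw m)
    scalar-m = proj₁ (proj₂ leastScalar)

    scalar-minimal : ∀ j → j ℕ.< m₁ → ¬ Scalar (pw (suc j))
    scalar-minimal = proj₂ (proj₂ leastScalar)

  scalar-multiple : ∀ c → Scalar (pw (c ℕ.* m))
  scalar-multiple zero = refl
  scalar-multiple (suc c) = trans (cong proj₂ (pw-+ m (c ℕ.* m))) (scalar-* {pw m} {pw (c ℕ.* m)} scalar-m (scalar-multiple c))

  -- With c the largest multiple of m up to k, the power of β to the remainder is the product of β^k
  -- and the inverse of β^c. Both are scalars, so minimality of m makes the remainder 0.
  scalar⇒%≡0 : ∀ k → Scalar (pw k) → k % m ≡ 0
  scalar⇒%≡0 k sc = vanish (k % m) (m%n<n k m) (trans (cong proj₂ remainder) (scalar-* {pw k} {pw (c ℕ.* n₁)} sc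
                      (trans (cong (proj₂ ∘ pw) reorder) (scalar-multiple (k / m ℕ.* n₁)))))
    where
    c = k / m ℕ.* m
    reorder : c ℕ.* n₁ ≡ k / m ℕ.* n₁ ℕ.* m
    reorder = trans (ℕₚ.*-assoc (k / m) m n₁) (trans (cong (k / m ℕ.*_) (ℕₚ.*-comm m n₁)) (sym (ℕₚ.*-assoc (k / m) n₁ m)))
    remainder : pw (k % m) ≡ pw k *ₖ pw (c ℕ.* n₁)
    remainder = sym (trans (cong (_*ₖ pw (c ℕ.* n₁)) (trans (cong pw (m≡m%n+[m/n]*n k m)) (pw-+ (k % m) c)))
      (trans (*ₖ-assoc (pw (k % m)) (pw c) (pw (c ℕ.* n₁))) (trans (cong (pw (k % m) *ₖ_) (pw-inverse c)) (*ₖ-identityʳ (pw (k % m))))))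
    vanish : ∀ r → r ℕ.< m → Scalar (pw r) → r ≡ 0
    vanish zero _ _ = refl
    vanish (suc r) r<m scr = contradiction scr (scalar-minimal r (ℕ.s≤s⁻¹ r<m))

  h : ℕ
  h = n₀ / m

  quotient : ∀ k → k % m ≡ 0 → k ≡ k / m ℕ.* m
  quotient k e = trans (m≡m%n+[m/n]*n k m) (cong (ℕ._+ k / m ℕ.* m) e)

  n₀≡hm : n₀ ≡ h ℕ.* m
  n₀≡hm = quotient n₀ (scalar⇒%≡0 n₀ (cong proj₂ pw-n₀))

  zero∪scalars : Fin (suc h) ↔ Fp p
  zero∪scalars = mk↔ₛ′ value index value-index (λ i → value-injective (value-index (value i)))
    where
    value : Fin (suc h) → Fp p
    value zero = 0p p
    value (suc j) = proj₁ (pw (toℕ j ℕ.* m))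
    embedding : ∀ j → pw (j ℕ.* m) ≡ (proj₁ (pw (j ℕ.* m)) , 0p p)
    embedding j = cong (proj₁ (pw (j ℕ.* m)) ,_) (scalar-multiple j)
    bound : ∀ (j : Fin h) → toℕ j ℕ.* m ℕ.< n₀
    bound j = subst (toℕ j ℕ.* m ℕ.<_) (sym n₀≡hm) (ℕₚ.*-monoˡ-< m (Finₚ.toℕ<n j))
    value-injective : ∀ {i j} → value i ≡ value j → i ≡ j
    value-injective {zero} {zero} q = refl
    value-injective {zero} {suc j} q = contradiction (trans (embedding (toℕ j)) (cong (_, 0p p) (sym q))) (pw≢0 (toℕ j ℕ.* m))
    value-injective {suc i} {zero} q = contradiction (trans (embedding (toℕ i)) (cong (_, 0p p) q)) (pw≢0 (toℕ i ℕ.* m))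
    value-injective {suc i} {suc j} q = cong suc (Finₚ.toℕ-injective (ℕₚ.*-cancelʳ-≡ (toℕ i) (toℕ j) m
      (pw-injective (bound i) (bound j) (trans (embedding (toℕ i)) (trans (cong (_, 0p p) q) (sym (embedding (toℕ j))))))))
    module Index (a : Fp p) (a≢0 : a ≢ 0p p) where
      logarithm = log (a , 0p p) (λ q → a≢0 (cong proj₁ q))
      k = proj₁ logarithm
      multiple : k ≡ k / m ℕ.* m
      multiple = quotient k (scalar⇒%≡0 k (cong proj₂ (proj₂ (proj₂ logarithm))))
      small : k / m ℕ.< h
      small = m<n*o⇒m/o<n {k} {h} {m} (subst (k ℕ.<_) n₀≡hm (proj₁ (proj₂ logarithm)))
      correct : proj₁ (pw (toℕ (fromℕ< small) ℕ.* m)) ≡ a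
      correct = trans (cong (λ j → proj₁ (pw (j ℕ.* m))) (Finₚ.toℕ-fromℕ< small))
                (trans (cong (proj₁ ∘ pw) (sym multiple)) (cong proj₁ (proj₂ (proj₂ logarithm))))
    indexDec : ∀ a → Dec (a ≡ 0p p) → Fin (suc h)
    indexDec a (yes _) = zero
    indexDec a (no a≢0) = suc (fromℕ< (Index.small a a≢0))
    index : Fp p → Fin (suc h)
    index a = indexDec a (a Fin.≟ 0p p)
    value-indexDec : ∀ a d → value (indexDec a d) ≡ a
    value-indexDec a (yes a≡0) = sym a≡0
    value-indexDec a (no a≢0) = Index.correct a a≢0
    value-index : ∀ a → value (index a) ≡ a
    value-index a = value-indexDec a (a Fin.≟ 0p p)

  1+h≡p : suc h ≡ p
  1+h≡p = ↔⇒≡ zero∪scalars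

  -- Counting F_q and F_p gives h m = p² - 1 and h = p - 1; cancel h.
  m≡1+p : m ≡ suc p
  m≡1+p = ℕₚ.*-cancelˡ-≡ m (suc p) h ⦃ ℕ.≢-nonZero h≢0 ⦄ (ℕₚ.suc-injective (begin
    suc (h ℕ.* m)      ≡⟨ cong suc (sym n₀≡hm) ⟩
    suc n₀             ≡⟨ order ⟩
    p ℕ.* p            ≡⟨ cong (λ p → p ℕ.* p) (sym 1+h≡p) ⟩
    suc h ℕ.* suc h    ≡⟨ expandSquare ⟩
    suc (h ℕ.* suc (suc h)) ≡⟨ cong (λ p → suc (h ℕ.* suc p)) 1+h≡p ⟩
    suc (h ℕ.* suc p)  ∎))
    where
    open ≡-Reasoning
    expandSquare : suc h ℕ.* suc h ≡ suc (h ℕ.* suc (suc h))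
    expandSquare = cong suc (trans (cong (h ℕ.+_) refl) (sym (ℕₚ.*-suc h (suc h))))
    h≢0 : h ≢ 0
    h≢0 h≡0 = ℕₚ.<⇒≢ 1<p (trans (cong suc (sym h≡0)) 1+h≡p)

  2≤m : 2 ℕ.≤ m
  2≤m = subst (2 ℕ.≤_) (sym m≡1+p) (ℕ.s≤s (ℕₚ.<⇒≤ 1<p))

  mod-toℕ : ∀ (a : Fp p) → toℕ a mod p ≡ a
  mod-toℕ a = same (⟦mod⟧ (toℕ a)) (r a) refl

  ⋆-scalar : ∀ (a : Fp p) x → toℕ a ⋆ x ≡ (a , 0p p) *ₖ x
  ⋆-scalar a x = trans (⋆-* (toℕ a) x) (cong (λ b → (b , 0p p) *ₖ x) (mod-toℕ a))

  -- The line spanned by β^i consists of 0 and the powers with exponent congruent to i modulo m,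
  -- since the nonzero scalars are the powers of β^m.
  line-powers : ∀ i (f : Fq p → ℤ) → ∑< p (λ n → f (n ⋆ pw i)) ≡ f 0ₖ + ∑< h (λ j → f (pw (j ℕ.* m ℕ.+ i)))
  line-powers i f = trans (∑<-Fin p (λ n → f (n ⋆ pw i)))
    (trans (∑-cong (elems {Fin p}) (λ a → cong f (⋆-scalar a (pw i))))
    (trans (Sum-reindex zero∪scalars (λ a → f ((a , 0p p) *ₖ pw i)))
    (trans (∑-Fin-suc {h} (λ j → f ((Inverse.to zero∪scalars j , 0p p) *ₖ pw i)))
    (cong₂ _+_ (cong f (*ₖ-zeroˡ (pw i)))
      (trans (∑-cong (elems {Fin h}) (λ j → cong f (trans (cong (_*ₖ pw i) (sym (cong (proj₁ (pw (toℕ j ℕ.* m)) ,_) (scalar-multiple (toℕ j))))) (sym (pw-+ (toℕ j ℕ.* m) i)))))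
             (sym (∑<-Fin h (λ j → f (pw (j ℕ.* m ℕ.+ i))))))))))

  segment-∑< : ∀ n d v x → ap (segment n d) v x ≡ ∑< n (λ k → v (x +ₖ k ⋆ d))
  segment-∑< zero d v x = refl
  segment-∑< (suc n) d v x = cong (_+ v (x +ₖ n ⋆ d)) (segment-∑< n d v x)

  lineSum-powers : ∀ i v x → ap (lineSum (pw i)) v x ≡ v x + ∑< h (λ j → v (x +ₖ pw (j ℕ.* m ℕ.+ i)))
  lineSum-powers i v x = trans (segment-∑< p (pw i) v x) (trans (line-powers i (λ z → v (x +ₖ z)))
    (cong (λ z → v z + ∑< h (λ j → v (x +ₖ pw (j ℕ.* m ℕ.+ i)))) (+ₖ-identityʳ x)))

  Sum-powers : ∀ (f : Fq p → ℤ) → Sum f ≡ f 0ₖ + ∑< n₀ (f ∘ pw)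
  Sum-powers f = trans (Sum-reindex zero∪powers f) (trans (∑-Fin-suc {n₀} (f ∘ Inverse.to zero∪powers))
    (cong (_+_ (f 0ₖ)) (sym (∑<-Fin n₀ (f ∘ pw)))))

  translation : Fq p → Fq p ↔ Fq p
  translation x = injective⇒↔ Fq↔Fin Fq↔Fin (x +ₖ_) (λ {y} {z} q → cancelʳ y z x (trans (+ₖ-comm y x) (trans q (+ₖ-comm x z))))

  Sum-translate : ∀ x (f : Fq p → ℤ) → Sum f ≡ Sum (λ z → f (x +ₖ z))
  Sum-translate x f = Sum-reindex (translation x) f

  power-classes : ∀ i j → pw i ≡ pw j → i % m ≡ j % m
  power-classes i j q = trans (reduce i) (trans (cong (_% m) (pw-≡⇒% i j q)) (sym (reduce j)))
    where
    reduce : ∀ i → i % m ≡ (i % n₀) % m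
    reduce i = sym (trans (sym ([m+kn]%n≡m%n (i % n₀) (i / n₀ ℕ.* h) m))
      (cong (_% m) (trans (cong (i % n₀ ℕ.+_) (trans (ℕₚ.*-assoc (i / n₀) h m) (cong (i / n₀ ℕ.*_) (sym n₀≡hm)))) (sym (m≡m%n+[m/n]*n i n₀)))))

  module Independent {i j} (i<m : i ℕ.< m) (j≢i : j % m ≢ i) where

    d = pw i
    w = pw j

    -- Nonzero scalars have logarithms divisible by m, so a common nonzero multiple of β^i and β^j
    -- would force i and j to be congruent modulo m.
    parallel : ∀ a b → (a , 0p p) *ₖ d ≡ (b , 0p p) *ₖ w → a ≡ 0p p × b ≡ 0p p
    parallel a b q = cases (a Fin.≟ 0p p) (b Fin.≟ 0p p)
      where
      as-power : ∀ a → a ≢ 0p p → Σ ℕ λ t → (pw t ≡ (a , 0p p)) × (t % m ≡ 0)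
      as-power a a≢0 = let t , _ , e = log (a , 0p p) (λ q → a≢0 (cong proj₁ q)) in t , e , scalar⇒%≡0 t (cong proj₂ e)
      nonzero : ∀ c k → c ≢ 0p p → (c , 0p p) *ₖ pw k ≢ 0ₖ
      nonzero c k c≢0 e = let t , q , _ = as-power c c≢0 in pw≢0 (t ℕ.+ k) (trans (pw-+ t k) (trans (cong (_*ₖ pw k) q) e))
      class : ∀ t k → t % m ≡ 0 → (t ℕ.+ k) % m ≡ k % m
      class t k e = trans (cong (_% m) (trans (cong (ℕ._+ k) (quotient t e)) (ℕₚ.+-comm (t / m ℕ.* m) k))) ([m+kn]%n≡m%n k (t / m) m)
      cases : Dec (a ≡ 0p p) → Dec (b ≡ 0p p) → a ≡ 0p p × b ≡ 0p p
      cases (yes a≡0) (yes b≡0) = a≡0 , b≡0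
      cases (yes refl) (no b≢0) = contradiction (trans (sym q) (*ₖ-zeroˡ d)) (nonzero b j b≢0)
      cases (no a≢0) (yes refl) = contradiction (trans q (*ₖ-zeroˡ w)) (nonzero a i a≢0)
      cases (no a≢0) (no b≢0) = let t , et , ct = as-power a a≢0 ; u , eu , cu = as-power b b≢0 in
        contradiction (trans (sym (class u j cu)) (trans (sym (power-classes (t ℕ.+ i) (u ℕ.+ j)
          (trans (pw-+ t i) (trans (cong (_*ₖ d) et) (trans q (trans (cong (_*ₖ w) (sym eu)) (sym (pw-+ u j)))))))) (trans (class t i ct) (m<n⇒m%n≡m i<m)))) j≢i

    combination : Fp p × Fp p → Fq p
    combination (a , b) = toℕ a ⋆ d +ₖ toℕ b ⋆ w

    combination-injective : ∀ {x y} → combination x ≡ combination y → x ≡ y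
    combination-injective {a , b} {a′ , b′} q = cong₂ _,_ (equal a a′ (proj₁ zeros)) (sym (equal b′ b (proj₂ zeros)))
      where
      difference : Fp p → Fp p → Fq p → Fq p
      difference a a′ x = (a ⊕ₚ (⊝ a′) , 0p p) *ₖ x
      difference≡ : ∀ a a′ x → difference a a′ x ≡ (toℕ a ⋆ x) +ₖ (-ₖ (toℕ a′ ⋆ x))
      difference≡ a a′ x = trans (cong (λ z → (a ⊕ₚ (⊝ a′) , z) *ₖ x) (same ⟦0⟧ (⟦+⟧ ⟦0⟧ (⟦-⟧ ⟦0⟧)) refl))
        (trans (*ₖ-distribʳ x (a , 0p p) (-ₖ (a′ , 0p p))) (cong₂ _+ₖ_ (sym (⋆-scalar a x)) (trans (-ₖ-* (a′ , 0p p) x) (cong -ₖ_ (sym (⋆-scalar a′ x))))))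
      rearrange : ∀ X Y X′ Y′ → X +ₖ Y ≡ X′ +ₖ Y′ → X +ₖ (-ₖ X′) ≡ Y′ +ₖ (-ₖ Y)
      rearrange X Y X′ Y′ e = cancelʳ _ _ (Y +ₖ X′) (trans (first′ X Y X′) (trans e (sym (second′ Y′ Y X′))))
        where
        first′ : ∀ X Y X′ → X +ₖ (-ₖ X′) +ₖ (Y +ₖ X′) ≡ X +ₖ Y
        first′ X Y X′ = trans (cong (X +ₖ (-ₖ X′) +ₖ_) (+ₖ-comm Y X′)) (trans (+ₖ-assoc X (-ₖ X′) (X′ +ₖ Y))
          (cong (X +ₖ_) (trans (sym (+ₖ-assoc (-ₖ X′) X′ Y)) (trans (cong (_+ₖ Y) (inverseˡ X′)) (identityˡ Y)))))
        second′ : ∀ Y′ Y X′ → Y′ +ₖ (-ₖ Y) +ₖ (Y +ₖ X′) ≡ X′ +ₖ Y′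
        second′ Y′ Y X′ = trans (+ₖ-assoc Y′ (-ₖ Y) (Y +ₖ X′))
          (trans (cong (Y′ +ₖ_) (trans (sym (+ₖ-assoc (-ₖ Y) Y X′)) (trans (cong (_+ₖ X′) (inverseˡ Y)) (identityˡ X′)))) (+ₖ-comm Y′ X′))
      zeros : (a ⊕ₚ (⊝ a′) ≡ 0p p) × (b′ ⊕ₚ (⊝ b) ≡ 0p p)
      zeros = parallel (a ⊕ₚ (⊝ a′)) (b′ ⊕ₚ (⊝ b)) (trans (difference≡ a a′ d)
        (trans (rearrange (toℕ a ⋆ d) (toℕ b ⋆ w) (toℕ a′ ⋆ d) (toℕ b′ ⋆ w) q) (sym (difference≡ b′ b w))))
      equal : ∀ a a′ → a ⊕ₚ (⊝ a′) ≡ 0p p → a ≡ a′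
      equal a a′ e = ≈⇒≡-Fin (-≈0⇒≈ (≈-trans (≈-sym (⟦+⟧ (r a) (⟦-⟧ (r a′)))) (≈-trans (≡⇒≈ (cong ⟦_⟧ e)) ⟦0⟧)))

    coordinates : (Fp p × Fp p) ↔ Fq p
    coordinates = injective⇒↔ Fq↔Fin Fq↔Fin combination combination-injective

    spans : ∀ x → Σ ℕ λ a → Σ ℕ λ b → x ≡ a ⋆ d +ₖ b ⋆ w
    spans x = let a , b = Inverse.from coordinates x in toℕ a , toℕ b , sym (Inverse.strictlyInverseˡ coordinates x)

    transversal : Transversal d w
    transversal = record
      { generate = spans
      ; planeSum = λ v x → trans (segment-∑< p d (ap (lineSum w) v) x)
          (trans (∑<-Fin p (λ k → ap (lineSum w) v (x +ₖ k ⋆ d)))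
          (trans (∑-cong (elems {Fin p}) (λ a → trans (segment-∑< p w v (x +ₖ toℕ a ⋆ d)) (trans (∑<-Fin p (λ k → v (x +ₖ toℕ a ⋆ d +ₖ k ⋆ w)))
              (∑-cong (elems {Fin p}) (λ b → cong v (+ₖ-assoc x (toℕ a ⋆ d) (toℕ b ⋆ w)))))))
          (trans (sym (∑-× (elems {Fin p}) (elems {Fin p}) (λ c → v (x +ₖ combination c))))
          (trans (sym (Sum-reindex coordinates (λ z → v (x +ₖ z)))) (sym (Sum-translate x v))))))
      }

    complement : Complement d w
    complement = record
      { spans = spans
      ; unique = λ {c} {b} {n} c<p b<p n<p q →
          let e = combination-injective {fromℕ< n<p , fromℕ< b<p} {fromℕ< (ℕₚ.<-trans (ℕₚ.n<1+n 0) 1<p) , fromℕ< c<p}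
                    (trans (cong₂ (λ n b → n ⋆ d +ₖ b ⋆ w) (Finₚ.toℕ-fromℕ< n<p) (Finₚ.toℕ-fromℕ< b<p))
                    (trans (+ₖ-comm (n ⋆ d) (b ⋆ w)) (trans (sym q)
                    (trans (sym (identityˡ (c ⋆ w)))
                    (sym (cong₂ (λ n b → n ⋆ d +ₖ b ⋆ w) (Finₚ.toℕ-fromℕ< (ℕₚ.<-trans (ℕₚ.n<1+n 0) 1<p)) (Finₚ.toℕ-fromℕ< c<p)))))))
          in back c<p b<p (cong proj₂ e) , forth n<p (ℕₚ.<-trans (ℕₚ.n<1+n 0) 1<p) (cong proj₁ e)
      }
      where
      forth : ∀ {a b} (a<p : a ℕ.< p) (b<p : b ℕ.< p) → fromℕ< a<p ≡ fromℕ< b<p → a ≡ b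
      forth a<p b<p e = trans (sym (Finₚ.toℕ-fromℕ< a<p)) (trans (cong toℕ e) (Finₚ.toℕ-fromℕ< b<p))
      back : ∀ {a b} (a<p : a ℕ.< p) (b<p : b ℕ.< p) → fromℕ< b<p ≡ fromℕ< a<p → a ≡ b
      back a<p b<p e = sym (forth b<p a<p e)

-- Graphs given by colourings of the exponents with period four.

bit : Bool → ℕ
bit true = 1
bit false = 0

ℤbit : Bool → ℤ
ℤbit = boolTo 0ℤ 1ℤ

consIf : {A : Set} → Bool → A → List A → List A
consIf true x xs = x ∷ xs
consIf false x xs = xs

-- A union of classes modulo 4. That half of the residues are chosen makes the number of directions
-- s = m / 2, for the colouring as well as for its negation.
record Colour (c : ℕ → Bool) : Set where
  field
    periodic : ∀ n → c (4 ℕ.+ n) ≡ c n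
    half : bit (c 3) ℕ.+ (bit (c 2) ℕ.+ (bit (c 1) ℕ.+ bit (c 0))) ≡ 2

  periodic-* : ∀ t j → c (j ℕ.+ t ℕ.* 4) ≡ c j
  periodic-* t j = trans (cong c (ℕₚ.+-comm j (t ℕ.* 4))) (go t)
    where
    go : ∀ t → c (t ℕ.* 4 ℕ.+ j) ≡ c j
    go zero = refl
    go (suc t) = trans (periodic (t ℕ.* 4 ℕ.+ j)) (go t)

complementColour : ∀ {c} → Colour c → Colour (not ∘ c)
complementColour {c} col = record { periodic = λ n → cong not (periodic n) ; half = flip (c 3) (c 2) (c 1) (c 0) half }
  where
  open Colour col
  flip : ∀ a b c d → bit a ℕ.+ (bit b ℕ.+ (bit c ℕ.+ bit d)) ≡ 2 → bit (not a) ℕ.+ (bit (not b) ℕ.+ (bit (not c) ℕ.+ bit (not d))) ≡ 2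
  flip false false true true _ = refl
  flip false true false true _ = refl
  flip false true true false _ = refl
  flip true false false true _ = refl
  flip true false true false _ = refl
  flip true true false false _ = refl
  flip false false false false ()
  flip false false false true ()
  flip false false true false ()
  flip false true false false ()
  flip false true true true ()
  flip true false false false ()
  flip true false true true ()
  flip true true false true ()
  flip true true true false ()
  flip true true true true ()

module Coloured (p : ℕ) .⦃ _ : ℕ.NonZero p ⦄ (pPrime : Prime p) (p%4≡3 : p % 4 ≡ 3) (β : Fq p) (generates : IsPrimitive p β) where

  t′ : ℕ
  t′ = p / 4

  p≡3+4t′ : p ≡ 3 ℕ.+ t′ ℕ.* 4
  p≡3+4t′ = trans (m≡m%n+[m/n]*n p 4) (cong (ℕ._+ t′ ℕ.* 4) p%4≡3)

  2<p : 2 ℕ.< p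
  2<p = subst (2 ℕ.<_) (sym p≡3+4t′) (ℕₚ.m≤m+n 3 (t′ ℕ.* 4))

  open Directions p pPrime 2<p β generates public
  open PlaneRank p pPrime 𝔽 exponent using (Complement)

  t : ℕ
  t = suc t′

  m≡4t : m ≡ t ℕ.* 4
  m≡4t = trans m≡1+p (cong suc p≡3+4t′)

  s′ : ℕ
  s′ = t′ ℕ.* 2

  p≡ : p ≡ suc (suc s′ ℕ.+ suc s′)
  p≡ = trans p≡3+4t′ (cong (λ n → suc (suc n)) (trans (cong suc (ℕₚ.*-distribˡ-+ t′ 2 2)) (sym (ℕₚ.+-suc s′ s′))))

  open PlaneSRG p pPrime 𝔽 exponent s′ p≡ Fq↔Fin public using (s; SRG; S; plane-SRG; 2≤s; p+1≡2s)

  card : Sum {Fq p} (λ _ → 1ℤ) ≡ π * π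
  card = trans (Sum-powers (λ _ → 1ℤ)) (trans (cong (_+_ 1ℤ) (trans (∑<-const n₀ 1ℤ) (*-identityʳ (+ n₀))))
    (trans (cong +_ order) (pos-* p p)))

  directions : (ℕ → Bool) → ℕ → List (Fq p)
  directions c zero = []
  directions c (suc i) = consIf (c i) (pw i) (directions c i)

  All-directions : ∀ {P : Fq p → Set} c n → (∀ i → i ℕ.< n → c i ≡ true → P (pw i)) → All P (directions c n)
  All-directions c zero f = []
  All-directions {P} c (suc n) f = prependIf (c n) refl (All-directions c n (λ i i<n → f i (ℕₚ.m<n⇒m<1+n i<n)))
    where
    prependIf : ∀ b → c n ≡ b → ∀ {xs} → All P xs → All P (consIf b (pw n) xs)
    prependIf true q ps = f n (ℕₚ.n<1+n n) q ∷ ps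
    prependIf false q ps = ps

  transversal-< : ∀ {i j} → i ℕ.< m → j ℕ.< m → j ≢ i → Transversal (pw i) (pw j)
  transversal-< {i} {j} i<m j<m j≢i = Independent.transversal {i} {j} i<m (λ q → j≢i (trans (sym (m<n⇒m%n≡m j<m)) q))

  AllPairs-directions : ∀ c n → n ℕ.≤ m → AllPairs Transversal (directions c n)
  AllPairs-directions c zero _ = []
  AllPairs-directions c (suc n) n<m = prependIf (c n)
    where
    rest = AllPairs-directions c n (ℕₚ.<⇒≤ n<m)
    prependIf : ∀ b → AllPairs Transversal (consIf b (pw n) (directions c n))
    prependIf true = All-directions c n (λ j j<n _ → transversal-< {n} {j} n<m (ℕₚ.<-trans j<n n<m) (ℕₚ.<⇒≢ j<n)) ∷ rest
    prependIf false = rest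

  -- Multiplication by β changes the direction because m > 1; it serves as the choice of
  -- transversals e. The last class i = m - 1 is followed by class 0.
  complement-next : ∀ i → i ℕ.< m → Complement (pw i) (pw (suc i))
  complement-next i i<m = Independent.complement {i} {suc i} i<m (distinct (ℕₚ.m≤n⇒m<n∨m≡n i<m))
    where
    distinct : suc i ℕ.< m ⊎ suc i ≡ m → suc i % m ≢ i
    distinct (inj₁ 1+i<m) q = ℕₚ.<⇒≢ (ℕₚ.n<1+n i) (trans (sym q) (m<n⇒m%n≡m 1+i<m))
    distinct (inj₂ 1+i≡m) q = ℕₚ.<⇒≢ 2≤m (trans (cong suc (trans (sym (n%n≡0 m)) (trans (cong (_% m) (sym 1+i≡m)) q))) 1+i≡m)

  length-consIf : ∀ b (x : Fq p) xs → length (consIf b x xs) ≡ bit b ℕ.+ length xs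
  length-consIf true x xs = refl
  length-consIf false x xs = refl

  lineSums-directions : ∀ c n v x → ap (lineSums (directions c n)) v x ≡ ∑< n (λ i → ℤbit (c i) * ap (lineSum (pw i)) v x)
  lineSums-directions c zero v x = refl
  lineSums-directions c (suc n) v x = trans (cons (c n)) (trans (+-comm _ (ap (lineSums (directions c n)) v x))
      (cong (_+ ℤbit (c n) * ap (lineSum (pw n)) v x) (lineSums-directions c n v x)))
    where
    cons : ∀ b → ap (lineSums (consIf b (pw n) (directions c n))) v x ≡ ℤbit b * ap (lineSum (pw n)) v x + ap (lineSums (directions c n)) v x
    cons true = cong (_+ ap (lineSums (directions c n)) v x) (sym (*-identityˡ (ap (lineSum (pw n)) v x)))
    cons false = sym (trans (cong (_+ ap (lineSums (directions c n)) v x) (*-zeroˡ (ap (lineSum (pw n)) v x))) (+-identityˡ _))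

  ∑<-bits : ∀ c n → ∑< n (ℤbit ∘ c) ≡ + length (directions c n)
  ∑<-bits c zero = refl
  ∑<-bits c (suc n) = trans (cong (_+ ℤbit (c n)) (∑<-bits c n)) (cons (c n))
    where
    cons : ∀ b → + length (directions c n) + ℤbit b ≡ + length (consIf b (pw n) (directions c n))
    cons true = +-comm (+ length (directions c n)) 1ℤ
    cons false = +-identityʳ _

  -- The p + 1 lines through x have x in common and partition the other points of the plane.
  all-lines : ∀ v x → ∑< m (λ i → ap (lineSum (pw i)) v x) ≡ π * v x + Sum v
  all-lines v x = trans (∑<-cong m (λ i → lineSum-powers i v x))
    (trans (∑<-+ m (λ _ → v x) (λ i → ∑< h (λ j → v (x +ₖ pw (j ℕ.* m ℕ.+ i)))))
    (trans (cong₂ _+_ (trans (∑<-const m (v x)) (cong (λ n → + n * v x) m≡1+p))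
                      (trans (sym (∑<-product h m (λ k → v (x +ₖ pw k)))) (cong (λ n → ∑< n (λ k → v (x +ₖ pw k))) (sym n₀≡hm))))
    (trans (regroup π (v x) (∑< n₀ (λ k → v (x +ₖ pw k))))
    (cong (_+_ (π * v x)) (sym (trans (Sum-translate x v) (trans (Sum-powers (λ z → v (x +ₖ z))) (cong (λ z → v z + ∑< n₀ (λ k → v (x +ₖ pw k))) (+ₖ-identityʳ x)))))))))
    where
    regroup : ∀ π a b → (1ℤ + π) * a + b ≡ π * a + (a + b)
    regroup = solve-∀

  module OfColourLength {c : ℕ → Bool} (colour : Colour c) where

    open Colour colour

    length-directions : ∀ t → length (directions c (t ℕ.* 4)) ≡ t ℕ.* 2
    length-directions zero = refl
    length-directions (suc t) = begin
      length (directions c (4 ℕ.+ n))                                  ≡⟨ length-consIf (c (3 ℕ.+ n)) _ _ ⟩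
      bit (c (3 ℕ.+ n)) ℕ.+ length (directions c (3 ℕ.+ n))             ≡⟨ cong₂ ℕ._+_ (cong bit (periodic-* t 3)) (trans (length-consIf (c (2 ℕ.+ n)) _ _)
        (cong₂ ℕ._+_ (cong bit (periodic-* t 2)) (trans (length-consIf (c (1 ℕ.+ n)) _ _)
        (cong₂ ℕ._+_ (cong bit (periodic-* t 1)) (trans (length-consIf (c n) _ _) (cong₂ ℕ._+_ (cong bit (periodic-* t 0)) (length-directions t))))))) ⟩
      bit (c 3) ℕ.+ (bit (c 2) ℕ.+ (bit (c 1) ℕ.+ (bit (c 0) ℕ.+ t ℕ.* 2)))  ≡⟨ reassociate (bit (c 3)) (bit (c 2)) (bit (c 1)) (bit (c 0)) (t ℕ.* 2) ⟩
      bit (c 3) ℕ.+ (bit (c 2) ℕ.+ (bit (c 1) ℕ.+ bit (c 0))) ℕ.+ t ℕ.* 2     ≡⟨ cong (ℕ._+ t ℕ.* 2) half ⟩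
      2 ℕ.+ t ℕ.* 2                                                     ∎
      where
      open ≡-Reasoning
      n = t ℕ.* 4
      reassociate : ∀ a b c d e → a ℕ.+ (b ℕ.+ (c ℕ.+ (d ℕ.+ e))) ≡ a ℕ.+ (b ℕ.+ (c ℕ.+ d)) ℕ.+ e
      reassociate a b c d e = sym (trans (ℕₚ.+-assoc a _ e) (cong (a ℕ.+_) (trans (ℕₚ.+-assoc b _ e) (cong (b ℕ.+_) (ℕₚ.+-assoc c d e)))))

  module OfColour {c : ℕ → Bool} (colour : Colour c) where

    open Colour colour
    open OfColourLength colour

    size : length (directions c m) ≡ s
    size = trans (cong (λ n → length (directions c n)) m≡4t) (length-directions t)

    periodic-m : ∀ j i → c (j ℕ.* m ℕ.+ i) ≡ c i
    periodic-m j i = trans (cong c (trans (ℕₚ.+-comm (j ℕ.* m) i) (cong (i ℕ.+_) (trans (cong (j ℕ.*_) m≡4t) (sym (ℕₚ.*-assoc j t 4)))))) (periodic-* (j ℕ.* t) i)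

    colour-% : ∀ i → c (i % m) ≡ c i
    colour-% i = trans (sym (periodic-m (i / m) (i % m))) (cong c (trans (ℕₚ.+-comm (i / m ℕ.* m) (i % m)) (sym (m≡m%n+[m/n]*n i m))))

    -- Equal powers have exponents congruent modulo m, and 4 divides m, so the colour is a function
    -- of the field element.
    colour-pw : ∀ i j → pw i ≡ pw j → c i ≡ c j
    colour-pw i j q = trans (sym (colour-% i)) (trans (cong c (power-classes i j q)) (colour-% j))

    -- As a scalar, -1 has its logarithm divisible by m and hence by 4. This makes the adjacency
    -- symmetric and allows x - y to be replaced by y - x.
    colour-neg : ∀ k → Σ ℕ λ l → (-ₖ pw k ≡ pw l) × (c l ≡ c k)
    colour-neg k = let l , e = minusOne-log in l ℕ.+ k ,
      trans (cong -ₖ_ (sym (*ₖ-identityˡ (pw k)))) (trans (sym (-ₖ-* 1ₖ (pw k))) (trans (cong (_*ₖ pw k) (sym e)) (sym (pw-+ l k)))) ,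
      trans (cong (λ l → c (l ℕ.+ k)) (quotient l (scalar⇒%≡0 l (trans (cong proj₂ e) (same (⟦-⟧ ⟦0⟧) ⟦0⟧ refl))))) (periodic-m (l / m) k)

    total : ∀ v x → ap (lineSums (directions c m)) v x + ap (lineSums (directions (not ∘ c) m)) v x ≡ π * v x + Sum v
    total v x = trans (cong₂ _+_ (lineSums-directions c m v x) (lineSums-directions (not ∘ c) m v x))
      (trans (sym (∑<-+ m (λ i → ℤbit (c i) * ap (lineSum (pw i)) v x) (λ i → ℤbit (not (c i)) * ap (lineSum (pw i)) v x)))
      (trans (∑<-cong m (λ i → either (c i) (ap (lineSum (pw i)) v x))) (all-lines v x)))
      where
      either : ∀ b a → ℤbit b * a + ℤbit (not b) * a ≡ a
      either true a = trans (cong₂ _+_ (*-identityˡ a) (*-zeroˡ a)) (+-identityʳ a)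
      either false a = trans (cong₂ _+_ (*-zeroˡ a) (*-identityˡ a)) (+-identityˡ a)

    module WithAdjacency (adj : Fq p → Fq p → Bool) (irreflexive : ∀ x → adj x x ≡ false)
                         (adj-pw : ∀ x y k → x +ₖ (-ₖ y) ≡ pw k → adj x y ≡ c k)
                         (c-0 : c 0 ≡ true) (c-3 : c 3 ≡ false) where

      a : Fq p → Fq p → ℤ
      a x y = ℤbit (adj x y)

      N : End (Fq p)
      N = lineSums (directions c m)

      a-translate : ∀ x k → a x (x +ₖ pw k) ≡ ℤbit (c k)
      a-translate x k = let l , e , q = colour-neg k in cong ℤbit (trans (adj-pw x (x +ₖ pw k) l (trans difference e)) q)
        where
        difference : x +ₖ (-ₖ (x +ₖ pw k)) ≡ -ₖ pw k
        difference = cancelʳ (x +ₖ (-ₖ (x +ₖ pw k))) (-ₖ pw k) (x +ₖ pw k) (trans (+ₖ-assoc x (-ₖ (x +ₖ pw k)) (x +ₖ pw k)) (trans (cong (x +ₖ_) (inverseˡ (x +ₖ pw k))) (trans (+ₖ-identityʳ x)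
          (sym (trans (cong ((-ₖ pw k) +ₖ_) (+ₖ-comm x (pw k))) (trans (sym (+ₖ-assoc (-ₖ pw k) (pw k) x)) (trans (cong (_+ₖ x) (inverseˡ (pw k))) (identityˡ x))))))))

      neighbours : ∀ (v : Fq p → ℤ) x → Sum (λ y → a x y * v y) ≡ ∑< m (λ i → ℤbit (c i) * ∑< h (λ j → v (x +ₖ pw (j ℕ.* m ℕ.+ i))))
      neighbours v x = trans (Sum-translate x (λ y → a x y * v y)) (trans (Sum-powers (λ z → a x (x +ₖ z) * v (x +ₖ z)))
        (trans (cong₂ _+_ (trans (cong (_* v (x +ₖ 0ₖ)) (cong ℤbit (trans (cong (adj x) (+ₖ-identityʳ x)) (irreflexive x)))) (*-zeroˡ (v (x +ₖ 0ₖ))))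
          (trans (∑<-cong n₀ (λ k → cong (_* v (x +ₖ pw k)) (a-translate x k)))
          (trans (cong (λ n → ∑< n (λ k → ℤbit (c k) * v (x +ₖ pw k))) n₀≡hm)
          (trans (∑<-product h m (λ k → ℤbit (c k) * v (x +ₖ pw k)))
          (∑<-cong m (λ i → trans (∑<-cong h (λ j → cong (λ b → ℤbit b * v (x +ₖ pw (j ℕ.* m ℕ.+ i))) (periodic-m j i)))
                                  (∑<-* h (ℤbit (c i)) (λ j → v (x +ₖ pw (j ℕ.* m ℕ.+ i))))))))))
        (+-identityˡ _)))

      -- N is the adjacency matrix plus s: the point x lies on all s chosen lines through it, and
      -- the remaining points of these lines are its neighbours.
      adjacency : ∀ v x → ap N v x ≡ S * v x + Sum (λ y → a x y * v y)
      adjacency v x = trans (lineSums-directions c m v x)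
        (trans (∑<-cong m (λ i → trans (cong (_*_ (ℤbit (c i))) (lineSum-powers i v x)) (distribute (ℤbit (c i)) (v x) (∑< h (λ j → v (x +ₖ pw (j ℕ.* m ℕ.+ i)))))))
        (trans (∑<-+ m (λ i → v x * ℤbit (c i)) (λ i → ℤbit (c i) * ∑< h (λ j → v (x +ₖ pw (j ℕ.* m ℕ.+ i)))))
        (cong₂ _+_ (trans (∑<-* m (v x) (ℤbit ∘ c)) (trans (cong (_*_ (v x)) (trans (∑<-bits c m) (cong +_ size))) (*-comm (v x) S)))
                   (sym (neighbours v x)))))
        where
        distribute : ∀ b a z → b * (a + z) ≡ a * b + b * z
        distribute = solve-∀

      colour-SRG : SRG N
      colour-SRG = plane-SRG (β *ₖ_) (directions c m) (directions (not ∘ c) m) size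
        (trans (cong (λ n → length (directions (not ∘ c) n)) m≡4t) (OfComplement.length-directions t))
        (All-directions c m (λ i i<m _ → complement-next i i<m))
        (AllPairs-directions c m ℕₚ.≤-refl)
        (All-directions c m (λ i i<m ci → All-directions (not ∘ c) m (λ j j<m cj → transversal-< {i} {j} i<m j<m (λ { refl → clash ci cj }))))
        total card (transversal-< {0} {1} (ℕₚ.<-trans (ℕₚ.n<1+n 0) 2≤m) 2≤m (λ ()))
        a adjacency (λ x → cong ℤbit (irreflexive x))
        -- The elements β^0 and β^3 are a neighbour and a non-neighbour of 0 in both graphs.
        {pw 0} {pw 3} (λ q → pw≢0 0 (sym q)) (λ q → pw≢0 3 (sym q))
        (cong ℤbit (trans (adj-pw (pw 0) 0ₖ 0 (minus-zero (pw 0))) c-0))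
        (cong ℤbit (trans (adj-pw (pw 3) 0ₖ 3 (minus-zero (pw 3))) c-3))
        where
        module OfComplement = OfColourLength (complementColour colour)
        clash : ∀ {b} → b ≡ true → not b ≡ true → ⊥
        clash refl ()
        minus-zero : ∀ x → x +ₖ (-ₖ 0ₖ) ≡ x
        minus-zero x = trans (cong (x +ₖ_) (trans (sym (identityˡ (-ₖ 0ₖ))) (+ₖ-inverseʳ 0ₖ))) (+ₖ-identityʳ x)

-- The two adjacency relations in terms of discrete logarithms.

any-true : ∀ {A : Set} (f : A → Bool) {xs x} → x ∈ xs → f x ≡ true → any f xs ≡ true
any-true f (here refl) q rewrite q = refl
any-true f {y ∷ xs} (there i) q = trans (cong (f y ∨_) (any-true f i q)) (Boolₚ.∨-zeroʳ (f y))

any-witness : ∀ {A : Set} (f : A → Bool) xs → any f xs ≡ true → Σ A λ x → f x ≡ true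
any-witness f (x ∷ xs) q with f x in e
... | true = x , e
... | false = any-witness f xs q

≡-of-⇔ : ∀ b c → (b ≡ true → c ≡ true) → (c ≡ true → b ≡ true) → b ≡ c
≡-of-⇔ true c f g = sym (f refl)
≡-of-⇔ false true f g = g refl
≡-of-⇔ false false f g = refl

∧-true : ∀ {a b} → a ∧ b ≡ true → a ≡ true × b ≡ true
∧-true {true} {true} q = refl , refl

paleyColour peisertColour : ℕ → Bool
paleyColour 0 = true
paleyColour 1 = false
paleyColour (suc (suc n)) = paleyColour n
peisertColour 0 = true
peisertColour 1 = true
peisertColour 2 = false
peisertColour 3 = false
peisertColour (suc (suc (suc (suc n)))) = peisertColour n

paley-periodic : Colour paleyColour
paley-periodic = record { periodic = λ _ → refl ; half = refl }

peisert-periodic : Colour peisertColour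
peisert-periodic = record { periodic = λ _ → refl ; half = refl }

paleyColour-double : ∀ l → paleyColour (l ℕ.+ l) ≡ true
paleyColour-double zero = refl
paleyColour-double (suc l) = trans (cong (paleyColour ∘ suc) (ℕₚ.+-suc l l)) (paleyColour-double l)

paleyColour-half : ∀ k → paleyColour k ≡ true → Σ ℕ λ l → k ≡ l ℕ.+ l
paleyColour-half 0 q = 0 , refl
paleyColour-half (suc (suc k)) q = let l , e = paleyColour-half k q in suc l , cong suc (trans (cong suc e) (sym (ℕₚ.+-suc l l)))

peisertColour-quarter : ∀ k → peisertColour k ≡ true → Σ ℕ λ l → k ≡ l ℕ.* 4 ⊎ k ≡ suc (l ℕ.* 4)
peisertColour-quarter 0 q = 0 , inj₁ refl
peisertColour-quarter 1 q = 0 , inj₂ refl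
peisertColour-quarter (suc (suc (suc (suc k)))) q = let l , e = peisertColour-quarter k q in
  suc l , Sum.map (cong (4 ℕ.+_)) (cong (4 ℕ.+_)) e

module Similarity (p : ℕ) .⦃ _ : ℕ.NonZero p ⦄ (pPrime : Prime p) (p%4≡3 : p % 4 ≡ 3) (β : Fq p) (generates : IsPrimitive p β) where

  open Coloured p pPrime p%4≡3 β generates

  =q-true : ∀ x y → x ≡ y → _=q_ p x y ≡ true
  =q-true (a , b) _ refl with a Finₚ.≟ a | b Finₚ.≟ b
  ... | yes _ | yes _ = refl
  ... | no ¬q | _ = contradiction refl ¬q
  ... | yes _ | no ¬q = contradiction refl ¬q

  =q-sound : ∀ x y → _=q_ p x y ≡ true → x ≡ y
  =q-sound (a , b) (c , d) q with a Finₚ.≟ c | b Finₚ.≟ d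
  ... | yes refl | yes refl = refl

  =q-false : ∀ x y → x ≢ y → _=q_ p x y ≡ false
  =q-false x y x≢y = ≡-of-⇔ (_=q_ p x y) false (λ q → contradiction (=q-sound x y q) x≢y) (λ ())

  not=q : ∀ x y → not (_=q_ p x y) ≡ true → x ≢ y
  not=q x y q x≡y = clash (=q-true x y x≡y) q
    where
    clash : ∀ {b} → b ≡ true → not b ≡ true → ⊥
    clash refl ()

  all-elements : ∀ x → x ∈ elemsFq p
  all-elements (a , b) = ∈-cartesianProduct⁺ (∈-allFin a) (∈-allFin b)

  -- The tests inC0, inβC0 and isNZSquare all have this form.
  inImage : (Fq p → Fq p) → Fq p → Bool
  inImage f d = any (λ y → not (_=q_ p y 0ₖ) ∧ _=q_ p (f y) d) (elemsFq p)

  inImage-witness : ∀ f d → inImage f d ≡ true → Σ ℕ λ l → f (pw l) ≡ d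
  inImage-witness f d q = let y , e = any-witness (λ y → not (_=q_ p y 0ₖ) ∧ _=q_ p (f y) d) (elemsFq p) q
                              e₁ , e₂ = ∧-true {not (_=q_ p y 0ₖ)} e
                              l , _ , pw-l = log y (not=q y 0ₖ e₁)
                          in l , trans (cong f pw-l) (=q-sound (f y) d e₂)

  inImage-pw : ∀ f d l → f (pw l) ≡ d → inImage f d ≡ true
  inImage-pw f d l q = any-true (λ y → not (_=q_ p y 0ₖ) ∧ _=q_ p (f y) d) (all-elements (pw l))
    (trans (cong (λ b → not b ∧ _=q_ p (f (pw l)) d) (=q-false (pw l) 0ₖ (pw≢0 l))) (=q-true (f (pw l)) d q))

  pw-^ : ∀ l n → _^q_ p (pw l) n ≡ pw (n ℕ.* l)
  pw-^ l zero = refl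
  pw-^ l (suc n) = trans (cong (pw l *ₖ_) (pw-^ l n)) (sym (pw-+ l (n ℕ.* l)))

  pw-^4 : ∀ l → _^q_ p (pw l) 4 ≡ pw (l ℕ.* 4)
  pw-^4 l = trans (pw-^ l 4) (cong pw (ℕₚ.*-comm 4 l))

  module Paley = OfColour paley-periodic
  module Peisert = OfColour peisert-periodic

  squares : ∀ k → isNZSquare p (pw k) ≡ paleyColour k
  squares k = ≡-of-⇔ (isNZSquare p (pw k)) (paleyColour k)
    (λ q → let l , e = inImage-witness (λ y → y *ₖ y) (pw k) q in
      trans (sym (Paley.colour-pw (l ℕ.+ l) k (trans (pw-+ l l) e))) (paleyColour-double l))
    (λ q → let l , e = paleyColour-half k q in inImage-pw (λ y → y *ₖ y) (pw k) l (trans (sym (pw-+ l l)) (cong pw (sym e))))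

  fourth-powers : ∀ k → inC0 p (pw k) ∨ inβC0 p β (pw k) ≡ peisertColour k
  fourth-powers k = ≡-of-⇔ (inC0 p (pw k) ∨ inβC0 p β (pw k)) (peisertColour k)
    (λ q → Sum.[ (λ q → let l , e = inImage-witness (λ y → _^q_ p y 4) (pw k) q in
                   trans (sym (Peisert.colour-pw (l ℕ.* 4) k (trans (sym (pw-^4 l)) e))) (Colour.periodic-* peisert-periodic l 0))
               , (λ q → let l , e = inImage-witness (λ y → β *ₖ _^q_ p y 4) (pw k) q in
                   trans (sym (Peisert.colour-pw (suc (l ℕ.* 4)) k (trans (cong (β *ₖ_) (sym (pw-^4 l))) e))) (Colour.periodic-* peisert-periodic l 1))
               ] (∨-true (inC0 p (pw k)) q))
    (λ q → let l , e = peisertColour-quarter k q in Sum.[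
        (λ e → cong (_∨ inβC0 p β (pw k)) (inImage-pw (λ y → _^q_ p y 4) (pw k) l (trans (pw-^4 l) (cong pw (sym e)))))
      , (λ e → trans (cong (inC0 p (pw k) ∨_) (inImage-pw (λ y → β *ₖ _^q_ p y 4) (pw k) l (trans (cong (β *ₖ_) (pw-^4 l)) (cong pw (sym e)))))
                     (Boolₚ.∨-zeroʳ (inC0 p (pw k)))) ] e)
    where
    ∨-true : ∀ a {b} → a ∨ b ≡ true → a ≡ true ⊎ b ≡ true
    ∨-true true q = inj₁ refl
    ∨-true false q = inj₂ q

  module Adjacency (test : Fq p → Bool) {c : ℕ → Bool} (test-pw : ∀ k → test (pw k) ≡ c k) where

    adj : Fq p → Fq p → Bool
    adj x y = not (_=q_ p x y) ∧ test (_-q_ p x y)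

    irreflexive : ∀ x → adj x x ≡ false
    irreflexive x = cong (λ b → not b ∧ test (_-q_ p x x)) (=q-true x x refl)

    adj-pw : ∀ x y k → x +ₖ (-ₖ y) ≡ pw k → adj x y ≡ c k
    adj-pw x y k q = trans (cong (λ b → not b ∧ test (_-q_ p x y)) (=q-false x y distinct)) (trans (cong test q) (test-pw k))
      where
      distinct : x ≢ y
      distinct refl = pw≢0 k (trans (sym q) (+ₖ-inverseʳ x))

  module PaleyAdj = Adjacency (isNZSquare p) squares
  module PeisertAdj = Adjacency (λ d → inC0 p d ∨ inβC0 p β d) fourth-powers
  module PaleyN = Paley.WithAdjacency (paleyAdj p) PaleyAdj.irreflexive PaleyAdj.adj-pw refl refl
  module PeisertN = Peisert.WithAdjacency (peisertAdj p β) PeisertAdj.irreflexive PeisertAdj.adj-pw refl refl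

  Id : Fq p → Fq p → ℤ
  Id x y = ℤbit (_=q_ p x y)

  unit-Id : ∀ x y → unit y x ≡ Id x y
  unit-Id x y with x ≟ y
  ... | yes refl = trans (unit-diag x) (cong ℤbit (sym (=q-true x x refl)))
  ... | no x≢y = trans (indicator-no (y ≟ x) (x≢y ∘ sym)) (cong ℤbit (sym (=q-false x y x≢y)))

  apply : (f : End (Fq p)) (v : Fq p → ℤ) → ∀ x → Sum (λ y → ap f (unit y) x * v y) ≡ ap f v x
  apply f v x = sym (trans (ap-expand f v x) (∑-cong (elems {Fq p}) (λ y → *-comm (v y) (ap f (unit y) x))))

  abstract
    similar : Similar PaleyN.N PeisertN.N
    similar = Classification.SRG-similar p pPrime s 2≤s p+1≡2s PaleyN.colour-SRG PeisertN.colour-SRG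

    P : Iso (Fq p) (Fq p)
    P = Similar.iso similar

    C C′ : Fq p → Fq p → ℤ
    C x y = ap (to P) (unit y) x
    C′ x y = ap (from P) (unit y) x

    C-C′ : ∀ x z → Sum (λ y → C x y * C′ y z) ≡ Id x z
    C-C′ x z = trans (apply (to P) (λ y → C′ y z) x) (trans (to-from P (unit z) x) (unit-Id x z))

    C′-C : ∀ x z → Sum (λ y → C′ x y * C y z) ≡ Id x z
    C′-C x z = trans (apply (from P) (λ y → C y z) x) (trans (from-to P (unit z) x) (unit-Id x z))

    -- The isomorphism intertwines the two operators N, each the adjacency matrix plus s. The scalar
    -- s commutes with C, so its contribution cancels.
    C-A : ∀ x z → Sum (λ y → C x y * ℤbit (paleyAdj p y z)) ≡ Sum (λ y → ℤbit (peisertAdj p β x y) * C y z)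
    C-A x z = trans (apply (to P) (λ y → PaleyN.a y z) x) (+-cancelˡ (S * C x z) _ _ (begin
      S * C x z + ap (to P) (λ y → PaleyN.a y z) x                      ≡⟨ cong (_+ ap (to P) (λ y → PaleyN.a y z) x) (ap-* (to P) S (unit z) x) ⟨
      ap (to P) (λ y → S * unit z y) x + ap (to P) (λ y → PaleyN.a y z) x ≡⟨ ap-+ (to P) (λ y → S * unit z y) (λ y → PaleyN.a y z) x ⟨
      ap (to P) (λ y → S * unit z y + PaleyN.a y z) x                   ≡⟨ ap-cong (to P) (λ y → column y) x ⟩
      ap (to P) (ap PaleyN.N (unit z)) x                                ≡⟨ intertwines similar (unit z) x ⟩
      ap PeisertN.N (ap (to P) (unit z)) x                              ≡⟨ PeisertN.adjacency (ap (to P) (unit z)) x ⟩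
      S * C x z + Sum (λ y → PeisertN.a x y * C y z)                    ∎))
      where
      open ≡-Reasoning
      column : ∀ y → S * unit z y + PaleyN.a y z ≡ ap PaleyN.N (unit z) y
      column y = sym (trans (PaleyN.adjacency (unit z) y) (cong (_+_ (S * unit z y))
        (trans (∑-cong (elems {Fq p}) (λ w → *-comm (PaleyN.a y w) (unit z w))) (∑-indicator z (PaleyN.a y)))))

-- Transport of matrix identities along a ring homomorphism from ℤ.

module Transfer (p : ℕ) .⦃ _ : ℕ.NonZero p ⦄ {A : Set} (_⊞′_ _⊠_ : A → A → A) (𝟘 𝟙 : A) (f : ℤ → A) (f-0 : f 0ℤ ≡ 𝟘) (f-1 : f 1ℤ ≡ 𝟙)
                (f-+ : ∀ a b → f (a + b) ≡ f a ⊞′ f b) (f-* : ∀ a b → f (a * b) ≡ f a ⊠ f b) where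

  open Mat (elemsFq p) _⊞′_ _⊠_ 𝟘

  f-bit : ∀ b → boolTo 𝟘 𝟙 b ≡ f (ℤbit b)
  f-bit true = sym f-1
  f-bit false = sym f-0

  f-∑ : ∀ xs {g k : Fq p → A} (g′ k′ : Fq p → ℤ) → (∀ y → g y ≡ f (g′ y)) → (∀ y → k y ≡ f (k′ y)) →
        foldr _⊞′_ 𝟘 (map (λ y → g y ⊠ k y) xs) ≡ f (∑ xs (λ y → g′ y * k′ y))
  f-∑ [] g′ k′ eg ek = sym f-0
  f-∑ (x ∷ xs) g′ k′ eg ek = trans (cong₂ _⊞′_ (trans (cong₂ _⊠_ (eg x) (ek x)) (sym (f-* (g′ x) (k′ x)))) (f-∑ xs g′ k′ eg ek))
    (sym (f-+ (g′ x * k′ x) (∑ xs (λ y → g′ y * k′ y))))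

  f-inverse : ∀ (C D : Fq p → Fq p → ℤ) → (∀ x z → Sum (λ y → C x y * D y z) ≡ ℤbit (_=q_ p x z)) →
              ∀ x z → ((λ x y → f (C x y)) · (λ x y → f (D x y))) x z ≡ boolTo 𝟘 𝟙 (_=q_ p x z)
  f-inverse C D e x z = trans (f-∑ (elemsFq p) (C x) (λ y → D y z) (λ _ → refl) (λ _ → refl))
    (trans (cong f (e x z)) (sym (f-bit (_=q_ p x z))))

  f-intertwine : ∀ (C : Fq p → Fq p → ℤ) (A B : Fq p → Fq p → Bool) →
                 (∀ x z → Sum (λ y → C x y * ℤbit (A y z)) ≡ Sum (λ y → ℤbit (B x y) * C y z)) →
                 ∀ x z → ((λ x y → f (C x y)) · (λ x y → boolTo 𝟘 𝟙 (A x y))) x z ≡ ((λ x y → boolTo 𝟘 𝟙 (B x y)) · (λ x y → f (C x y))) x z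
  f-intertwine C A B e x z = trans (f-∑ (elemsFq p) (C x) (λ y → ℤbit (A y z)) (λ _ → refl) (λ y → f-bit (A y z)))
    (trans (cong f (e x z)) (sym (f-∑ (elemsFq p) (λ y → ℤbit (B x y)) (λ y → C y z) (λ y → f-bit (B x y)) (λ _ → refl))))

-- The two base rings

-- Built in lowest terms with denominator 1, so that membership in every ℤ_(ℓ) reduces to ℓ not
-- dividing 1.
fromℤ : ℤ → ℚ
fromℤ a = mkℚ a 0 (Coprimality.sym (Coprimality.1-coprimeTo ∣ a ∣))

fromℤ-/1 : ∀ a → a ℚ./ 1 ≡ fromℤ a
fromℤ-/1 a = ℚₚ.↥p/↧p≡p (fromℤ a)

fromℤ-+ : ∀ a b → fromℤ (a + b) ≡ fromℤ a ℚ.+ fromℤ b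
fromℤ-+ a b = trans (sym (fromℤ-/1 (a + b))) (cong (ℚ._/ 1) (sym (cong₂ _+_ (*-identityʳ a) (*-identityʳ b))))

fromℤ-* : ∀ a b → fromℤ (a * b) ≡ fromℤ a ℚ.* fromℤ b
fromℤ-* a b = sym (fromℤ-/1 (a * b))

-- ℚ as the number field ℚ[x]/(x).
module ℚK = NF (0ℚ ∷ [])

fromℤK : ℤ → ℚK.K
fromℤK a = fromℤ a ∷ []

fromℤK-+ : ∀ a b → fromℤK (a + b) ≡ fromℤK a ℚK.+K fromℤK b
fromℤK-+ a b = cong (_∷ []) (fromℤ-+ a b)

fromℤK-* : ∀ a b → fromℤK (a * b) ≡ fromℤK a ℚK.*K fromℤK b
fromℤK-* a b = cong (_∷ []) (trans (fromℤ-* a b) (sym (ℚₚ.+-identityʳ (fromℤ a ℚ.* fromℤ b))))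

ℚK-isField : ℚK.IsField
ℚK-isField (x ∷ []) x≢0 = ((ℚ.1/ x) ∷ []) , cong (_∷ []) (trans (ℚₚ.+-identityʳ (x ℚ.* ℚ.1/ x)) (ℚₚ.*-inverseʳ x))
  where instance
  x-nonZero : ℚ.NonZero x
  x-nonZero = ℚ.≢-nonZero (λ q → x≢0 (cong (_∷ []) q))

-- The integer a is a root of the monic polynomial x - a.
fromℤK-isAlgInt : ∀ a → ℚK.IsAlgInt (fromℤK a)
fromℤK-isAlgInt a = 1 , (- a ∷ []) , cong (_∷ []) (begin
  (fromℤ a ℚ.* 1ℚ ℚ.+ 0ℚ) ℚ.+ ((- a ℚ./ 1) ℚ.* 1ℚ ℚ.+ 0ℚ) ≡⟨ cong₂ ℚ._+_ (simplify (fromℤ a)) (trans (simplify (- a ℚ./ 1)) (fromℤ-/1 (- a))) ⟩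
  fromℤ a ℚ.+ fromℤ (- a)                               ≡⟨ fromℤ-+ a (- a) ⟨
  fromℤ (a + - a)                                       ≡⟨ cong fromℤ (+-inverseʳ a) ⟩
  0ℚ                                                    ∎)
  where
  open ≡-Reasoning
  simplify : ∀ q → q ℚ.* 1ℚ ℚ.+ 0ℚ ≡ q
  simplify q = trans (ℚₚ.+-identityʳ (q ℚ.* 1ℚ)) (ℚₚ.*-identityʳ q)

theorem5p1 : (p : ℕ) .{{_ : NonZero p}} → Prime p → p % 4 ≡ 3 →
    (β : Fq p) → IsPrimitive p β →
    (Σ ℕ λ m → Σ (Vec ℚ (suc m)) λ c →
    NF.IsField c × SimilarOverIntegers p c (paleyAdj p) (peisertAdj p β))
    × ((ℓ : ℕ) → Prime ℓ → SimilarOverZloc ℓ p (paleyAdj p) (peisertAdj p β))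
theorem5p1 p pPrime p%4≡3 β generates =
  (0 , (0ℚ ∷ []) , ℚK-isField , (λ x y → fromℤK (C x y)) , (λ x y → fromℤK (C′ x y)) ,
    (λ x y → fromℤK-isAlgInt (C x y) , fromℤK-isAlgInt (C′ x y)) , K.f-inverse C C′ C-C′ , K.f-inverse C′ C C′-C , K.f-intertwine C (paleyAdj p) (peisertAdj p β) C-A)
  , λ ℓ ℓPrime → (λ x y → fromℤ (C x y)) , (λ x y → fromℤ (C′ x y)) ,
    (λ x y → ∤1 ℓPrime , ∤1 ℓPrime) , Q.f-inverse C C′ C-C′ , Q.f-inverse C′ C C′-C , Q.f-intertwine C (paleyAdj p) (peisertAdj p β) C-A
  where
  open Similarity p pPrime p%4≡3 β generates
  module K = Transfer p ℚK._+K_ ℚK._*K_ ℚK.0K ℚK.1K fromℤK refl refl fromℤK-+ fromℤK-*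
  module Q = Transfer p ℚ._+_ ℚ._*_ 0ℚ 1ℚ fromℤ refl refl fromℤ-+ fromℤ-*
  ∤1 : ∀ {ℓ} → Prime ℓ → ¬ (ℓ ℕ∣.∣ 1)
  ∤1 {ℓ} ℓPrime ℓ∣1 = ℕₚ.<⇒≢ (ℕ.nonTrivial⇒n>1 ℓ ⦃ prime⇒nonTrivial ℓPrime ⦄) (sym (ℕ∣.∣1⇒≡1 ℓ∣1))
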